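{- Let $G$ be a maximal nontraceable graph of order $n$. Then $e(G)\ge 10$ if $n=8$, $e(G)\ge 12$ if $n=9$, and $e(G)\ge \tfrac{3n-2}{2}$ if $n\ge 10$.
   Context: Graphs are simple and finite; $e(G)$ is the number of edges. A graph is traceable if it has a hamiltonian path. A graph $G$ is maximal nontraceable if $G$ is not traceable but $G+e$ is traceable for every pair of nonadjacent vertices joined by a new edge $e$. -}

module Defs where

open import Data.Nat using (ℕ; zero; suc; _+_; _<?_)
open import Data.Nat.ListAction using (sum)
open import Data.Fin using (Fin; toℕ)
open import Data.Fin.Properties using (_≟_)
open import Data.Bool using (Bool; true; false; _∨_; _∧_; if_then_else_)
open import Data.List using (List; map; allFin)
open import Data.Product using (Σ; _×_; _,_)
open import Relation.Binary.PropositionalEquality using (_≡_)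
open import Relation.Nullary using (¬_; does)
open import Function.Bundles using (_⤖_; Bijection)

record Graph (n : ℕ) : Set where
  field
    adj    : Fin n → Fin n → Bool
    sym    : ∀ i j → adj i j ≡ adj j i
    irrefl : ∀ i → adj i i ≡ false
open Graph public

bit : Bool → ℕ
bit true = 1
bit false = 0

edgeCount : ∀ {n} → Graph n → ℕ
edgeCount {n} G =
  sum (map (λ i → sum (map (λ j → if does (toℕ i <? toℕ j) then bit (adj G i j) else 0)
                           (allFin n)))
           (allFin n))

HamPath : ∀ {n} → (Fin n → Fin n → Bool) → Set
HamPath {n} a =
  Σ (Fin n ⤖ Fin n) λ p →
    ∀ (k k' : Fin n) → suc (toℕ k) ≡ toℕ k' →
      a (Bijection.to p k) (Bijection.to p k') ≡ true

Traceable : ∀ {n} → Graph n → Set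
Traceable G = HamPath (adj G)

eqB : ∀ {n} → Fin n → Fin n → Bool
eqB a b = does (a ≟ b)

addEdgeAdj : ∀ {n} → Graph n → Fin n → Fin n → (Fin n → Fin n → Bool)
addEdgeAdj G u v x y = adj G x y ∨ ((eqB x u ∧ eqB y v) ∨ (eqB x v ∧ eqB y u))

MaximalNontraceable : ∀ {n} → Graph n → Set
MaximalNontraceable {n} G =
  ¬ Traceable G ×
  (∀ (u v : Fin n) → ¬ (u ≡ v) → adj G u v ≡ false → HamPath (addEdgeAdj G u v))

{-# OPTIONS --safe #-}

-- A vertex of degree 2 has adjacent neighbours, and both have degree at least 4 unless one of them
-- has degree 2.  Call a leaf, or two adjacent vertices of degree 2 with a common third neighbour, a
-- pendant.  Letting every vertex of degree 2 outside the pendants take 1/2 from each neighbour, every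
-- vertex outside the pendants ends with charge at least 3, since a vertex with three such neighbours
-- sharing their other neighbour would give a cutset of two vertices with four components.  A pendant
-- falls short by 2 in total, so a graph with at most one pendant satisfies 2e ≥ 3n − 2.  With two
-- pendants, a Hamiltonian path in G + e has its ends in them; this forces a surplus of at least 3/2 on
-- two further vertices, which suffices by integrality.  With three pendants no Hamiltonian path can
-- arise by joining two vertices outside them, so these form a clique and the edges can be counted;
-- the same count applies when G has a component with at most three vertices.

module Submission where

import Defs
open import Defs using (Graph; adj; irrefl; bit; edgeCount; HamPath; MaximalNontraceable; addEdgeAdj)
import Data.Bool as Bool
open import Data.Bool using (Bool; true; false; if_then_else_)
open import Data.Empty using (⊥; ⊥-elim)
open import Data.Fin using (Fin; zero; suc; toℕ; cast)
open import Data.Fin.Properties using (_≟_; any?; injective⇒≤; toℕ-injective; toℕ-cast; cast-involutive; all?)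
open import Data.List using (List; []; _∷_; _++_; [_]; length; map; reverse; lookup; filter; allFin; tabulate)
open import Data.List.Membership.Propositional using (_∈_; _∉_; find)
open import Data.List.Membership.Propositional.Properties
open import Data.List.Properties using (++-assoc; unfold-reverse; length-tabulate; reverse-++; ∷ʳ-injectiveʳ; ∷-injective; length-++)
open import Data.List.Relation.Binary.Permutation.Propositional as ↭ using (_↭_; ↭-sym)
open import Data.List.Relation.Binary.Permutation.Propositional.Properties using (shift; map⁺; All-resp-↭; ∈-resp-↭; ↭-reverse; ++⁺ˡ)
open import Data.List.Relation.Unary.All as All using (All; []; _∷_)
open import Data.List.Relation.Unary.All.Properties as Allₚ using (¬Any⇒All¬)
open import Data.List.Relation.Unary.AllPairs as AllPairs using (AllPairs; []; _∷_)
open import Data.List.Relation.Unary.Any as Any using (Any; here; there; index)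
import Data.List.Relation.Unary.Any.Properties as Anyₚ
open import Data.List.Relation.Unary.Linked as Linked using (Linked; []; [-]; _∷_)
import Data.List.Relation.Unary.Linked.Properties as Linkedₚ
open import Data.List.Relation.Unary.Unique.Propositional using (Unique)
import Data.List.Relation.Unary.Unique.Propositional.Properties as Uniqueₚ
import Data.Nat as ℕ
open import Data.Nat using (ℕ; zero; suc; _+_; _*_; _∸_; _≤_; _<_; z≤n; s≤s; _≤?_; _<?_)
open import Data.Nat.ListAction using (sum)
open import Data.Nat.ListAction.Properties using (sum-↭)
open import Data.Nat.Properties hiding (_≟_)
open import Data.Nat.Tactic.RingSolver using (solve-∀)
open import Data.Product using (∃; ∃₂; _×_; _,_; proj₁; proj₂)
open import Data.Sum using (_⊎_; inj₁; inj₂; [_,_]′)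
open import Function using (_∘_; id)
open import Function.Bundles using (Bijection; mk⤖)
open import Relation.Binary.Definitions using (tri<; tri≈; tri>)
open import Relation.Binary.PropositionalEquality using (_≡_; _≢_; refl; sym; trans; cong; cong₂; subst; module ≡-Reasoning; subst₂)
open import Relation.Nullary using (¬_; Dec; yes; no; contradiction; does)
open import Relation.Nullary.Decidable using (¬?; dec-true; dec-false; _×-dec_)

-- Maximality is used in one form throughout: if an obstruction to a Hamiltonian path survives the
-- joining of two vertices, these were adjacent already (`forced`). The obstructions are a set `S`
-- whose removal leaves more than |S| + 1 parts (`tough`), three disjoint sets, each cut off by one
-- vertex, competing for the two ends of a path (`three-ends`), and the rerouting of a path through
-- the new edge. An edge with an end in `S` never repairs the first kind, so joining a vertex of `S`
-- to a vertex known not to be its neighbour gives contradictions. Charges are doubled, so that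
-- halves become natural numbers and the target 3 becomes 6. The delicate case is that of two
-- pendants with distinct hubs. The ends of every path are then used up, and the part between the
-- hubs is a path through all remaining vertices (`Span`): it exists after the addition of any edge
-- missing outside the pendants, but not in `G`. The values 10 and 12 are those of three pendant
-- triangles, whose quadratic edge count is still below (3n - 2)/2 for n = 8 and n = 9.

sum-map-⊆ : ∀ {A : Set} (w : A → ℕ) {xs ys} → Unique xs → (∀ {x} → x ∈ xs → x ∈ ys) →
            sum (map w xs) ≤ sum (map w ys)
sum-map-⊆ w {[]} u s = z≤n
sum-map-⊆ w {x ∷ xs} (x∉ ∷ u) s with ∈-∃++ (s (here refl))
... | as , bs , refl = subst (w x + sum (map w xs) ≤_) (sym (sum-↭ (map⁺ w (shift x as bs))))
        (+-monoʳ-≤ (w x) (sum-map-⊆ w u λ z∈ → skip (λ { refl → All.lookup x∉ z∈ refl }) (s (there z∈))))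
  where
  skip : ∀ {z} → z ≢ x → z ∈ as ++ x ∷ bs → z ∈ as ++ bs
  skip z≢x z∈ with ∈-++⁻ as z∈
  ... | inj₁ z∈as = ∈-++⁺ˡ z∈as
  ... | inj₂ (here z≡x) = contradiction z≡x z≢x
  ... | inj₂ (there z∈bs) = ∈-++⁺ʳ as z∈bs

length-⊆ : ∀ {A : Set} {xs ys : List A} → Unique xs → (∀ {x} → x ∈ xs → x ∈ ys) →
           length xs ≤ length ys
length-⊆ {xs = xs} {ys} u s = subst (_≤ length ys) (ones xs)
    (subst (sum (map (λ _ → 1) xs) ≤_) (ones ys) (sum-map-⊆ (λ _ → 1) u s))
  where
  ones : ∀ {A : Set} (zs : List A) → sum (map (λ _ → 1) zs) ≡ length zs
  ones [] = refl
  ones (_ ∷ zs) = cong suc (ones zs)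

Unique-split : ∀ {A : Set} (as : List A) {x bs} → Unique (as ++ x ∷ bs) → x ∉ as × x ∉ bs
Unique-split [] (x∉ ∷ u) = (λ ()) , λ x∈ → All.lookup x∉ x∈ refl
Unique-split (a ∷ as) (a∉ ∷ u) = (λ { (here refl) → All.lookup a∉ (∈-insert as) refl
                                   ; (there x∈) → proj₁ (Unique-split as u) x∈ })
                               , proj₂ (Unique-split as u)

Unique-++ʳ : ∀ {A : Set} (as : List A) {bs} → Unique (as ++ bs) → Unique bs
Unique-++ʳ [] u = u
Unique-++ʳ (a ∷ as) (_ ∷ u) = Unique-++ʳ as u

Unique-++ˡ : ∀ {A : Set} (as : List A) {bs} → Unique (as ++ bs) → Unique as
Unique-++ˡ [] u = []
Unique-++ˡ (a ∷ as) (a∉ ∷ u) = Allₚ.++⁻ˡ as a∉ ∷ Unique-++ˡ as u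

Unique-disjoint : ∀ {A : Set} (as : List A) {bs x} → Unique (as ++ bs) → x ∈ as → x ∉ bs
Unique-disjoint (a ∷ as) (a∉ ∷ u) (here refl) x∈bs = All.lookup a∉ (∈-++⁺ʳ as x∈bs) refl
Unique-disjoint (a ∷ as) (a∉ ∷ u) (there x∈as) x∈bs = Unique-disjoint as u x∈as x∈bs

Unique-resp-↭ : ∀ {A : Set} {l m : List A} → l ↭ m → Unique l → Unique m
Unique-resp-↭ ↭.refl u = u
Unique-resp-↭ (↭.prep x p) (x∉ ∷ u) = All-resp-↭ p x∉ ∷ Unique-resp-↭ p u
Unique-resp-↭ (↭.swap x y p) ((x≢y ∷ x∉) ∷ y∉ ∷ u) =
  ((x≢y ∘ sym) ∷ All-resp-↭ p y∉) ∷ All-resp-↭ p x∉ ∷ Unique-resp-↭ p u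
Unique-resp-↭ (↭.trans p q) u = Unique-resp-↭ q (Unique-resp-↭ p u)

-- Lists whose consecutive entries are related

module _ {A : Set} {R : A → A → Set} where

  Linked-++ : ∀ as {x bs} → Linked R (as ++ [ x ]) → Linked R (x ∷ bs) → Linked R (as ++ x ∷ bs)
  Linked-++ [] l k = k
  Linked-++ (a ∷ []) (r ∷ l) k = r ∷ k
  Linked-++ (a ∷ b ∷ as) (r ∷ l) k = r ∷ Linked-++ (b ∷ as) l k

  Linked-++ˡ : ∀ as {x bs} → Linked R (as ++ x ∷ bs) → Linked R (as ++ [ x ])
  Linked-++ˡ [] l = [-]
  Linked-++ˡ (a ∷ []) (r ∷ l) = r ∷ [-]
  Linked-++ˡ (a ∷ b ∷ as) (r ∷ l) = r ∷ Linked-++ˡ (b ∷ as) l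

  Linked-++ʳ : ∀ as {bs} → Linked R (as ++ bs) → Linked R bs
  Linked-++ʳ [] l = l
  Linked-++ʳ (a ∷ as) l = Linked-++ʳ as (Linked.tail l)

  Linked-reverse : (∀ {a b} → R a b → R b a) → ∀ {l} → Linked R l → Linked R (reverse l)
  Linked-reverse s {[]} l = []
  Linked-reverse s {x ∷ []} l = [-]
  Linked-reverse s {x ∷ y ∷ l} (r ∷ k) = subst (Linked R) (sym eq)
      (Linked-++ (reverse l) (subst (Linked R) (unfold-reverse y l) (Linked-reverse s k)) (s r ∷ [-]))
    where
    eq : reverse (x ∷ y ∷ l) ≡ reverse l ++ y ∷ x ∷ []
    eq = trans (unfold-reverse x (y ∷ l)) (trans (cong (_++ [ x ]) (unfold-reverse y l)) (++-assoc (reverse l) [ y ] [ x ]))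

  Linked-map∈ : ∀ {S : A → A → Set} {l} → (∀ {a b} → a ∈ l → b ∈ l → R a b → S a b) → Linked R l → Linked S l
  Linked-map∈ f [] = []
  Linked-map∈ f [-] = [-]
  Linked-map∈ f (r ∷ k) = f (here refl) (there (here refl)) r
    ∷ Linked-map∈ (λ a∈ b∈ → f (there a∈) (there b∈)) k

  -- Used to locate an exceptional link in a path: a crossing of the new edge, or an edge that an
  -- exchange of vertices does not preserve.
  Linked-⊎ : ∀ {S : A → A → Set} {T : A → A → Set} → (∀ {a b} → R a b → S a b ⊎ T a b) → ∀ {l} → Linked R l →
    Linked S l ⊎ (∃₂ λ as p → ∃₂ λ q bs → l ≡ as ++ p ∷ q ∷ bs × T p q)
  Linked-⊎ f [] = inj₁ []
  Linked-⊎ f [-] = inj₁ [-]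
  Linked-⊎ f {x ∷ y ∷ l} (r ∷ k) with f r | Linked-⊎ f k
  ... | inj₂ t | _ = inj₂ ([] , x , y , l , refl , t)
  ... | inj₁ s | inj₁ k′ = inj₁ (s ∷ k′)
  ... | inj₁ s | inj₂ (as , p , q , bs , eq , t) = inj₂ (x ∷ as , p , q , bs , cong (x ∷_) eq , t)

last′ : ∀ {A : Set} → A → List A → A
last′ x [] = x
last′ x (y ∷ l) = last′ y l

last′∈ : ∀ {A : Set} (x : A) l → last′ x l ∈ x ∷ l
last′∈ x [] = here refl
last′∈ x (y ∷ l) = there (last′∈ y l)

last′-++ : ∀ {A : Set} (x : A) as y bs → last′ x (as ++ y ∷ bs) ≡ last′ y bs
last′-++ x [] y bs = refl
last′-++ x (a ∷ as) y bs = last′-++ a as y bs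

-- Walks and sets closed modulo separating vertices

module Walks {n : ℕ} (R : Fin n → Fin n → Set) (R-sym : ∀ {a b} → R a b → R b a) where

  open import Data.List.Membership.DecPropositional (_≟_ {n}) using (_∈?_)

  -- For `P` disjoint from `S` this says that `P` is a union of components of what remains after the
  -- removal of `S`.
  Closed : (Fin n → Set) → List (Fin n) → Set
  Closed P S = ∀ {p q} → P p → R p q → P q ⊎ q ∈ S

  record HamList : Set where
    constructor hamList
    field
      walk     : List (Fin n)
      unique   : Unique walk
      complete : ∀ v → v ∈ walk
      linked   : Linked R walk

  module _ {P : Fin n → Set} {S : List (Fin n)} (cl : Closed P S) where

    avoid→ : ∀ {x l} → Linked R (x ∷ l) → (∀ {s} → s ∈ S → s ∉ x ∷ l) → ¬ P x → All (¬_ ∘ P) (x ∷ l)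
    avoid→ [-] ns ¬p = ¬p ∷ []
    avoid→ (r ∷ k) ns ¬p = ¬p ∷ avoid→ k (λ s∈ → ns s∈ ∘ there)
      λ p → [ ¬p , (λ x∈ → ns x∈ (here refl)) ]′ (cl p (R-sym r))

    -- The starting vertex itself may lie in `S`, so that this applies to the part of a path from
    -- its cut vertex onwards.
    avoid← : ∀ {x l} → Linked R (x ∷ l) → (∀ {s} → s ∈ S → s ∉ l) → ¬ P (last′ x l) → All (¬_ ∘ P) (x ∷ l)
    avoid← [-] ns ¬p = ¬p ∷ []
    avoid← (r ∷ k) ns ¬p with avoid← k (λ s∈ → ns s∈ ∘ there) ¬p
    ... | ¬q ∷ ps = (λ p → [ ¬q , (λ y∈ → ns y∈ (here refl)) ]′ (cl p r)) ∷ ¬q ∷ ps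

  module _ {P : Fin n → Set} {y : Fin n} (cl : Closed P [ y ]) (¬Py : ¬ P y) where

    -- Entering `P` and leaving it again would both pass through `y`, which a path visits only once.
    avoid : ∀ {x l} → Linked R (x ∷ l) → Unique (x ∷ l) → ¬ P x → ¬ P (last′ x l) → All (¬_ ∘ P) (x ∷ l)
    avoid [-] u ¬p ¬e = ¬p ∷ []
    avoid {x} (r ∷ k) (x∉ ∷ u) ¬p ¬e with x ≟ y
    ... | yes refl = avoid← cl (r ∷ k) (λ { (here refl) y∈ → All.lookup x∉ y∈ refl }) ¬e
    ... | no x≢y = ¬p ∷ avoid k u (λ p → [ ¬p , (λ { (here x≡y) → x≢y x≡y }) ]′ (cl p (R-sym r))) ¬e

    end-in : ∀ {x l} → Linked R (x ∷ l) → Unique (x ∷ l) → (∀ v → Dec (P v)) →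
             ∀ {v} → v ∈ x ∷ l → P v → P x ⊎ P (last′ x l)
    end-in {x} {l} k u P? v∈ pv with P? x | P? (last′ x l)
    ... | yes p | _ = inj₁ p
    ... | no _ | yes p = inj₂ p
    ... | no ¬p | no ¬q = contradiction pv (All.lookup (avoid k u ¬p ¬q) v∈)

    prefix : ∀ {x l} → Linked R (x ∷ l) → P x → y ∈ x ∷ l →
             ∃₂ λ as bs → x ∷ l ≡ as ++ y ∷ bs × All P as
    prefix k p (here refl) = contradiction p ¬Py
    prefix {x} (r ∷ k) p (there y∈) with cl p r
    ... | inj₂ (here refl) = [ x ] , _ , refl , p ∷ []
    ... | inj₁ q with prefix k q y∈
    ... | as , bs , eq , ps = x ∷ as , bs , cong (x ∷_) eq , p ∷ ps

    all← : ∀ {x l} → Linked R (x ∷ l) → y ∉ x ∷ l → P (last′ x l) → All P (x ∷ l)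
    all← [-] y∉ p = p ∷ []
    all← (r ∷ k) y∉ p with all← k (y∉ ∘ there) p
    ... | q ∷ ps with cl q (R-sym r)
    ... | inj₁ p′ = p′ ∷ q ∷ ps
    ... | inj₂ (here refl) = contradiction (here refl) y∉

    suffix : ∀ {x l} → Linked R (x ∷ l) → Unique (x ∷ l) → P (last′ x l) → y ∈ x ∷ l →
             ∃₂ λ as bs → x ∷ l ≡ as ++ y ∷ bs × All P bs
    suffix [-] u p (here refl) = contradiction p ¬Py
    suffix (r ∷ k) (y∉ ∷ u) p (here refl) = [] , _ , refl , all← k (λ y∈ → All.lookup y∉ y∈ refl) p
    suffix {x} (r ∷ k) (_ ∷ u) p (there y∈) with suffix k u p y∈
    ... | as , bs , eq , ps = x ∷ as , bs , cong (x ∷_) eq , ps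

  -- By `end-in` each of the three sets contains an end of the path, and there are only two ends.
  -- The cut vertices may differ or coincide.
  three-ends : ∀ {P Q T : Fin n → Set} {x y z : Fin n} →
    (P? : ∀ v → Dec (P v)) (Q? : ∀ v → Dec (Q v)) (T? : ∀ v → Dec (T v)) →
    Closed P [ x ] → Closed Q [ y ] → Closed T [ z ] →
    ¬ P x → ¬ Q y → ¬ T z → ∃ P → ∃ Q → ∃ T →
    (∀ {v} → P v → ¬ Q v) → (∀ {v} → P v → ¬ T v) → (∀ {v} → Q v → ¬ T v) → ¬ HamList
  three-ends P? Q? T? cP cQ cT ¬x ¬y ¬z (p , Pp) (q , Qq) (t , Tt) PQ PT QT (hamList [] u c k) with c p
  ... | ()
  three-ends P? Q? T? cP cQ cT ¬x ¬y ¬z (p , Pp) (q , Qq) (t , Tt) PQ PT QT (hamList (_ ∷ _) u c k)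
    with end-in cP ¬x k u P? (c p) Pp | end-in cQ ¬y k u Q? (c q) Qq | end-in cT ¬z k u T? (c t) Tt
  ... | inj₁ a | inj₁ b | _ = PQ a b
  ... | inj₂ a | inj₂ b | _ = PQ a b
  ... | inj₁ a | inj₂ b | inj₁ d = PT a d
  ... | inj₁ a | inj₂ b | inj₂ d = QT b d
  ... | inj₂ a | inj₁ b | inj₁ d = QT b d
  ... | inj₂ a | inj₁ b | inj₂ d = PT a d

  -- The starts include the first vertex of every maximal run avoiding S, so a set closed modulo S
  -- that meets the walk contains one of them.
  module _ (S : List (Fin n)) where

    restarts : List (Fin n) → List (Fin n)
    starts : List (Fin n) → List (Fin n)
    restarts [] = []
    restarts (x ∷ l) with x ∈? S
    ... | yes _ = starts l
    ... | no _ = restarts l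
    starts [] = []
    starts (x ∷ l) = x ∷ restarts (x ∷ l)

    hits : List (Fin n) → ℕ
    hits l = length (filter (_∈? S) l)

    restarts-bound : ∀ l → length (restarts l) ≤ hits l
    starts-bound : ∀ l → length (starts l) ≤ suc (hits l)
    starts-bound [] = z≤n
    starts-bound (x ∷ l) = s≤s (restarts-bound (x ∷ l))
    restarts-bound [] = z≤n
    restarts-bound (x ∷ l) with x ∈? S
    ... | yes _ = starts-bound l
    ... | no _ = restarts-bound l

    module _ {P : Fin n → Set} (cl : Closed P S) (¬S : ∀ {s} → s ∈ S → ¬ P s) where

      starts-cover : ∀ {l} → Linked R l → All (¬_ ∘ P) (starts l) → All (¬_ ∘ P) l
      restarts-cover : ∀ {x l} → Linked R (x ∷ l) → ¬ P x → All (¬_ ∘ P) (restarts (x ∷ l)) → All (¬_ ∘ P) l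
      starts-cover {[]} k ps = []
      starts-cover {x ∷ l} k (¬p ∷ ps) = ¬p ∷ restarts-cover k ¬p ps
      restarts-cover {x} {[]} k ¬p ps = []
      restarts-cover {x} {y ∷ l} (r ∷ k) ¬p ps with x ∈? S
      ... | yes _ = starts-cover k ps
      ... | no x∉ = ¬q ∷ restarts-cover k ¬q ps
        where
        ¬q : ¬ P y
        ¬q q = [ ¬p , x∉ ]′ (cl q (R-sym r))

  -- Cutting a Hamiltonian path at the vertices of `S` leaves at most |S| + 1 runs. Every `P i`
  -- contains a start of a run, and disjointness makes the choice of such a start injective in `i`.
  tough : ∀ {k} (S : List (Fin n)) (P : Fin k → Fin n → Set) → (∀ i v → Dec (P i v)) →
    (∀ i → Closed (P i) S) → (∀ i {s} → s ∈ S → ¬ P i s) → (∀ i → ∃ (P i)) →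
    (∀ {i j v} → P i v → P j v → i ≡ j) → suc (length S) < k → ¬ HamList
  tough {k} S P P? cl ¬S ex disj lt (hamList l u c lk) = <⇒≱ lt
      (≤-trans (injective⇒≤ {f = f} f-inj)
      (≤-trans (starts-bound S l) (s≤s (length-⊆ (Uniqueₚ.filter⁺ (_∈? S) u) (proj₂ ∘ ∈-filter⁻ (_∈? S) {xs = l})))))
    where
    found : ∀ i → Any (P i) (starts S l)
    found i with Any.any? (P? i) (starts S l)
    ... | yes a = a
    ... | no ¬a = contradiction (proj₂ (ex i)) (All.lookup (starts-cover S (cl i) (¬S i) lk (¬Any⇒All¬ _ ¬a)) (c (proj₁ (ex i))))
    f : Fin k → Fin (length (starts S l))
    f i = index (found i)
    f-inj : ∀ {i j} → f i ≡ f j → i ≡ j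
    f-inj {i} {j} eq = disj (Anyₚ.lookup-index (found i)) (subst (P j ∘ lookup (starts S l)) (sym eq) (Anyₚ.lookup-index (found j)))

-- Sums over lists and over all vertices

sum-map-≤ : ∀ {A : Set} {f g : A → ℕ} l → (∀ x → f x ≤ g x) → sum (map f l) ≤ sum (map g l)
sum-map-≤ [] h = z≤n
sum-map-≤ (x ∷ l) h = +-mono-≤ (h x) (sum-map-≤ l h)

sum-map-cong : ∀ {A : Set} {f g : A → ℕ} l → (∀ x → f x ≡ g x) → sum (map f l) ≡ sum (map g l)
sum-map-cong l h = ≤-antisym (sum-map-≤ l (≤-reflexive ∘ h)) (sum-map-≤ l (≤-reflexive ∘ sym ∘ h))

sum-map-+ : ∀ {A : Set} (f g : A → ℕ) l → sum (map (λ x → f x + g x) l) ≡ sum (map f l) + sum (map g l)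
sum-map-+ f g [] = refl
sum-map-+ f g (x ∷ l) rewrite sum-map-+ f g l = interchange (f x) (g x) _ _
  where
  interchange : ∀ a b c d → (a + b) + (c + d) ≡ (a + c) + (b + d)
  interchange = solve-∀

sum-map-* : ∀ {A : Set} c (f : A → ℕ) l → sum (map (λ x → c * f x) l) ≡ c * sum (map f l)
sum-map-* c f [] = sym (*-zeroʳ c)
sum-map-* c f (x ∷ l) rewrite sum-map-* c f l = sym (*-distribˡ-+ c (f x) _)

sum-map-const : ∀ {A : Set} c (l : List A) → sum (map (λ _ → c) l) ≡ length l * c
sum-map-const c [] = refl
sum-map-const c (x ∷ l) = cong (c +_) (sum-map-const c l)

sum-map-swap : ∀ {A B : Set} (f : A → B → ℕ) l m →
  sum (map (λ x → sum (map (f x) m)) l) ≡ sum (map (λ y → sum (map (λ x → f x y) l)) m)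
sum-map-swap f [] m = sym (trans (sum-map-const 0 m) (*-zeroʳ (length m)))
sum-map-swap f (x ∷ l) m rewrite sum-map-swap f l m = sym (sum-map-+ (f x) _ m)

module _ {n : ℕ} where

  Σ[_] : (Fin n → ℕ) → ℕ
  Σ[ f ] = sum (map f (allFin n))

  Σ-const : ∀ c → Σ[ (λ _ → c) ] ≡ n * c
  Σ-const c = trans (sum-map-const c (allFin n)) (cong (_* c) (length-tabulate {n = n} id))

  δ : Fin n → Fin n → ℕ
  δ x v = bit (does (v ≟ x))

  δ-refl : ∀ x → δ x x ≡ 1
  δ-refl x with x ≟ x
  ... | yes _ = refl
  ... | no x≢x = contradiction refl x≢x

  δ-≢ : ∀ {x v} → v ≢ x → δ x v ≡ 0
  δ-≢ {x} {v} v≢x with v ≟ x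
  ... | yes v≡x = contradiction v≡x v≢x
  ... | no _ = refl

  Σ-δ : ∀ x → Σ[ δ x ] ≡ 1
  Σ-δ x = one (Uniqueₚ.allFin⁺ n) (∈-allFin x)
    where
    none : ∀ {l} → x ∉ l → sum (map (δ x) l) ≡ 0
    none {[]} x∉ = refl
    none {y ∷ l} x∉ rewrite δ-≢ (λ (y≡x : y ≡ x) → x∉ (here (sym y≡x))) = none (x∉ ∘ there)
    one : ∀ {l} → Unique l → x ∈ l → sum (map (δ x) l) ≡ 1
    one (y∉ ∷ u) (here refl) rewrite δ-refl x = cong suc (none (λ x∈ → All.lookup y∉ x∈ refl))
    one (y∉ ∷ u) (there x∈) rewrite δ-≢ (All.lookup y∉ x∈) = one u x∈

-- Neighbourhoods, degrees and the handshake lemma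

module Degrees {n : ℕ} (G : Graph n) where

  E : Fin n → Fin n → Set
  E u v = adj G u v ≡ true

  E? : ∀ u v → Dec (E u v)
  E? u v = adj G u v Bool.≟ true

  E-sym : ∀ {u v} → E u v → E v u
  E-sym {u} {v} = trans (Defs.sym G v u)

  E⇒≢ : ∀ {u v} → E u v → u ≢ v
  E⇒≢ {u} e refl with trans (sym e) (irrefl G u)
  ... | ()

  nb : Fin n → List (Fin n)
  nb v = filter (E? v) (allFin n)

  D : Fin n → ℕ
  D v = length (nb v)

  nb-unique : ∀ v → Unique (nb v)
  nb-unique v = Uniqueₚ.filter⁺ (E? v) (Uniqueₚ.allFin⁺ n)

  nb⁺ : ∀ {v u} → E v u → u ∈ nb v
  nb⁺ {v} {u} e = ∈-filter⁺ (E? v) (∈-allFin u) e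

  nb⁻ : ∀ {v u} → u ∈ nb v → E v u
  nb⁻ {v} = proj₂ ∘ ∈-filter⁻ (E? v) {xs = allFin n}

  sum-nb : ∀ (w : Fin n → ℕ) v → sum (map w (nb v)) ≡ Σ[ (λ u → bit (adj G v u) * w u) ]
  sum-nb w v = go (allFin n)
    where
    go : ∀ l → sum (map w (filter (E? v) l)) ≡ sum (map (λ u → bit (adj G v u) * w u) l)
    go [] = refl
    go (u ∷ l) with adj G v u
    ... | true = cong₂ _+_ (sym (+-identityʳ (w u))) (go l)
    ... | false = go l

  D≡Σ : ∀ v → D v ≡ Σ[ (λ u → bit (adj G v u)) ]
  D≡Σ v = trans (sym (trans (sum-map-const 1 (nb v)) (*-identityʳ _)))
            (trans (sum-nb (λ _ → 1) v) (sum-map-cong (allFin n) (λ u → *-identityʳ _)))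

  -- The adjacency matrix splits into its strictly upper and strictly lower triangles, the diagonal
  -- being zero; exchanging the order of summation turns the lower one into a second copy of
  -- `edgeCount`.
  ΣD≡2e : Σ[ D ] ≡ 2 * edgeCount G
  ΣD≡2e = begin
    Σ[ D ] ≡⟨ sum-map-cong (allFin n) D≡Σ ⟩
    Σ[ (λ i → Σ[ (λ j → bit (adj G i j)) ]) ]
      ≡⟨ sum-map-cong (allFin n) (λ i → trans (sum-map-cong (allFin n) (split i)) (sum-map-+ (up i) (λ j → up j i) (allFin n))) ⟩
    Σ[ (λ i → Σ[ up i ] + Σ[ (λ j → up j i) ]) ]
      ≡⟨ sum-map-+ (λ i → Σ[ up i ]) (λ i → Σ[ (λ j → up j i) ]) (allFin n) ⟩
    edgeCount G + Σ[ (λ i → Σ[ (λ j → up j i) ]) ]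
      ≡⟨ cong (edgeCount G +_) (trans (sum-map-swap (λ i j → up j i) (allFin n) (allFin n)) (sym (+-identityʳ _))) ⟩
    2 * edgeCount G ∎
    where
    open ≡-Reasoning
    up : Fin n → Fin n → ℕ
    up i j = if does (toℕ i <? toℕ j) then bit (adj G i j) else 0
    split : ∀ i j → bit (adj G i j) ≡ up i j + up j i
    split i j with <-cmp (toℕ i) (toℕ j)
    ... | tri< p _ q rewrite dec-true (toℕ i <? toℕ j) p | dec-false (toℕ j <? toℕ i) q = sym (+-identityʳ _)
    ... | tri> q _ p rewrite dec-false (toℕ i <? toℕ j) q | dec-true (toℕ j <? toℕ i) p = cong bit (Defs.sym G i j)
    ... | tri≈ p eq q rewrite dec-false (toℕ i <? toℕ j) p | dec-false (toℕ j <? toℕ i) q =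
      cong bit (trans (cong (adj G i) (sym (toℕ-injective eq))) (irrefl G i))

  sum≤nb : ∀ (w : Fin n → ℕ) {v xs} → Unique xs → All (E v) xs → sum (map w xs) ≤ sum (map w (nb v))
  sum≤nb w u es = sum-map-⊆ w u (nb⁺ ∘ All.lookup es)

  length≤D : ∀ {v xs} → Unique xs → All (E v) xs → length xs ≤ D v
  length≤D u es = length-⊆ u (nb⁺ ∘ All.lookup es)

  open import Data.List.Membership.DecPropositional (_≟_ {n}) using (_∈?_)

  fresh : ∀ {v} xs → length xs < D v → ∃ λ u → E v u × u ∉ xs
  fresh {v} xs lt with Any.any? (λ u → ¬? (u ∈? xs)) (nb v)
  ... | yes a = let u , u∈ , u∉ = find a in u , nb⁻ u∈ , u∉
  ... | no ¬a = contradiction (length-⊆ (nb-unique v) λ {u} u∈ → all u∈) (<⇒≱ lt)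
    where
    all : ∀ {u} → u ∈ nb v → u ∈ xs
    all {u} u∈ with u ∈? xs
    ... | yes p = p
    ... | no u∉ = contradiction (Any.map (λ { refl → u∉ }) u∈) ¬a

  saturated : ∀ {v xs} → D v ≤ length xs → Unique xs → All (E v) xs → ∀ {u} → E v u → u ∈ xs
  saturated {v} {xs} le uq es {u} e with u ∈? xs
  ... | yes p = p
  ... | no u∉ = contradiction (length≤D (All.tabulate (λ { x∈ refl → u∉ x∈ }) ∷ uq) (e ∷ es)) (<⇒≱ (s≤s le))

Unique-split-≡ : ∀ {A : Set} (as cs : List A) {x bs ds} → Unique (as ++ x ∷ bs) →
                 as ++ x ∷ bs ≡ cs ++ x ∷ ds → as ≡ cs × bs ≡ ds
Unique-split-≡ [] [] u refl = refl , refl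
Unique-split-≡ [] (c ∷ cs) (x∉ ∷ u) refl = contradiction refl (All.lookup x∉ (∈-insert cs))
Unique-split-≡ (a ∷ as) [] (a∉ ∷ u) refl = contradiction refl (All.lookup a∉ (∈-insert as))
Unique-split-≡ (a ∷ as) (c ∷ cs) (_ ∷ u) eq with ∷-injective eq
... | refl , eq′ = let p , q = Unique-split-≡ as cs u eq′ in cong (a ∷_) p , q

Linked-last′ : ∀ {A : Set} {R : A → A → Set} {c} cs {v bs} → Linked R (c ∷ cs ++ v ∷ bs) → R (last′ c cs) v
Linked-last′ [] (r ∷ k) = r
Linked-last′ (_ ∷ cs) (_ ∷ k) = Linked-last′ cs k

-- Hamiltonian paths as bijections and as lists

module _ {n : ℕ} {a : Fin n → Fin n → Bool} (a-sym : ∀ {u v} → a u v ≡ true → a v u ≡ true) where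

  open Walks (λ u v → a u v ≡ true) a-sym using (HamList; hamList)

  HamPath⇒HamList : HamPath a → HamList
  HamPath⇒HamList (p , link) = hamList (tabulate to) (Uniqueₚ.tabulate⁺ injective)
      (λ v → let k , f = surjective v in subst (_∈ tabulate to) (f refl) (∈-tabulate⁺ k))
      (tab to link)
    where
    open Bijection p using (to; injective; surjective)
    tab : ∀ {m} (f : Fin m → Fin n) → (∀ k k′ → suc (toℕ k) ≡ toℕ k′ → a (f k) (f k′) ≡ true) →
          Linked (λ u v → a u v ≡ true) (tabulate f)
    tab {zero} f h = []
    tab {suc zero} f h = [-]
    tab {suc (suc m)} f h = h zero (suc zero) refl ∷ tab (f ∘ suc) (λ k k′ eq → h (suc k) (suc k′) (cong suc eq))

  HamList⇒HamPath : HamList → HamPath a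
  HamList⇒HamPath (hamList l u c k) = mk⤖ (inj , surj) , link
    where
    len : length l ≡ n
    len = trans (≤-antisym (length-⊆ u (λ _ → ∈-allFin _)) (length-⊆ (Uniqueₚ.allFin⁺ n) (λ _ → c _)))
                (length-tabulate {n = n} id)
    lookup-inj : ∀ {l : List (Fin n)} → Unique l → ∀ {i j} → lookup l i ≡ lookup l j → i ≡ j
    lookup-inj (x∉ ∷ u) {zero} {zero} eq = refl
    lookup-inj (x∉ ∷ u) {zero} {suc j} eq = contradiction eq (All.lookup x∉ (∈-lookup j))
    lookup-inj (x∉ ∷ u) {suc i} {zero} eq = contradiction (sym eq) (All.lookup x∉ (∈-lookup i))
    lookup-inj (x∉ ∷ u) {suc i} {suc j} eq = cong suc (lookup-inj u eq)
    to : Fin n → Fin n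
    to i = lookup l (cast (sym len) i)
    inj : ∀ {i j} → to i ≡ to j → i ≡ j
    inj {i} {j} eq = toℕ-injective (trans (sym (toℕ-cast (sym len) i))
      (trans (cong toℕ (lookup-inj u eq)) (toℕ-cast (sym len) j)))
    surj : ∀ v → ∃ λ i → ∀ {z} → z ≡ i → to z ≡ v
    surj v = cast len (index (c v)) , λ { refl →
      trans (cong (lookup l) (cast-involutive (sym len) len (index (c v)))) (sym (Anyₚ.lookup-index (c v))) }
    step : ∀ {l : List (Fin n)} → Linked (λ u v → a u v ≡ true) l →
           ∀ i j → suc (toℕ i) ≡ toℕ j → a (lookup l i) (lookup l j) ≡ true
    step (r ∷ k) zero (suc zero) eq = r
    step (r ∷ k) (suc i) (suc j) eq = step k i j (suc-injective eq)
    link : ∀ i j → suc (toℕ i) ≡ toℕ j → a (to i) (to j) ≡ true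
    link i j eq = step k _ _ (trans (cong suc (toℕ-cast (sym len) i)) (trans eq (sym (toℕ-cast (sym len) j))))

-- Adding an edge to a maximal nontraceable graph

module Maximal {n : ℕ} (G : Graph n) (mnt : MaximalNontraceable G) where

  open Degrees G public

  -- An inductive form of `addEdgeAdj`: matching on it separates the edges of `G` from the two
  -- directions of the new edge.
  data E⁺ (u v : Fin n) : Fin n → Fin n → Set where
    old : ∀ {p q} → E p q → E⁺ u v p q
    new : E⁺ u v u v
    wen : E⁺ u v v u

  E⁺-sym : ∀ {u v p q} → E⁺ u v p q → E⁺ u v q p
  E⁺-sym (old e) = old (E-sym e)
  E⁺-sym new = wen
  E⁺-sym wen = new

  E⁺-swap : ∀ {u v p q} → E⁺ u v p q → E⁺ v u p q
  E⁺-swap (old e) = old e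
  E⁺-swap new = wen
  E⁺-swap wen = new

  open module WE = Walks E E-sym using (hamList)
  module W⁺ u v = Walks (E⁺ u v) E⁺-sym

  Hamiltonian : Set
  Hamiltonian = WE.HamList

  Hamiltonian⁺ : Fin n → Fin n → Set
  Hamiltonian⁺ u v = W⁺.HamList u v

  ¬hamiltonian : ¬ Hamiltonian
  ¬hamiltonian h = proj₁ mnt (HamList⇒HamPath E-sym h)

  private
    add-sound : ∀ u v p q → addEdgeAdj G u v p q ≡ true → E⁺ u v p q
    add-sound u v p q eq with adj G p q in e
    ... | true = old e
    ... | false with p ≟ u | q ≟ v | p ≟ v | q ≟ u
    ... | yes refl | yes refl | _ | _ = new
    ... | yes refl | no _ | yes refl | yes refl = new
    ... | no _ | _ | yes refl | yes refl = wen
    ... | yes refl | no _ | yes _ | no _ with eq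
    ... | ()
    add-sound u v p q eq | false | yes refl | no _ | no _ | _ with eq
    ... | ()
    add-sound u v p q eq | false | no _ | _ | yes _ | no _ with eq
    ... | ()
    add-sound u v p q eq | false | no _ | _ | no _ | _ with eq
    ... | ()

    add-complete : ∀ {u v p q} → E⁺ u v p q → addEdgeAdj G u v p q ≡ true
    add-complete {u} {v} (old e) rewrite e = refl
    add-complete {u} {v} new with adj G u v
    ... | true = refl
    ... | false rewrite dec-true (u ≟ u) refl | dec-true (v ≟ v) refl = refl
    add-complete {u} {v} wen with adj G v u
    ... | true = refl
    ... | false rewrite dec-true (u ≟ u) refl | dec-true (v ≟ v) refl with v ≟ u | u ≟ v
    ... | yes _ | yes _ = refl
    ... | yes _ | no _ = refl
    ... | no _ | _ = refl

  hamiltonian⁺ : ∀ {u v} → u ≢ v → ¬ E u v → Hamiltonian⁺ u v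
  hamiltonian⁺ {u} {v} u≢v ¬e with adj G u v in eq
  ... | true = contradiction refl ¬e
  ... | false with HamPath⇒HamList {a = addEdgeAdj G u v}
                     (λ e → add-complete (E⁺-sym (add-sound u v _ _ e))) (proj₂ mnt u v u≢v eq)
  ... | Walks.hamList l uq c k = Walks.hamList l uq c (Linked.map (add-sound u v _ _) k)

  -- The working form of maximality: edges of `G` are produced by refuting a Hamiltonian path of `G`
  -- + `uv`.
  forced : ∀ {u v} → u ≢ v → ¬ Hamiltonian⁺ u v → E u v
  forced {u} {v} u≢v ¬h with E? u v
  ... | yes e = e
  ... | no ¬e = contradiction (hamiltonian⁺ u≢v ¬e) ¬h

  -- Only the ends of the new edge have to be checked again, and an end that lies in `S` is
  -- harmless.
  closed⁺ : ∀ {u v P S} → WE.Closed P S → (P u → P v ⊎ v ∈ S) → (P v → P u ⊎ u ∈ S) → W⁺.Closed u v P S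
  closed⁺ cl f g p (old e) = cl p e
  closed⁺ cl f g p new = f p
  closed⁺ cl f g p wen = g p

  old∉ : ∀ {u v p q} → p ≢ u → p ≢ v → E⁺ u v p q → E p q
  old∉ p≢u p≢v (old e) = e
  old∉ p≢u p≢v new = contradiction refl p≢u
  old∉ p≢u p≢v wen = contradiction refl p≢v

  Linked-old : ∀ {u v l} → u ∉ l → Linked (E⁺ u v) l → Linked E l
  Linked-old u∉ = Linked-map∈ λ { _ _ (old e) → e ; a∈ _ new → contradiction a∈ u∉ ; _ b∈ wen → contradiction b∈ u∉ }

  Linked-old′ : ∀ {u v l} → v ∉ l → Linked (E⁺ u v) l → Linked E l
  Linked-old′ v∉ k = Linked-old v∉ (Linked.map E⁺-swap k)

  record Through (u v : Fin n) : Set where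
    constructor through
    field
      before after : List (Fin n)
      unique       : Unique (before ++ u ∷ v ∷ after)
      complete     : ∀ w → w ∈ before ++ u ∷ v ∷ after
      linked       : Linked (E⁺ u v) (before ++ u ∷ v ∷ after)

  reverse-split : ∀ (as : List (Fin n)) {p q bs} → reverse (as ++ p ∷ q ∷ bs) ≡ reverse bs ++ q ∷ p ∷ reverse as
  reverse-split as {p} {q} {bs} = begin
    reverse (as ++ p ∷ q ∷ bs)                  ≡⟨ reverse-++ as (p ∷ q ∷ bs) ⟩
    reverse (p ∷ q ∷ bs) ++ reverse as          ≡⟨ cong (_++ reverse as) (trans (unfold-reverse p (q ∷ bs)) (cong (_++ [ p ]) (unfold-reverse q bs))) ⟩
    ((reverse bs ++ [ q ]) ++ [ p ]) ++ reverse as ≡⟨ ++-assoc (reverse bs ++ [ q ]) [ p ] (reverse as) ⟩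
    (reverse bs ++ [ q ]) ++ p ∷ reverse as     ≡⟨ ++-assoc (reverse bs) [ q ] (p ∷ reverse as) ⟩
    reverse bs ++ q ∷ p ∷ reverse as            ∎
    where open ≡-Reasoning

  flip-through : ∀ {u v} → Through u v → Through v u
  flip-through {u} {v} (through as bs uq c k) =
    through (reverse bs) (reverse as) (subst Unique eq (Unique-resp-↭ (↭-sym (↭-reverse _)) uq))
      (λ w → subst (w ∈_) eq (Anyₚ.reverse⁺ (c w)))
      (subst (Linked (E⁺ v u)) eq (Linked.map E⁺-swap (Linked-reverse E⁺-sym k)))
    where
    eq = reverse-split as

  -- A path that never crosses the new edge would be a Hamiltonian path of `G`; reversal takes care
  -- of the direction of the crossing.
  through-edge : ∀ {u v} → Hamiltonian⁺ u v → Through u v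
  through-edge {u} {v} (Walks.hamList l uq c k)
    with Linked-⊎ {S = E} {T = λ p q → (p ≡ u × q ≡ v) ⊎ (p ≡ v × q ≡ u)}
           (λ { (old e) → inj₁ e ; new → inj₂ (inj₁ (refl , refl)) ; wen → inj₂ (inj₂ (refl , refl)) }) k
  ... | inj₁ k′ = contradiction (hamList l uq c k′) ¬hamiltonian
  ... | inj₂ (as , p , q , bs , refl , inj₁ (refl , refl)) = through as bs uq c k
  ... | inj₂ (as , p , q , bs , refl , inj₂ (refl , refl)) =
          flip-through (through as bs uq c (Linked.map E⁺-swap k))

  -- A Hamiltonian path through the new edge xy avoids x v and v y, so v is an end of the path;
  -- moving v between x and y gives a Hamiltonian path of G.
  nbrs-adjacent : ∀ {v x y} → E v x → E v y → x ≢ y → (∀ {u} → E v u → u ≡ x ⊎ u ≡ y) → E x y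
  nbrs-adjacent {v} {x} {y} vx vy x≢y Nv = forced x≢y (either ∘ through-edge)
    where
    module _ {x y} (vx : E v x) (vy : E v y) (Nv : ∀ {u} → E v u → u ≡ x ⊎ u ≡ y) where
      core : (t : Through x y) → v ∉ Through.before t
      core (through as bs uq c k) v∈ with ∈-∃++ v∈
      core (through _ bs uq c k) v∈ | cs , d ∷ ds , refl
        with Nv (old∉ (E⇒≢ vx) (E⇒≢ vy) (Linked.head (Linked-++ʳ cs (subst (Linked (E⁺ x y)) (++-assoc cs (v ∷ d ∷ ds) (x ∷ y ∷ bs)) k))))
      ... | inj₁ refl = Unique-disjoint (cs ++ v ∷ d ∷ ds) uq (∈-++⁺ʳ cs (there (here refl))) (here refl)
      ... | inj₂ refl = Unique-disjoint (cs ++ v ∷ d ∷ ds) uq (∈-++⁺ʳ cs (there (here refl))) (there (here refl))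
      core (through _ bs uq c k) v∈ | b ∷ cs , [] , refl
        with Nv (old∉ (E⇒≢ vx) (E⇒≢ vy) (E⁺-sym (Linked-last′ cs (subst (Linked (E⁺ x y)) (++-assoc (b ∷ cs) [ v ] (x ∷ y ∷ bs)) k))))
      ... | inj₁ eq = Unique-disjoint ((b ∷ cs) ++ [ v ]) uq (∈-++⁺ˡ (subst (_∈ b ∷ cs) eq (last′∈ b cs))) (here refl)
      ... | inj₂ eq = Unique-disjoint ((b ∷ cs) ++ [ v ]) uq (∈-++⁺ˡ (subst (_∈ b ∷ cs) eq (last′∈ b cs))) (there (here refl))
      -- The path is `v x y …`, and `x v y …` avoids the new edge.
      core (through _ bs uq@(_ ∷ x∉ ∷ _) c (_ ∷ _ ∷ k)) v∈ | [] , [] , refl = ¬hamiltonian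
        (hamList (x ∷ v ∷ y ∷ bs) (Unique-resp-↭ (↭.swap v x ↭.refl) uq) (λ w → ∈-resp-↭ (↭.swap v x ↭.refl) (c w))
          (E-sym vx ∷ vy ∷ Linked-old (λ x∈ → All.lookup x∉ x∈ refl) k))

    either : ¬ Through x y
    either t@(through as bs uq c k) with ∈-++⁻ as (c v)
    ... | inj₁ v∈ = core vx vy Nv t v∈
    ... | inj₂ (here refl) = E⇒≢ vx refl
    ... | inj₂ (there (here refl)) = E⇒≢ vy refl
    ... | inj₂ (there (there v∈)) = core vy vx ([ inj₂ , inj₁ ]′ ∘ Nv) (flip-through t) (Anyₚ.reverse⁺ v∈)

  -- v and x are twins in G + vw, so exchanging them in a Hamiltonian path through vw replaces vw
  -- by xw, which is an edge of G.
  no-near-twins : ∀ {v x w} → v ≢ w → E v x → E x w →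
    (∀ {u} → E v u → u ≡ x ⊎ E x u) → (∀ {u} → E x u → u ≡ v ⊎ u ≡ w ⊎ E v u) →
    (∀ {p q} → E v p → E v q → p ≢ x → q ≢ x → p ≡ q) → E v w
  no-near-twins {v} {x} {w} v≢w vx xw Nv Nx deg = forced v≢w (core ∘ through-edge)
    where
    v≢x = E⇒≢ vx
    x≢w = E⇒≢ xw

    τ : Fin n → Fin n
    τ a with a ≟ v
    ... | yes _ = x
    ... | no _ with a ≟ x
    ... | yes _ = v
    ... | no _ = a

    τv : τ v ≡ x
    τv with v ≟ v
    ... | yes _ = refl
    ... | no v≢v = contradiction refl v≢v

    τx : τ x ≡ v
    τx with x ≟ v
    ... | yes eq = eq
    ... | no _ with x ≟ x
    ... | yes _ = refl
    ... | no x≢x = contradiction refl x≢x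

    τ-other : ∀ {a} → a ≢ v → a ≢ x → τ a ≡ a
    τ-other {a} a≢v a≢x with a ≟ v
    ... | yes a≡v = contradiction a≡v a≢v
    ... | no _ with a ≟ x
    ... | yes a≡x = contradiction a≡x a≢x
    ... | no _ = refl

    ττ : ∀ a → τ (τ a) ≡ a
    ττ a = by (a ≟ v) (a ≟ x)
      where
      by : Dec (a ≡ v) → Dec (a ≡ x) → τ (τ a) ≡ a
      by (yes refl) _ = trans (cong τ τv) τx
      by (no _) (yes refl) = trans (cong τ τx) τv
      by (no p) (no q) = trans (cong τ (τ-other p q)) (τ-other p q)

    -- The one edge whose image under `τ` may be missing from `G`: exchanging `v` and `x` turns `xw`
    -- into `vw`.
    Bad : Fin n → Fin n → Set
    Bad a b = (a ≡ w × b ≡ x) ⊎ (a ≡ x × b ≡ w)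

    twin : ∀ {a b} → Dec (a ≡ v) → Dec (a ≡ x) → Dec (b ≡ v) → Dec (b ≡ x) → E a b → E (τ a) (τ b) ⊎ Bad a b
    twin (yes refl) _ (yes refl) _ e = contradiction refl (E⇒≢ e)
    twin (yes refl) _ (no _) (yes refl) e rewrite τv | τx = inj₁ (E-sym e)
    twin (yes refl) _ (no b≢v) (no b≢x) e rewrite τv | τ-other b≢v b≢x =
      inj₁ ([ (λ b≡x → contradiction b≡x b≢x) , id ]′ (Nv e))
    twin (no _) (yes refl) (yes refl) _ e rewrite τx | τv = inj₁ (E-sym e)
    twin (no _) (yes refl) (no _) (yes refl) e = contradiction refl (E⇒≢ e)
    twin (no _) (yes refl) (no b≢v) (no b≢x) e with Nx e
    ... | inj₁ b≡v = contradiction b≡v b≢v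
    ... | inj₂ (inj₁ b≡w) = inj₂ (inj₂ (refl , b≡w))
    ... | inj₂ (inj₂ vb) rewrite τx | τ-other b≢v b≢x = inj₁ vb
    twin (no a≢v) (no a≢x) (yes refl) _ e rewrite τv | τ-other a≢v a≢x =
      inj₁ ([ (λ a≡x → contradiction a≡x a≢x) , E-sym ]′ (Nv (E-sym e)))
    twin (no a≢v) (no a≢x) (no _) (yes refl) e with Nx (E-sym e)
    ... | inj₁ a≡v = contradiction a≡v a≢v
    ... | inj₂ (inj₁ a≡w) = inj₂ (inj₁ (a≡w , refl))
    ... | inj₂ (inj₂ va) rewrite τx | τ-other a≢v a≢x = inj₁ (E-sym va)
    twin (no a≢v) (no a≢x) (no b≢v) (no b≢x) e rewrite τ-other a≢v a≢x | τ-other b≢v b≢x = inj₁ e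

    twin⁺ : ∀ {a b} → E⁺ v w a b → E (τ a) (τ b) ⊎ Bad a b
    twin⁺ {a} {b} (old e) = twin (a ≟ v) (a ≟ x) (b ≟ v) (b ≟ x) e
    twin⁺ new rewrite τv | τ-other (v≢w ∘ sym) (x≢w ∘ sym) = inj₁ xw
    twin⁺ wen rewrite τv | τ-other (v≢w ∘ sym) (x≢w ∘ sym) = inj₁ (E-sym xw)

    E-v : ∀ {q} → q ≢ v → q ≢ w → E⁺ v w x q → E v q
    E-v q≢v q≢w e with Nx (old∉ (v≢x ∘ sym) x≢w e)
    ... | inj₁ q≡v = contradiction q≡v q≢v
    ... | inj₂ (inj₁ q≡w) = contradiction q≡w q≢w
    ... | inj₂ (inj₂ vq) = vq

    -- When the path runs `v w x`, the exchange only trades one use of `vw` for another. If the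
    -- segment is at an end of the path, reordering it avoids `vw`. Otherwise the vertex before `v`
    -- and the vertex after `x` are both neighbours of `v` other than `x`, so `deg` identifies them,
    -- which a path does not allow.
    consecutive : ∀ as bs → Unique (as ++ v ∷ w ∷ x ∷ bs) → (∀ a → a ∈ as ++ v ∷ w ∷ x ∷ bs) →
                  Linked (E⁺ v w) (as ++ v ∷ w ∷ x ∷ bs) → ⊥
    consecutive [] bs uq@(v∉ ∷ w∉ ∷ _) c (_ ∷ _ ∷ k) = ¬hamiltonian (hamList (w ∷ x ∷ v ∷ bs)
        (Unique-resp-↭ perm uq) (λ a → ∈-resp-↭ perm (c a)) (E-sym xw ∷ E-sym vx ∷ rest v∉ w∉ k))
      where
      perm : v ∷ w ∷ x ∷ bs ↭ w ∷ x ∷ v ∷ bs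
      perm = ↭.trans (↭.swap v w ↭.refl) (↭.prep w (↭.swap v x ↭.refl))
      rest : ∀ {bs} → All (v ≢_) (w ∷ x ∷ bs) → All (w ≢_) (x ∷ bs) → Linked (E⁺ v w) (x ∷ bs) → Linked E (v ∷ bs)
      rest _ _ [-] = [-]
      rest (_ ∷ _ ∷ v∉) (_ ∷ w∉) (e ∷ k) = E-v (All.head v∉ ∘ sym) (All.head w∉ ∘ sym) e ∷ Linked-old (λ v∈ → All.lookup v∉ v∈ refl) k
    consecutive as@(a ∷ as′) [] uq c k = ¬hamiltonian (hamList (as ++ v ∷ x ∷ w ∷ [])
      (Unique-resp-↭ perm uq) (λ b → ∈-resp-↭ perm (c b))
      (Linked-++ as (Linked-old′ w∉ (Linked-++ˡ as k)) (vx ∷ xw ∷ [-])))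
      where
      perm : as ++ v ∷ w ∷ x ∷ [] ↭ as ++ v ∷ x ∷ w ∷ []
      perm = ++⁺ˡ as (↭.prep v (↭.swap w x ↭.refl))
      w∉ : w ∉ as ++ [ v ]
      w∉ w∈ with ∈-++⁻ as w∈
      ... | inj₁ w∈as = Unique-disjoint as uq w∈as (there (here refl))
      ... | inj₂ (here w≡v) = v≢w (sym w≡v)
    consecutive as@(a ∷ as′) (q ∷ bs) uq c k with Unique-++ʳ as uq
    ... | (v≢w ∷ v≢x ∷ v≢q ∷ _) ∷ (w≢x ∷ w≢q ∷ _) ∷ (x≢q ∷ _) ∷ _ =
      p≢ (there (there (there (here (deg (E-sym (E⇐ (Linked-last′ as′ k)))
        (E-v (v≢q ∘ sym) (w≢q ∘ sym) (Linked.head (Linked.tail (Linked.tail (Linked-++ʳ as k))))) (λ eq → p≢ (there (there (here eq)))) (x≢q ∘ sym))))))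
      where
      p = last′ a as′
      p≢ : p ∉ v ∷ w ∷ x ∷ q ∷ bs
      p≢ = Unique-disjoint as uq (last′∈ a as′)
      E⇐ : E⁺ v w p v → E p v
      E⇐ = old∉ (p≢ ∘ here) (p≢ ∘ there ∘ here)

    core : ¬ Through v w
    core (through as bs uq c k) with Linked-⊎ {S = λ a b → E (τ a) (τ b)} {T = Bad} twin⁺ k
    ... | inj₁ k′ = ¬hamiltonian (hamList (map τ (as ++ v ∷ w ∷ bs))
            (Uniqueₚ.map⁺ (λ {a} {b} eq → trans (sym (ττ a)) (trans (cong τ eq) (ττ b))) uq)
            (λ a → subst (_∈ _) (ττ a) (∈-map⁺ τ (c (τ a)))) (Linkedₚ.map⁺ k′))
    ... | inj₂ (cs , _ , _ , ds , eq , inj₁ (refl , refl))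
      with Unique-split-≡ (as ++ [ v ]) cs (subst Unique (sym (++-assoc as [ v ] (w ∷ bs))) uq) (trans (++-assoc as [ v ] (w ∷ bs)) eq)
    ... | _ , refl = consecutive as ds uq c k
    -- The predecessor of `w` is `v`, so `x` cannot precede it as well.
    core (through as bs uq c k) | inj₂ (cs , _ , _ , ds , eq , inj₂ (refl , refl))
      with Unique-split-≡ (as ++ [ v ]) (cs ++ [ x ]) (subst Unique (sym (++-assoc as [ v ] (w ∷ bs))) uq)
             (trans (++-assoc as [ v ] (w ∷ bs)) (trans eq (sym (++-assoc cs [ x ] (w ∷ ds)))))
    ... | eq′ , _ = v≢x (∷ʳ-injectiveʳ as cs eq′)

module _ {n : ℕ} (R : Fin n → Fin n → Set) (R-sym : ∀ {a b} → R a b → R b a) where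
  open Walks R R-sym
  open import Data.List.Membership.DecPropositional (_≟_ {n}) using (_∈?_)

  -- The complement of S and of sets closed modulo S is itself closed modulo S.
  tough-rest : ∀ {k} (S : List (Fin n)) (P : Fin k → Fin n → Set) → (∀ i v → Dec (P i v)) →
    (∀ i → Closed (P i) S) → (∀ i {s} → s ∈ S → ¬ P i s) → (∀ i → ∃ (P i)) →
    (∀ {i j v} → P i v → P j v → i ≡ j) → length S < k →
    ∀ {u} → u ∉ S → (∀ i → ¬ P i u) → ¬ HamList
  tough-rest {k} S P P? cl ¬S ex disj lt {u} u∉ ¬Pu = tough S P′ P′? cl′ ¬S′ ex′ disj′ (s≤s lt)
    where
    P′ : Fin (suc k) → Fin n → Set
    P′ zero v = v ∉ S × (∀ i → ¬ P i v)
    P′ (suc i) = P i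
    P′? : ∀ i v → Dec (P′ i v)
    P′? zero v = ¬? (v ∈? S) ×-dec all? (λ i → ¬? (P? i v))
    P′? (suc i) = P? i
    cl′ : ∀ i → Closed (P′ i) S
    cl′ zero {p} {q} (p∉ , ¬Pp) r with q ∈? S
    ... | yes q∈ = inj₂ q∈
    ... | no q∉ = inj₁ (q∉ , λ i Pq → [ ¬Pp i , p∉ ]′ (cl i Pq (R-sym r)))
    cl′ (suc i) = cl i
    ¬S′ : ∀ i {s} → s ∈ S → ¬ P′ i s
    ¬S′ zero s∈ (s∉ , _) = s∉ s∈
    ¬S′ (suc i) = ¬S i
    ex′ : ∀ i → ∃ (P′ i)
    ex′ zero = u , u∉ , ¬Pu
    ex′ (suc i) = ex i
    disj′ : ∀ {i j v} → P′ i v → P′ j v → i ≡ j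
    disj′ {zero} {zero} a b = refl
    disj′ {zero} {suc j} (_ , ¬P) b = contradiction b (¬P j)
    disj′ {suc i} {zero} a (_ , ¬P) = contradiction a (¬P i)
    disj′ {suc i} {suc j} a b = cong suc (disj a b)

-- The numerical claim

Claim : ℕ → ℕ → Set
Claim n e = (n ≡ 8 → 10 ≤ e) × (n ≡ 9 → 12 ≤ e) × (10 ≤ n → 3 * n ≤ 2 * e + 2)

-- For n = 8 and n = 9 the general bound would even give 11 and 13 edges.
strong-claim : ∀ {n e} → 3 * n ≤ 2 * e + 2 → Claim n e
strong-claim {n} {e} h =
  (λ { refl → ≤-trans (n≤1+n 10) (*-cancelˡ-≤ 2 (+-cancelʳ-≤ 2 22 (2 * e) h)) }) ,
  (λ { refl → *-cancelˡ-≤ 2 (≤-trans (n≤1+n 24) (+-cancelʳ-≤ 2 25 (2 * e) h)) }) , λ _ → h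

-- Outside a component of at most three vertices there are at least n - 3 = m + 1 vertices, and they
-- form a clique; edges inside the component are ignored. At n = 8 this gives exactly 10, and for n
-- ≥ 10, where m ≥ 6, the quadratic term exceeds what is required.
clique-claim : ∀ {m e} → 4 ≤ m → m * suc m ≤ 2 * e → Claim (4 + m) e
clique-claim {m} {e} 4≤m h =
  (λ { refl → *-cancelˡ-≤ 2 h }) ,
  (λ { refl → *-cancelˡ-≤ 2 (≤-trans (m≤m+n 24 6) h) }) ,
  λ 10≤n → ≤-trans (big (+-cancelˡ-≤ 4 6 m 10≤n)) (+-monoˡ-≤ 2 h)
  where
  big : 6 ≤ m → 3 * (4 + m) ≤ m * suc m + 2
  big 6≤m = begin
    3 * (4 + m)          ≡⟨ expand m ⟩
    10 + 3 * m + 2       ≤⟨ +-monoˡ-≤ 2 (+-monoˡ-≤ (3 * m) (≤-trans (m≤m+n 10 14) (*-monoʳ-≤ 4 6≤m))) ⟩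
    4 * m + 3 * m + 2    ≡⟨ collect m ⟩
    m * 7 + 2            ≤⟨ +-monoˡ-≤ 2 (*-monoʳ-≤ m (s≤s 6≤m)) ⟩
    m * suc m + 2        ∎
    where
    open ≤-Reasoning
    expand : ∀ m → 3 * (4 + m) ≡ 10 + 3 * m + 2
    expand = solve-∀
    collect : ∀ m → 4 * m + 3 * m + 2 ≡ m * 7 + 2
    collect = solve-∀

-- Weights

module Counting {n : ℕ} (G : Graph n) (mnt : MaximalNontraceable G) (8≤n : 8 ≤ n) where

  open Maximal G mnt public
  open import Data.List.Membership.DecPropositional (_≟_ {n}) using (_∈?_) public

  Goal : Set
  Goal = Claim n (edgeCount G)

  outside : ∀ L → length L < 8 → ∃ λ u → u ∉ L
  outside L lt with Any.any? (λ u → ¬? (u ∈? L)) (allFin n)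
  ... | yes a = let u , _ , u∉ = find a in u , u∉
  ... | no ¬a = contradiction (subst (_≤ length L) (length-tabulate {n = n} id) (length-⊆ (Uniqueₚ.allFin⁺ n) (λ {u} _ → all u)))
                  (<⇒≱ (≤-trans lt 8≤n))
    where
    all : ∀ u → u ∈ L
    all u with u ∈? L
    ... | yes p = p
    ... | no u∉ = contradiction (Any.map (λ { refl → u∉ }) (∈-allFin u)) ¬a

  1≤δ : ∀ (v : Fin n) → 1 ≤ δ v v
  1≤δ v = ≤-reflexive (sym (δ-refl v))

  κ : List (Fin n) → Fin n → ℕ
  κ C v = sum (map (λ c → δ c v) C)

  Σ-κ : ∀ C → Σ[ κ C ] ≡ length C
  Σ-κ C = trans (sum-map-swap (λ v c → δ c v) (allFin n) C)
    (trans (sum-map-cong C Σ-δ) (trans (sum-map-const 1 C) (*-identityʳ _)))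

  κ-∈ : ∀ {C v} → v ∈ C → 1 ≤ κ C v
  κ-∈ {c ∷ C} {v} (here refl) rewrite δ-refl v = s≤s z≤n
  κ-∈ {c ∷ C} {v} (there v∈) = ≤-trans (κ-∈ v∈) (m≤n+m _ (δ c v))

  -- Joining two vertices outside `C` leaves the graph disconnected, hence without a Hamiltonian
  -- path (`tough-rest` with no cut vertex), so the vertices outside `C` form a clique. Each has
  -- degree at least n - 4 = m, and granting `m` to the at most three vertices of `C` too gives nm ≤
  -- 2e + 3m.
  small-component : ∀ {c} C → c ∈ C → length C ≤ 3 → (∀ {p q} → p ∈ C → E p q → q ∈ C) → Goal
  small-component {c} C c∈ le cl = subst (λ k → Claim k (edgeCount G)) 4+m (clique-claim 4≤m bound)
    where
    m = n ∸ 4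
    4+m : 4 + m ≡ n
    4+m = m+[n∸m]≡n (≤-trans (m≤m+n 4 4) 8≤n)
    4≤m : 4 ≤ m
    4≤m = ∸-monoˡ-≤ 4 8≤n
    clique : ∀ {u v} → u ∉ C → v ∉ C → u ≢ v → E u v
    clique {u} {v} u∉ v∉ u≢v = forced u≢v (tough-rest (E⁺ u v) E⁺-sym {1} [] (λ _ → _∈ C) (λ _ → _∈? C)
      (λ _ → closed⁺ {P = _∈ C} (λ p e → inj₁ (cl p e)) (λ u∈ → contradiction u∈ u∉) (λ v∈ → contradiction v∈ v∉))
      (λ _ ()) (λ _ → c , c∈) (λ { {zero} {zero} _ _ → refl }) (s≤s z≤n) (λ ()) (λ _ → u∉))
    degree : ∀ {v} → v ∉ C → m ≤ D v
    degree {v} v∉ = +-cancelˡ-≤ 4 m (D v) (begin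
      4 + m                        ≡⟨ 4+m ⟩
      n                            ≡⟨ length-tabulate {n = n} id ⟨
      length (allFin n)            ≤⟨ length-⊆ (Uniqueₚ.allFin⁺ n) (λ {u} _ → cover u) ⟩
      suc (length (C ++ nb v))     ≡⟨ cong suc (length-++ C) ⟩
      suc (length C + D v)         ≤⟨ s≤s (+-monoˡ-≤ (D v) le) ⟩
      4 + D v                      ∎)
      where
      open ≤-Reasoning
      cover : ∀ u → u ∈ v ∷ C ++ nb v
      cover u with u ≟ v | u ∈? C
      ... | yes u≡v | _ = here u≡v
      ... | no _ | yes u∈ = there (∈-++⁺ˡ u∈)
      ... | no u≢v | no u∉ = there (∈-++⁺ʳ C (nb⁺ (clique v∉ u∉ (u≢v ∘ sym))))
    pointwise : ∀ v → m ≤ D v + m * κ C v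
    pointwise v with v ∈? C
    ... | yes v∈ = ≤-trans (≤-trans (≤-reflexive (sym (*-identityʳ m))) (*-monoʳ-≤ m (κ-∈ v∈))) (m≤n+m _ (D v))
    ... | no v∉ = ≤-trans (degree v∉) (m≤m+n _ _)
    bound : m * suc m ≤ 2 * edgeCount G
    bound = +-cancelʳ-≤ (m * 3) _ _ (begin
      m * suc m + m * 3                 ≡⟨ expand m ⟩
      (4 + m) * m                       ≡⟨ cong (_* m) 4+m ⟩
      n * m                             ≡⟨ Σ-const {n} m ⟨
      Σ[ (λ (_ : Fin n) → m) ]                    ≤⟨ sum-map-≤ (allFin n) pointwise ⟩
      Σ[ (λ v → D v + m * κ C v) ]      ≡⟨ sum-map-+ D (λ v → m * κ C v) (allFin n) ⟩
      Σ[ D ] + Σ[ (λ v → m * κ C v) ]   ≡⟨ cong₂ _+_ ΣD≡2e (trans (sum-map-* m (κ C) (allFin n)) (cong (m *_) (Σ-κ C))) ⟩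
      2 * edgeCount G + m * length C    ≤⟨ +-monoʳ-≤ (2 * edgeCount G) (*-monoʳ-≤ m le) ⟩
      2 * edgeCount G + m * 3           ∎)
      where
      open ≤-Reasoning
      expand : ∀ m → m * suc m + m * 3 ≡ (4 + m) * m
      expand = solve-∀

  -- The vertices of degree 2 that lie in no pendant triangle.
  record B (v : Fin n) : Set where
    constructor mkB
    field
      degree   : D v ≡ 2
      nbr-degs : All (λ u → 3 ≤ D u) (nb v)

  B? : ∀ v → Dec (B v)
  B? v with D v ℕ.≟ 2 | All.all? (λ u → 3 ≤? D u) (nb v)
  ... | yes p | yes q = yes (mkB p q)
  ... | no ¬p | _ = no (¬p ∘ B.degree)
  ... | yes _ | no ¬q = no (¬q ∘ B.nbr-degs)

  B-nbr : ∀ {v u} → B v → E v u → 3 ≤ D u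
  B-nbr b e = All.lookup (B.nbr-degs b) (nb⁺ e)

  3≤D⇒¬B : ∀ {v} → 3 ≤ D v → ¬ B v
  3≤D⇒¬B le b = <⇒≢ le (sym (B.degree b))

  weight : ∀ {P : Set} → Dec P → ℕ
  weight (yes _) = 1
  weight (no _) = 2

  -- A neighbour counts 2, or 1 if it lies in `B`: in doubled units this is the loss of 1/2 along
  -- the edge to it.
  w : Fin n → ℕ
  w v = weight (B? v)

  ¬B⇒w : ∀ {v} → ¬ B v → 2 ≤ w v
  ¬B⇒w {v} ¬b with B? v
  ... | yes b = contradiction b ¬b
  ... | no _ = ≤-refl

  3≤D⇒w : ∀ {v} → 3 ≤ D v → 2 ≤ w v
  3≤D⇒w = ¬B⇒w ∘ 3≤D⇒¬B

  1≤w : ∀ v → 1 ≤ w v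
  1≤w v with B? v
  ... | yes _ = s≤s z≤n
  ... | no _ = s≤s z≤n

  charge : Fin n → ℕ
  charge v = sum (map w (nb v))

  -- Twice the degree, after each vertex in B has taken half a unit of degree from both its neighbours.
  f : Fin n → ℕ
  f v = charge v + 2 * (2 ∸ w v)

  charge≤f : ∀ v → charge v ≤ f v
  charge≤f v = m≤m+n _ _

  -- After an exchange of the summations a vertex `u` contributes `w u` once for each neighbour. A
  -- vertex of `B` has degree exactly 2, so its gain of 2 makes up for what its two neighbours give
  -- away, and every vertex accounts for 2 · `D u`.
  Σf≡4e : Σ[ f ] ≡ 4 * edgeCount G
  Σf≡4e = begin
    Σ[ f ]                                                   ≡⟨ sum-map-+ charge _ (allFin n) ⟩
    Σ[ charge ] + Σ[ gain ]                                  ≡⟨ cong (_+ Σ[ gain ]) (sum-map-cong (allFin n) (sum-nb w)) ⟩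
    Σ[ (λ v → Σ[ (λ u → bit (adj G v u) * w u) ]) ] + Σ[ gain ]
      ≡⟨ cong (_+ Σ[ gain ]) (sum-map-swap (λ v u → bit (adj G v u) * w u) (allFin n) (allFin n)) ⟩
    Σ[ (λ u → Σ[ (λ v → bit (adj G v u) * w u) ]) ] + Σ[ gain ] ≡⟨ cong (_+ Σ[ gain ]) (sum-map-cong (allFin n) column) ⟩
    Σ[ (λ u → w u * D u) ] + Σ[ gain ]                       ≡⟨ sum-map-+ (λ u → w u * D u) gain (allFin n) ⟨
    Σ[ (λ u → w u * D u + gain u) ]                          ≡⟨ sum-map-cong (allFin n) local ⟩
    Σ[ (λ u → 2 * D u) ]                                     ≡⟨ sum-map-* 2 D (allFin n) ⟩
    2 * Σ[ D ]                                               ≡⟨ cong (2 *_) ΣD≡2e ⟩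
    2 * (2 * edgeCount G)                                    ≡⟨ *-assoc 2 2 (edgeCount G) ⟨
    4 * edgeCount G                                          ∎
    where
    open ≡-Reasoning
    gain : Fin n → ℕ
    gain v = 2 * (2 ∸ w v)
    column : ∀ u → Σ[ (λ v → bit (adj G v u) * w u) ] ≡ w u * D u
    column u = trans (sum-map-cong (allFin n) (λ v → trans (*-comm _ (w u)) (cong (λ b → w u * bit b) (Defs.sym G v u))))
      (trans (sum-map-* (w u) (λ v → bit (adj G u v)) (allFin n)) (cong (w u *_) (sym (D≡Σ u))))
    local : ∀ u → w u * D u + gain u ≡ 2 * D u
    local u with B? u
    ... | yes b rewrite B.degree b = refl
    ... | no _ = +-identityʳ _

  -- Vertices of degree 2 and the charge of their neighbours

  record Ear (v x y : Fin n) : Set where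
    constructor ear
    field
      vx   : E v x
      vy   : E v y
      x≢y  : x ≢ y
      xy   : E x y
      only : ∀ {u} → E v u → u ≡ x ⊎ u ≡ y

  pair : ∀ {v x y} → D v ≤ 2 → E v x → E v y → x ≢ y → ∀ {u} → E v u → u ≡ x ⊎ u ≡ y
  pair le vx vy x≢y e with saturated le ((x≢y ∷ []) ∷ [] ∷ []) (vx ∷ vy ∷ []) e
  ... | here u≡x = inj₁ u≡x
  ... | there (here u≡y) = inj₂ u≡y

  ear-at : ∀ {v x} → D v ≡ 2 → E v x → ∃ (Ear v x)
  ear-at {v} {x} Dv vx with fresh [ x ] (≤-reflexive (sym Dv))
  ... | y , vy , y∉ = y , ear vx vy x≢y (nbrs-adjacent vx vy x≢y only) only
    where
    x≢y : x ≢ y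
    x≢y x≡y = y∉ (here (sym x≡y))
    only : ∀ {u} → E v u → u ≡ x ⊎ u ≡ y
    only = pair (≤-reflexive Dv) vx vy x≢y

  charge≥ : ∀ {v xs} k → Unique xs → All (E v) xs → k ≤ sum (map w xs) → k ≤ charge v
  charge≥ k u es le = ≤-trans le (sum≤nb w u es)

  -- If `x` had only the neighbours `r`, `s`, `t`, where `r` has the neighbours `x` and `s`, then
  -- `r` and `x` would differ only in `t`. So `no-near-twins` would make `t` a third neighbour of
  -- `r`.
  B-degree≥4 : ∀ {x r} → B r → E x r → 4 ≤ D x
  B-degree≥4 {x} {r} b xr with 4 ≤? D x
  ... | yes p = p
  ... | no ¬p with ear-at (B.degree b) (E-sym xr)
  ... | s , ear rx rs x≢s xs only with fresh (r ∷ s ∷ []) (B-nbr b rx)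
  ... | t , xt , t∉ = ⊥-elim ([ (λ { refl → E⇒≢ xt refl }) , (λ { refl → t∉ (there (here refl)) }) ]′ (only rt))
    where
    sat : ∀ {u} → E x u → u ∈ r ∷ s ∷ t ∷ []
    sat = saturated (≤-pred (≰⇒> ¬p)) ((E⇒≢ rs ∷ (λ r≡t → t∉ (here (sym r≡t))) ∷ []) ∷ ((λ s≡t → t∉ (there (here (sym s≡t)))) ∷ []) ∷ [] ∷ [])
            (xr ∷ xs ∷ xt ∷ [])
    Nx : ∀ {u} → E x u → u ≡ r ⊎ u ≡ t ⊎ E r u
    Nx e with sat e
    ... | here p = inj₁ p
    ... | there (here refl) = inj₂ (inj₂ rs)
    ... | there (there (here p)) = inj₂ (inj₁ p)
    rt : E r t
    rt = no-near-twins (λ r≡t → t∉ (here (sym r≡t))) rx xt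
      (λ e → [ inj₁ , (λ { refl → inj₂ xs }) ]′ (only e)) Nx
      (λ ep eq p≢x q≢x → trans ([ (λ p≡x → contradiction p≡x p≢x) , id ]′ (only ep))
                           (sym ([ (λ q≡x → contradiction q≡x q≢x) , id ]′ (only eq))))

  -- Otherwise G − {x, s} has four components.
  three-ears : ∀ {x s r c d} → Ear r x s → Ear c x s → Ear d x s → r ≢ c → r ≢ d → c ≢ d → 5 ≤ D x
  three-ears {x} {s} {r} {c} {d} er ec ed r≢c r≢d c≢d with 5 ≤? D x
  ... | yes p = p
  -- If `x` has degree at most 4, its neighbours are `s`, `r`, `c`, `d`. The new edge `xu` has an
  -- end in the cutset, so the four parts remain apart and `xu` must be an edge already.
  ... | no ¬p with outside (x ∷ s ∷ r ∷ c ∷ d ∷ []) (m≤m+n 6 2)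
  ... | u , u∉ = ⊥-elim (u∉ (mem (forced x≢u (tough-rest (E⁺ x u) E⁺-sym {3} (x ∷ s ∷ []) P P? cl ¬S ex disj ≤-refl
                    (λ { (here p) → u∉ (here p) ; (there (here p)) → u∉ (there (here p)) }) ¬Pu))))
    where
    x≢u : x ≢ u
    x≢u x≡u = u∉ (here (sym x≡u))
    mem : E x u → u ∈ x ∷ s ∷ r ∷ c ∷ d ∷ []
    mem e = there (saturated (≤-pred (≰⇒> ¬p))
      (((E⇒≢ (Ear.vy er) ∘ sym) ∷ (E⇒≢ (Ear.vy ec) ∘ sym) ∷ (E⇒≢ (Ear.vy ed) ∘ sym) ∷ []) ∷ (r≢c ∷ r≢d ∷ []) ∷ (c≢d ∷ []) ∷ [] ∷ [])
      (Ear.xy er ∷ E-sym (Ear.vx er) ∷ E-sym (Ear.vx ec) ∷ E-sym (Ear.vx ed) ∷ []) e)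
    tip : Fin 3 → Fin n
    tip zero = r
    tip (suc zero) = c
    tip (suc (suc zero)) = d
    tip-ear : ∀ i → Ear (tip i) x s
    tip-ear zero = er
    tip-ear (suc zero) = ec
    tip-ear (suc (suc zero)) = ed
    tip∈ : ∀ i → tip i ∈ r ∷ c ∷ d ∷ []
    tip∈ zero = here refl
    tip∈ (suc zero) = there (here refl)
    tip∈ (suc (suc zero)) = there (there (here refl))
    tip-inj : ∀ i j → tip i ≡ tip j → i ≡ j
    tip-inj zero zero _ = refl
    tip-inj zero (suc zero) eq = contradiction eq r≢c
    tip-inj zero (suc (suc zero)) eq = contradiction eq r≢d
    tip-inj (suc zero) zero eq = contradiction (sym eq) r≢c
    tip-inj (suc zero) (suc zero) _ = refl
    tip-inj (suc zero) (suc (suc zero)) eq = contradiction eq c≢d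
    tip-inj (suc (suc zero)) zero eq = contradiction (sym eq) r≢d
    tip-inj (suc (suc zero)) (suc zero) eq = contradiction (sym eq) c≢d
    tip-inj (suc (suc zero)) (suc (suc zero)) _ = refl
    P : Fin 3 → Fin n → Set
    P i v = v ≡ tip i
    P? : ∀ i v → Dec (P i v)
    P? i v = v ≟ tip i
    ¬Pu : ∀ i → ¬ P i u
    ¬Pu i eq = u∉ (subst (_∈ x ∷ s ∷ r ∷ c ∷ d ∷ []) (sym eq) (there (there (tip∈ i))))
    ¬S : ∀ i {t} → t ∈ x ∷ s ∷ [] → ¬ P i t
    ¬S i (here refl) eq = E⇒≢ (Ear.vx (tip-ear i)) (sym eq)
    ¬S i (there (here refl)) eq = E⇒≢ (Ear.vy (tip-ear i)) (sym eq)
    cl : ∀ i → W⁺.Closed x u (P i) (x ∷ s ∷ [])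
    cl i = closed⁺ {P = P i} (λ { refl e → inj₂ ([ here , there ∘ here ]′ (Ear.only (tip-ear i) e)) })
             (λ { eq → contradiction eq (¬S i (here refl)) }) (λ { _ → inj₂ (here refl) })
    ex : ∀ i → ∃ (P i)
    ex i = tip i , refl
    disj : ∀ {i j v} → P i v → P j v → i ≡ j
    disj {i} {j} p q = tip-inj i j (trans (sym p) q)

  -- Without neighbours in `B`, three neighbours of weight 2 suffice. Otherwise there is an ear `r`
  -- on `x` and `s`, of weights 1 and 2, and by `B-degree≥4` two more neighbours `c` and `d`. They
  -- fall short of weight 3 only if both lie in `B`. An ear whose other vertex is not `s` brings a
  -- new neighbour of weight 2, and if all three ears are on `x` and `s`, then `three-ears` supplies
  -- a fifth neighbour.
  charge≥6 : ∀ {x} → 3 ≤ D x → 6 ≤ charge x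
  charge≥6 {x} 3≤Dx with Any.any? B? (nb x)
  ... | no ¬a with fresh [] (≤-trans (s≤s z≤n) 3≤Dx)
  ... | a , xa , _ with fresh [ a ] (≤-trans (n≤1+n 2) 3≤Dx)
  ... | b , xb , b∉ with fresh (b ∷ a ∷ []) 3≤Dx
  ... | c , xc , c∉ = charge≥ 6 (((c∉ ∘ here) ∷ (c∉ ∘ there ∘ here) ∷ []) ∷ ((b∉ ∘ here) ∷ []) ∷ [] ∷ []) (xc ∷ xb ∷ xa ∷ [])
      (+-mono-≤ (2≤ xc) (+-mono-≤ (2≤ xb) (+-mono-≤ (2≤ xa) z≤n)))
    where
    2≤ : ∀ {u} → E x u → 2 ≤ w u
    2≤ e = ¬B⇒w λ b → ¬a (Any.map (λ { refl → b }) (nb⁺ e))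
  charge≥6 {x} 3≤Dx | yes a with find a
  ... | r , r∈ , Br with ear-at (B.degree Br) (E-sym (nb⁻ r∈))
  ... | s , er@(ear rx rs x≢s xs only) with fresh (r ∷ s ∷ []) 3≤Dx
  ... | c , xc , c∉ with fresh (c ∷ r ∷ s ∷ []) (B-degree≥4 Br (E-sym rx))
  ... | d , xd , d∉ = by (B? c) (B? d)
    where
    Ds = B-nbr Br rs
    xr = E-sym rx
    four : ∀ {k t} → E x k → E x t → k ∉ r ∷ s ∷ [] → t ∉ k ∷ r ∷ s ∷ [] → 3 ≤ w k + w t → 6 ≤ charge x
    four {k} {t} xk xt k∉ t∉ le = charge≥ 6
      ((E⇒≢ rs ∷ (k∉ ∘ here ∘ sym) ∷ (t∉ ∘ there ∘ here ∘ sym) ∷ []) ∷ ((k∉ ∘ there ∘ here ∘ sym) ∷ (t∉ ∘ there ∘ there ∘ here ∘ sym) ∷ [])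
        ∷ ((t∉ ∘ here ∘ sym) ∷ []) ∷ [] ∷ [])
      (xr ∷ xs ∷ xk ∷ xt ∷ [])
      (+-mono-≤ (1≤w r) (+-mono-≤ (3≤D⇒w Ds) (subst (3 ≤_) (cong (w k +_) (sym (+-identityʳ (w t)))) le)))
    other : ∀ {k} → E x k → k ∉ r ∷ s ∷ [] → B k → 6 ≤ charge x ⊎ Ear k x s
    other {k} xk k∉ Bk with ear-at (B.degree Bk) (E-sym xk)
    ... | t , ek with t ≟ s
    ... | yes refl = inj₂ ek
    ... | no t≢s = inj₁ (four xk (Ear.xy ek) k∉ t∉ (+-mono-≤ (1≤w k) (3≤D⇒w (B-nbr Bk (Ear.vy ek)))))
      where
      t∉ : t ∉ k ∷ r ∷ s ∷ []
      t∉ (here refl) = E⇒≢ (Ear.vy ek) refl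
      t∉ (there (here refl)) = 3≤D⇒¬B (B-nbr Bk (Ear.vy ek)) Br
      t∉ (there (there (here t≡s))) = t≢s t≡s
    by : Dec (B c) → Dec (B d) → 6 ≤ charge x
    by (no ¬b) _ = four xc xd c∉ d∉ (+-mono-≤ (¬B⇒w ¬b) (1≤w d))
    by (yes _) (no ¬b) = four xc xd c∉ d∉ (+-mono-≤ (1≤w c) (¬B⇒w ¬b))
    by (yes Bc) (yes Bd) with other xc c∉ Bc | other xd (d∉ ∘ there) Bd
    ... | inj₁ h | _ = h
    ... | inj₂ _ | inj₁ h = h
    ... | inj₂ ec | inj₂ ed with fresh (d ∷ c ∷ r ∷ s ∷ []) (three-ears er ec ed (c∉ ∘ here ∘ sym) (d∉ ∘ there ∘ here ∘ sym) (d∉ ∘ here ∘ sym))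
    ... | g , xg , g∉ = charge≥ 6
      (((g∉ ∘ here) ∷ (g∉ ∘ there ∘ here) ∷ (g∉ ∘ there ∘ there ∘ here) ∷ (g∉ ∘ there ∘ there ∘ there ∘ here) ∷ [])
        ∷ ((d∉ ∘ here) ∷ (d∉ ∘ there ∘ here) ∷ (d∉ ∘ there ∘ there ∘ here) ∷ [])
        ∷ ((c∉ ∘ here) ∷ (c∉ ∘ there ∘ here) ∷ []) ∷ (E⇒≢ rs ∷ []) ∷ [] ∷ [])
      (xg ∷ xd ∷ xc ∷ xr ∷ xs ∷ [])
      (+-mono-≤ (1≤w g) (+-mono-≤ (1≤w d) (+-mono-≤ (1≤w c) (+-mono-≤ (1≤w r) (+-mono-≤ (3≤D⇒w Ds) z≤n)))))

  -- Pendants and the classification of vertices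

  Normal : Fin n → Set
  Normal v = B v ⊎ 3 ≤ D v

  f≥6 : ∀ {v} → Normal v → 6 ≤ f v
  f≥6 {v} (inj₂ le) = ≤-trans (charge≥6 le) (charge≤f v)
  f≥6 {v} (inj₁ b) with fresh [] (≤-trans (s≤s z≤n) (≤-reflexive (sym (B.degree b))))
  ... | x , vx , _ with ear-at (B.degree b) vx
  ... | y , e = +-mono-≤
      (charge≥ 4 ((Ear.x≢y e ∷ []) ∷ [] ∷ []) (vx ∷ Ear.vy e ∷ [])
        (+-mono-≤ (3≤D⇒w (B-nbr b vx)) (+-mono-≤ (3≤D⇒w (B-nbr b (Ear.vy e))) z≤n)))
      gain
    where
    gain : 2 ≤ 2 * (2 ∸ w v)
    gain with B? v
    ... | yes _ = ≤-refl
    ... | no ¬b = contradiction b ¬b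

  -- A leaf is the case v = v′; otherwise v, v′, y is a triangle attached to the rest of the graph at y.
  record Pendant (v v′ y : Fin n) : Set where
    field
      vy   : E v y
      v′y  : E v′ y
      only  : ∀ {u} → E v u → u ≡ v′ ⊎ u ≡ y
      only′ : ∀ {u} → E v′ u → u ≡ v ⊎ u ≡ y
      edge : v ≢ v′ → E v v′
      hub  : 3 ≤ D y

  flip-pendant : ∀ {v v′ y} → Pendant v v′ y → Pendant v′ v y
  flip-pendant p = record { vy = v′y ; v′y = vy ; only = only′ ; only′ = only ; edge = λ ne → E-sym (edge (ne ∘ sym)) ; hub = hub }
    where open Pendant p

  D-pendant : ∀ {v v′ y} → Pendant v v′ y → D v ≤ 2
  D-pendant {v} {v′} {y} p = length-⊆ {ys = v′ ∷ y ∷ []} (nb-unique v) λ u∈ → [ here , there ∘ here ]′ (Pendant.only p (nb⁻ u∈))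

  -- A leaf has `f` at least 2 and each of the two vertices of a pendant triangle at least 4. Since
  -- the two indicators coincide at a leaf, in both cases the pendant as a whole is granted a
  -- deficit of 4.
  f-pendant : ∀ {v v′ y} → Pendant v v′ y → 6 ≤ f v + 2 * (δ v v + δ v′ v)
  f-pendant {v} {v′} {y} p = by (v ≟ v′)
    where
    open Pendant p
    by : Dec (v ≡ v′) → 6 ≤ f v + 2 * (δ v v + δ v′ v)
    by (yes refl) = +-mono-≤
          (≤-trans (charge≥ 2 ([] ∷ []) (vy ∷ []) (+-mono-≤ (3≤D⇒w hub) z≤n)) (charge≤f v))
          (*-monoʳ-≤ 2 (+-mono-≤ {1} {δ v v} {1} {δ v v} (1≤δ v) (1≤δ v)))
    by (no v≢v′) = +-mono-≤
          (≤-trans (charge≥ 4 ((E⇒≢ v′y ∷ []) ∷ [] ∷ []) (edge v≢v′ ∷ vy ∷ [])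
            (+-mono-≤ (¬B⇒w (λ b → <⇒≱ (B-nbr b (E-sym (edge v≢v′))) (D-pendant p))) (+-mono-≤ (3≤D⇒w hub) z≤n))) (charge≤f v))
          (*-monoʳ-≤ 2 (≤-trans (1≤δ v) (m≤m+n (δ v v) (δ v′ v))))

  -- The neighbour of a leaf cannot have degree 2, since its two neighbours would be adjacent and
  -- the leaf would have a second neighbour. When no vertex next to `v` has degree at least 3, what
  -- is left is an isolated vertex, edge or triangle, that is, a small component.
  classify : ∀ v → Goal ⊎ (∃₂ λ v′ y → Pendant v v′ y) ⊎ Normal v
  classify v = by-degree (D v) refl
    where
    by-degree : ∀ d → D v ≡ d → Goal ⊎ (∃₂ λ v′ y → Pendant v v′ y) ⊎ Normal v
    by-degree 0 Dv = inj₁ (small-component [ v ] (here refl) (s≤s z≤n)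
              λ { (here refl) e → contradiction (length≤D ([] ∷ []) (e ∷ [])) (λ le → <⇒≱ le (≤-reflexive Dv)) })
    by-degree (suc (suc (suc _))) Dv = inj₂ (inj₂ (inj₂ (subst (3 ≤_) (sym Dv) (s≤s (s≤s (s≤s z≤n))))))
    by-degree 1 Dv with fresh [] (≤-reflexive (sym Dv))
    ... | x , vx , _ = by (3 ≤? D x) (2 ≤? D x)
      where
      only : ∀ {u} → E v u → u ≡ x
      only e with saturated (≤-reflexive Dv) ([] ∷ []) (vx ∷ []) e
      ... | here eq = eq
      by : Dec (3 ≤ D x) → Dec (2 ≤ D x) → Goal ⊎ (∃₂ λ v′ y → Pendant v v′ y) ⊎ Normal v
      by (yes hub) _ = inj₂ (inj₁ (v , x , record { vy = vx ; v′y = vx ; only = inj₂ ∘ only ; only′ = inj₂ ∘ only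
                                       ; edge = λ ne → contradiction refl ne ; hub = hub }))
      by (no ¬3) (yes 2≤) = contradiction (sym (only (Ear.xy e))) (E⇒≢ (Ear.vy e))
        where
        Dx : D x ≡ 2
        Dx = ≤-antisym (≤-pred (≰⇒> ¬3)) 2≤
        e = proj₂ (ear-at Dx (E-sym vx))
      by (no _) (no ¬2) = inj₁ (small-component (v ∷ x ∷ []) (here refl) (s≤s (s≤s z≤n))
        λ { (here refl) e → there (here (only e))
          ; (there (here refl)) e → here (case-here (saturated (≤-pred (≰⇒> ¬2)) ([] ∷ []) (E-sym vx ∷ []) e)) })
        where
        case-here : ∀ {u} → u ∈ [ v ] → u ≡ v
        case-here (here eq) = eq
    by-degree 2 Dv with fresh [] (≤-trans (s≤s z≤n) (≤-reflexive (sym Dv)))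
    ... | x , vx , _ with ear-at Dv vx
    ... | y , ear _ vy x≢y xy only = by (3 ≤? D x) (3 ≤? D y)
      where
      by : Dec (3 ≤ D x) → Dec (3 ≤ D y) → Goal ⊎ (∃₂ λ v′ y → Pendant v v′ y) ⊎ Normal v
      by (yes 3x) (yes 3y) = inj₂ (inj₂ (inj₁ (mkB Dv (All.tabulate λ u∈ → [ (λ { refl → 3x }) , (λ { refl → 3y }) ]′ (only (nb⁻ u∈))))))
      by (no ¬x) (yes 3y) = inj₂ (inj₁ (x , y , record { vy = vy ; v′y = xy ; only = only
        ; only′ = pair (≤-pred (≰⇒> ¬x)) (E-sym vx) xy (E⇒≢ vy) ; edge = λ _ → vx ; hub = 3y }))
      by (yes 3x) (no ¬y) = inj₂ (inj₁ (y , x , record { vy = vx ; v′y = E-sym xy ; only = [ inj₂ , inj₁ ]′ ∘ only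
        ; only′ = pair (≤-pred (≰⇒> ¬y)) (E-sym vy) (E-sym xy) (E⇒≢ vx) ; edge = λ _ → vy ; hub = 3x }))
      by (no ¬x) (no ¬y) = inj₁ (small-component (v ∷ x ∷ y ∷ []) (here refl) ≤-refl λ
        { (here refl) e → [ there ∘ here , there ∘ there ∘ here ]′ (only e)
        ; (there (here refl)) e → [ here , there ∘ there ∘ here ]′ (pair (≤-pred (≰⇒> ¬x)) (E-sym vx) xy (E⇒≢ vy) e)
        ; (there (there (here refl))) e → [ here , there ∘ here ]′ (pair (≤-pred (≰⇒> ¬y)) (E-sym vy) (E-sym xy) (E⇒≢ vx) e) })

  search : ∀ L → Goal ⊎ (∃ λ v → v ∉ L × ∃₂ λ v′ y → Pendant v v′ y) ⊎ (∀ v → v ∉ L → Normal v)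
  search L = [ inj₁ , [ inj₂ ∘ inj₁ , (λ ps → inj₂ (inj₂ (λ v → All.lookup ps (∈-allFin v)))) ]′ ]′ (go (allFin n))
    where
    go : ∀ l → Goal ⊎ (∃ λ v → v ∉ L × ∃₂ λ v′ y → Pendant v v′ y) ⊎ All (λ v → v ∉ L → Normal v) l
    go [] = inj₂ (inj₂ [])
    go (v ∷ l) with v ∈? L | go l
    ... | _ | inj₁ g = inj₁ g
    ... | _ | inj₂ (inj₁ p) = inj₂ (inj₁ p)
    ... | yes v∈ | inj₂ (inj₂ ps) = inj₂ (inj₂ ((λ v∉ → contradiction v∈ v∉) ∷ ps))
    ... | no v∉ | inj₂ (inj₂ ps) with classify v
    ... | inj₁ g = inj₁ g
    ... | inj₂ (inj₁ p) = inj₂ (inj₁ (v , v∉ , p))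
    ... | inj₂ (inj₂ q) = inj₂ (inj₂ ((λ _ → q) ∷ ps))

  -- The function `s` records the surplus over the target 6, and `l` half of the permitted deficit.
  account : ∀ (s l : Fin n → ℕ) → (∀ v → 6 + s v ≤ f v + 2 * l v) → n * 6 + Σ[ s ] ≤ 4 * edgeCount G + 2 * Σ[ l ]
  account s l h = begin
    n * 6 + Σ[ s ]                    ≡⟨ cong (_+ Σ[ s ]) (Σ-const {n} 6) ⟨
    Σ[ (λ (_ : Fin n) → 6) ] + Σ[ s ]           ≡⟨ sum-map-+ (λ _ → 6) s (allFin n) ⟨
    Σ[ (λ v → 6 + s v) ]              ≤⟨ sum-map-≤ (allFin n) h ⟩
    Σ[ (λ v → f v + 2 * l v) ]        ≡⟨ sum-map-+ f (λ v → 2 * l v) (allFin n) ⟩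
    Σ[ f ] + Σ[ (λ v → 2 * l v) ]     ≡⟨ cong₂ _+_ Σf≡4e (sum-map-* 2 l (allFin n)) ⟩
    4 * edgeCount G + 2 * Σ[ l ]      ∎
    where open ≤-Reasoning

-- The m + 1 vertices outside the pendants form a clique, of degree sum m + m². A pendant with k
-- vertices adds k(k - 1) for its inner edges and 2k for those to its hub, hence k² + k.
three-pendant-claim : ∀ {n e} m k₁ k₂ k₃ → k₁ ≡ 1 ⊎ k₁ ≡ 2 → k₂ ≡ 1 ⊎ k₂ ≡ 2 → k₃ ≡ 1 ⊎ k₃ ≡ 2 →
  n ≡ suc (k₁ + k₂ + k₃) + m →
  m + m * m + (k₁ * k₁ + k₂ * k₂ + k₃ * k₃ + (k₁ + k₂ + k₃)) ≤ 2 * e → Claim n e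
three-pendant-claim {n} {e} m _ _ _ = λ where
    (inj₁ refl) (inj₁ refl) (inj₁ refl) → p3
    (inj₁ refl) (inj₁ refl) (inj₂ refl) → p4
    (inj₁ refl) (inj₂ refl) (inj₁ refl) → p4
    (inj₂ refl) (inj₁ refl) (inj₁ refl) → p4
    (inj₁ refl) (inj₂ refl) (inj₂ refl) → p5
    (inj₂ refl) (inj₁ refl) (inj₂ refl) → p5
    (inj₂ refl) (inj₂ refl) (inj₁ refl) → p5
    (inj₂ refl) (inj₂ refl) (inj₂ refl) → p6
  where
  quadratic : ∀ j → 3 + j ≤ m → 2 * m + (1 + j) ≤ m * m
  quadratic j le = ≤-trans (+-monoʳ-≤ (2 * m) (≤-trans (+-monoˡ-≤ j (s≤s (z≤n {2}))) le))
    (≤-trans (≤-reflexive (collect m)) (*-monoʳ-≤ m (≤-trans (m≤m+n 3 j) le)))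
    where
    collect : ∀ m → 2 * m + m ≡ m * 3
    collect = solve-∀
  p3 : n ≡ 4 + m → m + m * m + 6 ≤ 2 * e → Claim n e
  p3 refl h = (λ { refl → *-cancelˡ-≤ 2 (≤-trans (m≤m+n 20 6) h) }) , (λ { refl → *-cancelˡ-≤ 2 (≤-trans (m≤m+n 24 12) h) }) ,
    λ le → ≤-trans (≤-trans (≤-reflexive (l m)) (≤-trans (+-monoˡ-≤ (m + 8) (quadratic 3 (+-cancelˡ-≤ 4 6 m le))) (≤-reflexive (r m)))) (+-monoˡ-≤ 2 h)
    where
    l : ∀ m → 3 * (4 + m) ≡ 2 * m + 4 + (m + 8)
    l = solve-∀
    r : ∀ m → m * m + (m + 8) ≡ m + m * m + 6 + 2
    r = solve-∀
  p4 : n ≡ 5 + m → m + m * m + 10 ≤ 2 * e → Claim n e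
  p4 refl h = (λ { refl → *-cancelˡ-≤ 2 (≤-trans (m≤m+n 20 2) h) }) , (λ { refl → *-cancelˡ-≤ 2 (≤-trans (m≤m+n 24 6) h) }) ,
    λ le → ≤-trans (≤-trans (≤-reflexive (l m)) (≤-trans (+-monoˡ-≤ (m + 12) (quadratic 2 (+-cancelˡ-≤ 5 5 m le))) (≤-reflexive (r m)))) (+-monoˡ-≤ 2 h)
    where
    l : ∀ m → 3 * (5 + m) ≡ 2 * m + 3 + (m + 12)
    l = solve-∀
    r : ∀ m → m * m + (m + 12) ≡ m + m * m + 10 + 2
    r = solve-∀
  p5 : n ≡ 6 + m → m + m * m + 14 ≤ 2 * e → Claim n e
  p5 refl h = (λ { refl → *-cancelˡ-≤ 2 h }) , (λ { refl → *-cancelˡ-≤ 2 (≤-trans (m≤m+n 24 2) h) }) ,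
    λ le → ≤-trans (≤-trans (≤-reflexive (l m)) (≤-trans (+-monoˡ-≤ (m + 16) (quadratic 1 (+-cancelˡ-≤ 6 4 m le))) (≤-reflexive (r m)))) (+-monoˡ-≤ 2 h)
    where
    l : ∀ m → 3 * (6 + m) ≡ 2 * m + 2 + (m + 16)
    l = solve-∀
    r : ∀ m → m * m + (m + 16) ≡ m + m * m + 14 + 2
    r = solve-∀
  p6 : n ≡ 7 + m → m + m * m + 18 ≤ 2 * e → Claim n e
  -- With three pendant triangles the count is exactly 20 at n = 8 and 24 at n = 9: these are the
  -- exceptional values 10 and 12.
  p6 refl h = (λ { refl → *-cancelˡ-≤ 2 h }) , (λ { refl → *-cancelˡ-≤ 2 h }) ,
    λ le → ≤-trans (≤-trans (≤-reflexive (l m)) (≤-trans (+-monoˡ-≤ (m + 20) (quadratic 0 (+-cancelˡ-≤ 7 3 m le))) (≤-reflexive (r m)))) (+-monoˡ-≤ 2 h)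
    where
    l : ∀ m → 3 * (7 + m) ≡ 2 * m + 1 + (m + 20)
    l = solve-∀
    r : ∀ m → m * m + (m + 20) ≡ m + m * m + 18 + 2
    r = solve-∀

-- The claim amounts to 6n ≤ 4e + 4. Both 6n and 4e are even, so 6n ≤ 4e + 5 is enough, and a net
-- deficit of 5 is tolerated.
halved-claim : ∀ {n e s l} → n * 6 + s ≤ 4 * e + 2 * l → 2 * l ≤ 5 + s → Claim n e
halved-claim {n} {e} {s} {l} h le with 3 * n ≤? 2 * e + 2
... | yes p = strong-claim p
... | no ¬p = contradiction (+-cancelʳ-≤ s (n * 6) (4 * e + 5) (≤-trans h (≤-trans (+-monoʳ-≤ (4 * e) le) (≤-reflexive (sym (+-assoc (4 * e) 5 s))))))
    (<⇒≱ (≤-trans (≤-reflexive (l₁ e)) (≤-trans (*-monoʳ-≤ 2 (≰⇒> ¬p)) (≤-reflexive (l₂ n)))))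
  where
  l₁ : ∀ e → suc (4 * e + 5) ≡ 2 * suc (2 * e + 2)
  l₁ = solve-∀
  l₂ : ∀ n → 2 * (3 * n) ≡ n * 6
  l₂ = solve-∀

-- Three pendants

module Pendants {n : ℕ} (G : Graph n) (mnt : MaximalNontraceable G) (8≤n : 8 ≤ n) where

  open Counting G mnt 8≤n public

  pendant-closed : ∀ {v v′ y} → Pendant v v′ y → WE.Closed (_∈ v ∷ v′ ∷ []) [ y ]
  pendant-closed p (here refl) e = [ inj₁ ∘ there ∘ here , inj₂ ∘ here ]′ (Pendant.only p e)
  pendant-closed p (there (here refl)) e = [ inj₁ ∘ here , inj₂ ∘ here ]′ (Pendant.only′ p e)

  low : ∀ {v v′ y u} → Pendant v v′ y → u ∈ v ∷ v′ ∷ [] → D u ≤ 2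
  low p (here refl) = D-pendant p
  low p (there (here refl)) = D-pendant (flip-pendant p)

  hub∉ : ∀ {v v′ y x} → Pendant v v′ y → 3 ≤ D x → x ∉ v ∷ v′ ∷ []
  hub∉ p le x∈ = <⇒≱ le (low p x∈)

  pendant-hub : ∀ {v v′ y u} → Pendant v v′ y → u ∈ v ∷ v′ ∷ [] → E u y
  pendant-hub p (here refl) = Pendant.vy p
  pendant-hub p (there (here refl)) = Pendant.v′y p

  pendant-w : ∀ {v v′ y} → Pendant v v′ y → 2 ≤ w v
  pendant-w {v} p = ¬B⇒w λ b → let s , e = ear-at (B.degree b) (Pendant.vy p) in
    [ (λ { refl → <⇒≱ (B-nbr b (Ear.vy e)) (D-pendant (flip-pendant p)) }) , Ear.x≢y e ∘ sym ]′ (Pendant.only p (Ear.vy e))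

  -- If `u′` lay in the first pendant, its neighbour `u` would lie there too or be the hub, but a
  -- hub has degree at least 3.
  pendants-disjoint : ∀ {v v′ y u u′ z} → Pendant v v′ y → Pendant u u′ z → u ∉ v ∷ v′ ∷ [] →
    ∀ {x} → x ∈ u ∷ u′ ∷ [] → x ∉ v ∷ v′ ∷ []
  pendants-disjoint p q u∉ (here refl) = u∉
  pendants-disjoint {u = u} {u′} p q u∉ (there (here refl)) u′∈ with u ≟ u′
  ... | yes refl = u∉ u′∈
  ... | no u≢u′ with pendant-closed p u′∈ (E-sym (Pendant.edge q u≢u′))
  ... | inj₁ u∈ = u∉ u∈
  ... | inj₂ (here refl) = <⇒≱ (Pendant.hub p) (D-pendant q)

  closed∉ : ∀ {u v P S} → WE.Closed P S → ¬ P u → ¬ P v → W⁺.Closed u v P S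
  closed∉ {u} {v} {P} cl ¬u ¬v = closed⁺ {P = P} cl (λ p → contradiction p ¬u) (λ p → contradiction p ¬v)

  -- The vertices of a pendant without the repetition in `v ∷ v′ ∷ []` that a leaf causes, in an
  -- order that can be continued to the hub.
  record Extent (v v′ : Fin n) : Set where
    field
      vertices : List (Fin n)
      unique   : Unique vertices
      size     : length vertices ≡ 1 ⊎ length vertices ≡ 2
      sound    : ∀ {u} → u ∈ vertices → u ∈ v ∷ v′ ∷ []
      complete : ∀ {u} → u ∈ v ∷ v′ ∷ [] → u ∈ vertices
      walk     : ∀ {y} → Pendant v v′ y → Linked E (vertices ++ [ y ])

  extent : ∀ v v′ {y} → Pendant v v′ y → Extent v v′
  extent v v′ p with v ≟ v′
  ... | yes refl = record { vertices = [ v ] ; unique = [] ∷ [] ; size = inj₁ refl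
        ; sound = λ { (here eq) → here eq } ; complete = λ { (here eq) → here eq ; (there (here eq)) → here eq }
        ; walk = λ q → Pendant.vy q ∷ [-] }
  ... | no v≢v′ = record { vertices = v ∷ v′ ∷ [] ; unique = (v≢v′ ∷ []) ∷ [] ∷ [] ; size = inj₂ refl
        ; sound = id ; complete = id ; walk = λ q → Pendant.edge p v≢v′ ∷ Pendant.v′y q ∷ [-] }

  κ-∉ : ∀ {C v} → v ∉ C → κ C v ≡ 0
  κ-∉ {[]} v∉ = refl
  κ-∉ {c ∷ C} {v} v∉ = cong₂ _+_ (δ-≢ (v∉ ∘ here)) (κ-∉ (v∉ ∘ there))

  κ-unique : ∀ {C v} → Unique C → v ∈ C → κ C v ≡ 1
  κ-unique {c ∷ C} {v} (c∉ ∷ u) (here refl) = cong₂ _+_ (δ-refl v) (κ-∉ (λ v∈ → All.lookup c∉ v∈ refl))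
  κ-unique {c ∷ C} {v} (c∉ ∷ u) (there v∈) = cong₂ _+_ (δ-≢ {x = c} {v} (λ { refl → All.lookup c∉ v∈ refl })) (κ-unique u v∈)

  extent-D : ∀ {v v′ y u} (p : Pendant v v′ y) → u ∈ v ∷ v′ ∷ [] → length (Extent.vertices (extent v v′ p)) ≤ D u
  extent-D {v} {v′} p u∈ with v ≟ v′
  extent-D p (here refl) | yes refl = length≤D ([] ∷ []) (Pendant.vy p ∷ [])
  extent-D p (there (here refl)) | yes refl = length≤D ([] ∷ []) (Pendant.vy p ∷ [])
  extent-D p (here refl) | no v≢v′ = length≤D ((E⇒≢ (Pendant.v′y p) ∷ []) ∷ [] ∷ []) (Pendant.edge p v≢v′ ∷ Pendant.vy p ∷ [])
  extent-D p (there (here refl)) | no v≢v′ = length≤D ((E⇒≢ (Pendant.vy p) ∷ []) ∷ [] ∷ []) (E-sym (Pendant.edge p v≢v′) ∷ Pendant.v′y p ∷ [])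

  module ThreePendants {v₁ v₁′ y₁ v₂ v₂′ y₂ v₃ v₃′ y₃}
    (p₁ : Pendant v₁ v₁′ y₁) (p₂ : Pendant v₂ v₂′ y₂) (p₃ : Pendant v₃ v₃′ y₃)
    (v₂∉ : v₂ ∉ v₁ ∷ v₁′ ∷ []) (v₃∉₁ : v₃ ∉ v₁ ∷ v₁′ ∷ []) (v₃∉₂ : v₃ ∉ v₂ ∷ v₂′ ∷ []) where

    A₁ A₂ A₃ : List (Fin n)
    A₁ = v₁ ∷ v₁′ ∷ []
    A₂ = v₂ ∷ v₂′ ∷ []
    A₃ = v₃ ∷ v₃′ ∷ []
    P₁ P₂ P₃ : List (Fin n)
    P₁ = Extent.vertices (extent v₁ v₁′ p₁)
    P₂ = Extent.vertices (extent v₂ v₂′ p₂)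
    P₃ = Extent.vertices (extent v₃ v₃′ p₃)
    k₁ k₂ k₃ : ℕ
    k₁ = length P₁
    k₂ = length P₂
    k₃ = length P₃
    d₂₁ : ∀ {x} → x ∈ A₂ → x ∉ A₁
    d₂₁ = pendants-disjoint p₁ p₂ v₂∉
    d₃₁ : ∀ {x} → x ∈ A₃ → x ∉ A₁
    d₃₁ = pendants-disjoint p₁ p₃ v₃∉₁
    d₃₂ : ∀ {x} → x ∈ A₃ → x ∉ A₂
    d₃₂ = pendants-disjoint p₂ p₃ v₃∉₂

    record Core (u : Fin n) : Set where
      constructor core
      field
        ∉₁ : u ∉ A₁
        ∉₂ : u ∉ A₂
        ∉₃ : u ∉ A₃

    clique : ∀ {u v} → Core u → Core v → u ≢ v → E u v
    clique {u} {v} (core u₁ u₂ u₃) (core x₁ x₂ x₃) u≢v = forced u≢v (W⁺.three-ends u v (_∈? A₁) (_∈? A₂) (_∈? A₃)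
      (closed∉ (pendant-closed p₁) u₁ x₁) (closed∉ (pendant-closed p₂) u₂ x₂) (closed∉ (pendant-closed p₃) u₃ x₃)
      (hub∉ p₁ (Pendant.hub p₁)) (hub∉ p₂ (Pendant.hub p₂)) (hub∉ p₃ (Pendant.hub p₃))
      (v₁ , here refl) (v₂ , here refl) (v₃ , here refl)
      (λ a b → d₂₁ b a) (λ a b → d₃₁ b a) (λ a b → d₃₂ b a))

    -- The vertices of the pendant `P` that a core vertex `v` may fail to be adjacent to: none if
    -- `v` is the hub `y`.
    missed : Fin n → List (Fin n) → Fin n → List (Fin n)
    missed y P v with v ≟ y
    ... | yes _ = []
    ... | no _ = P

    length-missed : ∀ y P v → length (missed y P v) + δ y v * length P ≡ length P
    length-missed y P v = by (v ≟ y)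
      where
      by : Dec (v ≡ y) → length (missed y P v) + δ y v * length P ≡ length P
      by (yes refl) with v ≟ v
      ... | yes _ = +-identityʳ _
      ... | no v≢v = contradiction refl v≢v
      by (no v≢y) with v ≟ y
      ... | yes v≡y = contradiction v≡y v≢y
      ... | no _ = +-identityʳ _

    missed-∈ : ∀ {v v′ y x u} (p : Pendant v v′ y) → u ∈ v ∷ v′ ∷ [] →
               u ∈ missed y (Extent.vertices (extent v v′ p)) x ⊎ E x u
    missed-∈ {v} {v′} {y} {x} p u∈ with x ≟ y
    ... | yes refl = inj₂ (E-sym (pendant-hub p u∈))
    ... | no _ = inj₁ (Extent.complete (extent v v′ p) u∈)

    -- Every vertex is `v` itself, a neighbour of `v`, or in a pendant whose hub is not `v`. In
    -- other words `D v` is at least m plus the sizes of the pendants at `v`, written without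
    -- subtraction.
    degree : ∀ {v} → Core v → n + (δ y₁ v * k₁ + δ y₂ v * k₂ + δ y₃ v * k₃) ≤ suc (k₁ + k₂ + k₃) + D v
    degree {v} cv = begin
      n + (s₁ + s₂ + s₃)                                   ≡⟨ cong (_+ (s₁ + s₂ + s₃)) (length-tabulate {n = n} id) ⟨
      length (allFin n) + (s₁ + s₂ + s₃)                   ≤⟨ +-monoˡ-≤ (s₁ + s₂ + s₃) (length-⊆ (Uniqueₚ.allFin⁺ n) (λ {u} _ → cover u)) ⟩
      suc (length (M₁ ++ M₂ ++ M₃ ++ nb v)) + (s₁ + s₂ + s₃) ≡⟨ cong (λ z → suc z + (s₁ + s₂ + s₃)) len ⟩
      suc (length M₁ + (length M₂ + (length M₃ + D v))) + (s₁ + s₂ + s₃) ≡⟨ regroup (length M₁) (length M₂) (length M₃) (D v) s₁ s₂ s₃ ⟩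
      suc ((length M₁ + s₁) + (length M₂ + s₂) + (length M₃ + s₃)) + D v
        ≡⟨ cong (λ z → suc z + D v) (cong₂ _+_ (cong₂ _+_ (length-missed y₁ P₁ v) (length-missed y₂ P₂ v)) (length-missed y₃ P₃ v)) ⟩
      suc (k₁ + k₂ + k₃) + D v                             ∎
      where
      open ≤-Reasoning
      s₁ = δ y₁ v * k₁
      s₂ = δ y₂ v * k₂
      s₃ = δ y₃ v * k₃
      M₁ = missed y₁ P₁ v
      M₂ = missed y₂ P₂ v
      M₃ = missed y₃ P₃ v
      len : length (M₁ ++ M₂ ++ M₃ ++ nb v) ≡ length M₁ + (length M₂ + (length M₃ + D v))
      len = trans (length-++ M₁) (cong (length M₁ +_) (trans (length-++ M₂) (cong (length M₂ +_) (length-++ M₃))))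
      regroup : ∀ a b c d x y z → suc (a + (b + (c + d))) + (x + y + z) ≡ suc ((a + x) + (b + y) + (c + z)) + d
      regroup = solve-∀
      in-nb : ∀ {u} → E v u → u ∈ v ∷ M₁ ++ M₂ ++ M₃ ++ nb v
      in-nb e = there (∈-++⁺ʳ M₁ (∈-++⁺ʳ M₂ (∈-++⁺ʳ M₃ (nb⁺ e))))
      cover : ∀ u → u ∈ v ∷ M₁ ++ M₂ ++ M₃ ++ nb v
      cover u with u ≟ v | u ∈? A₁ | u ∈? A₂ | u ∈? A₃
      ... | yes u≡v | _ | _ | _ = here u≡v
      ... | no _ | yes u∈ | _ | _ = [ there ∘ ∈-++⁺ˡ , in-nb ]′ (missed-∈ p₁ u∈)
      ... | no _ | no _ | yes u∈ | _ = [ there ∘ ∈-++⁺ʳ M₁ ∘ ∈-++⁺ˡ , in-nb ]′ (missed-∈ p₂ u∈)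
      ... | no _ | no _ | no _ | yes u∈ = [ there ∘ ∈-++⁺ʳ M₁ ∘ ∈-++⁺ʳ M₂ ∘ ∈-++⁺ˡ , in-nb ]′ (missed-∈ p₃ u∈)
      ... | no u≢v | no a | no b | no c = in-nb (clique cv (core a b c) (u≢v ∘ sym))

    size≤ : ∀ {k} → k ≡ 1 ⊎ k ≡ 2 → k ≤ 2
    size≤ (inj₁ refl) = s≤s z≤n
    size≤ (inj₂ refl) = ≤-refl

    z₁ = Extent.size (extent v₁ v₁′ p₁)
    z₂ = Extent.size (extent v₂ v₂′ p₂)
    z₃ = Extent.size (extent v₃ v₃′ p₃)

    m : ℕ
    m = n ∸ suc (k₁ + k₂ + k₃)

    n≡ : n ≡ suc (k₁ + k₂ + k₃) + m
    n≡ = sym (m+[n∸m]≡n (≤-trans (s≤s (+-mono-≤ (+-mono-≤ (size≤ z₁) (size≤ z₂)) (size≤ z₃))) (≤-trans (n≤1+n 7) 8≤n)))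

    -- One inequality for all vertices, with `c` marking membership in a pendant and `d` marking a
    -- hub. In the i-th pendant it reads kᵢ ≤ D, and in the core it is `degree`.
    Bound : (D c₁ c₂ c₃ d₁ d₂ d₃ : ℕ) → Set
    Bound D c₁ c₂ c₃ d₁ d₂ d₃ = m + (k₁ * c₁ + k₂ * c₂ + k₃ * c₃) + (d₁ * k₁ + d₂ * k₂ + d₃ * k₃) ≤ D + m * (c₁ + c₂ + c₃)

    pointwise : ∀ v → Bound (D v) (κ P₁ v) (κ P₂ v) (κ P₃ v) (δ y₁ v) (δ y₂ v) (δ y₃ v)
    pointwise v with v ∈? A₁ | v ∈? A₂ | v ∈? A₃
    ... | yes v∈ | _ | _
        rewrite κ-unique (Extent.unique (extent v₁ v₁′ p₁)) (Extent.complete (extent v₁ v₁′ p₁) v∈)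
              | κ-∉ (λ x → d₂₁ (Extent.sound (extent v₂ v₂′ p₂) x) v∈) | κ-∉ (λ x → d₃₁ (Extent.sound (extent v₃ v₃′ p₃) x) v∈)
              | δ-≢ {x = y₁} {v} (λ { refl → hub∉ p₁ (Pendant.hub p₁) v∈ })
              | δ-≢ {x = y₂} {v} (λ { refl → hub∉ p₁ (Pendant.hub p₂) v∈ })
              | δ-≢ {x = y₃} {v} (λ { refl → hub∉ p₁ (Pendant.hub p₃) v∈ })
        = ≤-trans (≤-reflexive (s m k₁ k₂ k₃)) (+-monoˡ-≤ _ (extent-D p₁ v∈))
      where
      s : ∀ m a b c → m + (a * 1 + b * 0 + c * 0) + 0 ≡ a + m * 1
      s = solve-∀
    ... | no ∉₁ | yes v∈ | _
        rewrite κ-∉ (∉₁ ∘ Extent.sound (extent v₁ v₁′ p₁)) | κ-unique (Extent.unique (extent v₂ v₂′ p₂)) (Extent.complete (extent v₂ v₂′ p₂) v∈)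
              | κ-∉ (λ x → d₃₂ (Extent.sound (extent v₃ v₃′ p₃) x) v∈)
              | δ-≢ {x = y₁} {v} (λ { refl → hub∉ p₂ (Pendant.hub p₁) v∈ })
              | δ-≢ {x = y₂} {v} (λ { refl → hub∉ p₂ (Pendant.hub p₂) v∈ })
              | δ-≢ {x = y₃} {v} (λ { refl → hub∉ p₂ (Pendant.hub p₃) v∈ })
        = ≤-trans (≤-reflexive (s m k₁ k₂ k₃)) (+-monoˡ-≤ _ (extent-D p₂ v∈))
      where
      s : ∀ m a b c → m + (a * 0 + b * 1 + c * 0) + 0 ≡ b + m * 1
      s = solve-∀
    ... | no ∉₁ | no ∉₂ | yes v∈
        rewrite κ-∉ (∉₁ ∘ Extent.sound (extent v₁ v₁′ p₁)) | κ-∉ (∉₂ ∘ Extent.sound (extent v₂ v₂′ p₂))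
              | κ-unique (Extent.unique (extent v₃ v₃′ p₃)) (Extent.complete (extent v₃ v₃′ p₃) v∈)
              | δ-≢ {x = y₁} {v} (λ { refl → hub∉ p₃ (Pendant.hub p₁) v∈ })
              | δ-≢ {x = y₂} {v} (λ { refl → hub∉ p₃ (Pendant.hub p₂) v∈ })
              | δ-≢ {x = y₃} {v} (λ { refl → hub∉ p₃ (Pendant.hub p₃) v∈ })
        = ≤-trans (≤-reflexive (s m k₁ k₂ k₃)) (+-monoˡ-≤ _ (extent-D p₃ v∈))
      where
      s : ∀ m a b c → m + (a * 0 + b * 0 + c * 1) + 0 ≡ c + m * 1
      s = solve-∀
    ... | no ∉₁ | no ∉₂ | no ∉₃
        rewrite κ-∉ (∉₁ ∘ Extent.sound (extent v₁ v₁′ p₁)) | κ-∉ (∉₂ ∘ Extent.sound (extent v₂ v₂′ p₂)) | κ-∉ (∉₃ ∘ Extent.sound (extent v₃ v₃′ p₃))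
        = +-cancelˡ-≤ (suc (k₁ + k₂ + k₃)) _ _ (≤-trans (≤-reflexive (trans (s (suc (k₁ + k₂ + k₃)) m k₁ k₂ k₃ X) (cong (_+ X) (sym n≡))))
            (≤-trans (degree (core ∉₁ ∉₂ ∉₃)) (≤-reflexive (t (suc (k₁ + k₂ + k₃)) m (D v)))))
      where
      X = δ y₁ v * k₁ + δ y₂ v * k₂ + δ y₃ v * k₃
      s : ∀ K m a b c X → K + (m + (a * 0 + b * 0 + c * 0) + X) ≡ K + m + X
      s = solve-∀
      t : ∀ K m d → K + d ≡ K + (d + m * 0)
      t = solve-∀

    Σ₃ : ∀ (f g h : Fin n → ℕ) → Σ[ (λ v → f v + g v + h v) ] ≡ Σ[ f ] + Σ[ g ] + Σ[ h ]
    Σ₃ f g h = trans (sum-map-+ (λ v → f v + g v) h (allFin n)) (cong (_+ Σ[ h ]) (sum-map-+ f g (allFin n)))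

    Σ-kκ : ∀ P → Σ[ (λ v → length P * κ P v) ] ≡ length P * length P
    Σ-kκ P = trans (sum-map-* (length P) (κ P) (allFin n)) (cong (length P *_) (Σ-κ P))

    Σ-δk : ∀ y k → Σ[ (λ v → δ y v * k) ] ≡ k
    Σ-δk y k = trans (sum-map-cong (allFin n) (λ v → *-comm (δ y v) k))
      (trans (sum-map-* k (δ y) (allFin n)) (trans (cong (k *_) (Σ-δ y)) (*-identityʳ k)))

    total : n * m + (k₁ * k₁ + k₂ * k₂ + k₃ * k₃) + (k₁ + k₂ + k₃) ≤ 2 * edgeCount G + m * (k₁ + k₂ + k₃)
    total = begin
      n * m + (k₁ * k₁ + k₂ * k₂ + k₃ * k₃) + (k₁ + k₂ + k₃)
        ≡⟨ cong₂ _+_ (cong₂ _+_ (Σ-const {n} m) (trans (Σ₃ a₁ a₂ a₃) (cong₂ _+_ (cong₂ _+_ (Σ-kκ P₁) (Σ-kκ P₂)) (Σ-kκ P₃))))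
             (trans (Σ₃ b₁ b₂ b₃) (cong₂ _+_ (cong₂ _+_ (Σ-δk y₁ k₁) (Σ-δk y₂ k₂)) (Σ-δk y₃ k₃))) ⟨
      Σ[ (λ (_ : Fin n) → m) ] + Σ[ (λ v → a₁ v + a₂ v + a₃ v) ] + Σ[ (λ v → b₁ v + b₂ v + b₃ v) ]
        ≡⟨ Σ₃ (λ _ → m) (λ v → a₁ v + a₂ v + a₃ v) (λ v → b₁ v + b₂ v + b₃ v) ⟨
      Σ[ (λ v → m + (a₁ v + a₂ v + a₃ v) + (b₁ v + b₂ v + b₃ v)) ]
        ≤⟨ sum-map-≤ (allFin n) pointwise ⟩
      Σ[ (λ v → D v + m * (κ P₁ v + κ P₂ v + κ P₃ v)) ]
        ≡⟨ trans (sum-map-+ D (λ v → m * (κ P₁ v + κ P₂ v + κ P₃ v)) (allFin n)) (cong₂ _+_ ΣD≡2e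
             (trans (sum-map-* m (λ v → κ P₁ v + κ P₂ v + κ P₃ v) (allFin n)) (cong (m *_) (trans (Σ₃ (κ P₁) (κ P₂) (κ P₃)) (cong₂ _+_ (cong₂ _+_ (Σ-κ P₁) (Σ-κ P₂)) (Σ-κ P₃)))))) ⟩
      2 * edgeCount G + m * (k₁ + k₂ + k₃) ∎
      where
      open ≤-Reasoning
      a₁ a₂ a₃ b₁ b₂ b₃ : Fin n → ℕ
      a₁ v = k₁ * κ P₁ v
      a₂ v = k₂ * κ P₂ v
      a₃ v = k₃ * κ P₃ v
      b₁ v = δ y₁ v * k₁
      b₂ v = δ y₂ v * k₂
      b₃ v = δ y₃ v * k₃

    goal : Goal
    -- Taking m(k₁ + k₂ + k₃) from both sides of `total` leaves m(m + 1) of the term nm.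
    goal = three-pendant-claim m k₁ k₂ k₃ z₁ z₂ z₃ n≡
      (+-cancelʳ-≤ (m * (k₁ + k₂ + k₃)) _ _ (≤-trans (≤-reflexive
        (trans (r m (k₁ + k₂ + k₃) (k₁ * k₁ + k₂ * k₂ + k₃ * k₃)) (cong (λ z → z * m + (k₁ * k₁ + k₂ * k₂ + k₃ * k₃) + (k₁ + k₂ + k₃)) (sym n≡)))) total))
      where
      r : ∀ m p q → m + m * m + (q + p) + m * p ≡ (suc p + m) * m + q + p
      r = solve-∀

inner-neighbours : ∀ {A : Set} {R : A → A → Set} {c d r} (M : List A) → Unique (c ∷ M ++ [ d ]) → Linked R (c ∷ M ++ [ d ]) → r ∈ M →
  ∃₂ λ p q → R p r × R r q × p ∈ c ∷ M ++ [ d ] × q ∈ c ∷ M ++ [ d ] × p ≢ q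
inner-neighbours {c = c} {d} (m ∷ []) ((_ ∷ c≢d ∷ []) ∷ _) (e ∷ e′ ∷ _) (here refl) =
  c , d , e , e′ , here refl , there (there (here refl)) , c≢d
inner-neighbours {c = c} (m ∷ m′ ∷ M) ((_ ∷ c≢m′ ∷ _) ∷ _) (e ∷ e′ ∷ _) (here refl) =
  c , m′ , e , e′ , here refl , there (there (here refl)) , c≢m′
inner-neighbours (m ∷ M) (_ ∷ u) (_ ∷ k) (there r∈) with inner-neighbours M u k r∈
... | p , q , e , e′ , p∈ , q∈ , p≢q = p , q , e , e′ , there p∈ , there q∈ , p≢q

predecessor : ∀ {A : Set} {R : A → A → Set} {c d r} (M : List A) → Linked R (c ∷ M ++ [ d ]) → r ∈ M → ∃ λ p → R p r × p ∈ c ∷ M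
predecessor {c = c} (m ∷ M) (e ∷ k) (here refl) = c , e , here refl
predecessor (m ∷ M) (e ∷ k) (there r∈) with predecessor M k r∈
... | p , e′ , p∈ = p , e′ , there p∈

Linked-prefix : ∀ {A : Set} {R : A → A → Set} as {bs} → Linked R (as ++ bs) → Linked R as
Linked-prefix [] k = []
Linked-prefix (a ∷ []) k = [-]
Linked-prefix (a ∷ b ∷ as) (e ∷ k) = e ∷ Linked-prefix (b ∷ as) k

-- Two pendants

module TwoPendants {n : ℕ} (G : Graph n) (mnt : MaximalNontraceable G) (8≤n : 8 ≤ n) where

  open Pendants G mnt 8≤n public

  record Setting (v₁ v₁′ y₁ v₂ v₂′ y₂ : Fin n) : Set where
    field
      p₁     : Pendant v₁ v₁′ y₁
      p₂     : Pendant v₂ v₂′ y₂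
      apart  : ∀ {x} → x ∈ v₂ ∷ v₂′ ∷ [] → x ∉ v₁ ∷ v₁′ ∷ []
      normal : ∀ {v} → v ∉ v₁ ∷ v₁′ ∷ [] → v ∉ v₂ ∷ v₂′ ∷ [] → Normal v

  swap-setting : ∀ {v₁ v₁′ y₁ v₂ v₂′ y₂} → Setting v₁ v₁′ y₁ v₂ v₂′ y₂ → Setting v₂ v₂′ y₂ v₁ v₁′ y₁
  swap-setting S = record { p₁ = p₂ ; p₂ = p₁ ; apart = λ x∈₁ x∈₂ → apart x∈₂ x∈₁ ; normal = λ a b → normal b a }
    where open Setting S

  f-pendant∈ : ∀ {v v′ y u} → Pendant v v′ y → u ∈ v ∷ v′ ∷ [] → 6 ≤ f u + 2 * (δ v u + δ v′ u)
  f-pendant∈ p (here refl) = f-pendant p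
  f-pendant∈ {v} {v′} {u = u} p (there (here refl)) =
    subst (λ z → 6 ≤ f u + 2 * z) (+-comm (δ v′ u) (δ v u)) (f-pendant (flip-pendant p))

  -- The 6 is the weight of three neighbours of z outside L.
  clique-hub : ∀ {z} L → length L < 8 → z ∈ L → (∀ {u v} → u ∉ L → v ∉ L → u ≢ v → E u v) →
    (∀ {r} → r ∉ L → E z r) → (∀ {r u} → r ∉ L → E r u → u ∉ L ⊎ u ≡ z) → (∀ {r} → r ∉ L → Normal r) →
    ∀ xs → (∀ {x} → x ∈ xs → x ∈ L) → Unique xs → All (E z) xs → 6 + sum (map w xs) ≤ charge z
  clique-hub {z} L lt z∈ cl hub out nrm xs ⊆L uq es = conclude (outside L lt)
    where
    3≤ : ∀ {r} → r ∉ L → 3 ≤ D r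
    3≤ {r} r∉ with nrm r∉
    ... | inj₂ le = le
    ... | inj₁ b with ear-at (B.degree b) (E-sym (hub r∉))
    ... | s , e with out r∉ (Ear.vy e)
    ... | inj₂ s≡z = contradiction (sym s≡z) (Ear.x≢y e)
    -- A third neighbour `t` of `s` outside `L` would be adjacent to `r` by the clique property, but
    -- `r` has only the neighbours `z` and `s`.
    ... | inj₁ s∉ with fresh (r ∷ z ∷ []) (B-nbr b (Ear.vy e))
    ... | t , st , t∉ with out s∉ st
    ... | inj₂ t≡z = contradiction (there (here t≡z)) t∉
    ... | inj₁ t∉L = ⊥-elim ([ t∉ ∘ there ∘ here , E⇒≢ st ∘ sym ]′ (Ear.only e (cl r∉ t∉L (t∉ ∘ here ∘ sym))))
    inner : ∀ {r} xs → r ∉ L → z ∈ xs → length xs < 3 → ∃ λ u → E r u × u ∉ L × u ∉ xs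
    inner xs r∉ z∈xs lt with fresh xs (≤-trans lt (3≤ r∉))
    ... | u , ru , u∉ with out r∉ ru
    ... | inj₁ u∉L = u , ru , u∉L , u∉
    ... | inj₂ refl = contradiction z∈xs u∉
    new∉ : ∀ {r} → r ∉ L → All (r ≢_) xs
    new∉ r∉ = All.tabulate λ x∈ → λ { refl → r∉ (⊆L x∈) }
    conclude : ∃ (_∉ L) → 6 + sum (map w xs) ≤ charge z
    conclude (r , r∉) with inner [ z ] r∉ (here refl) (s≤s (s≤s z≤n))
    ... | s , rs , s∉ , _ with inner (z ∷ s ∷ []) r∉ (here refl) ≤-refl
    ... | t , rt , t∉ , t∉zs = charge≥ (6 + sum (map w xs))
      ((E⇒≢ rs ∷ E⇒≢ rt ∷ new∉ r∉) ∷ ((t∉zs ∘ there ∘ here ∘ sym) ∷ new∉ s∉) ∷ new∉ t∉ ∷ uq)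
      (hub r∉ ∷ hub s∉ ∷ hub t∉ ∷ es)
      (+-mono-≤ (3≤D⇒w (3≤ r∉)) (+-mono-≤ (3≤D⇒w (3≤ s∉)) (+-mono-≤ (3≤D⇒w (3≤ t∉)) ≤-refl)))

  module _ {v₁ v₁′ y₁ v₂ v₂′ y₂} (S : Setting v₁ v₁′ y₁ v₂ v₂′ y₂) where
    open Setting S

    Inner : Fin n → Set
    Inner v = v ∉ v₁ ∷ v₁′ ∷ [] × v ∉ v₂ ∷ v₂′ ∷ []

    -- Two pendants have a total deficit of 8 and `halved-claim` tolerates 5, so a surplus of 3 is
    -- needed. Two inner vertices may share it, and hubs count as inner.
    surplus-goal : ∀ {x y} a b → x ≢ y → Inner x → Inner y → 6 + a ≤ f x → 6 + b ≤ f y → 3 ≤ a + b → Goal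
    surplus-goal {x} {y} a b x≢y (x∉₁ , x∉₂) (y∉₁ , y∉₂) fx fy ab = halved-claim {n} {edgeCount G} {a + b} {4}
        (subst₂ (λ s l → n * 6 + s ≤ 4 * edgeCount G + 2 * l) Σs Σl (account s l pointwise))
        (+-monoʳ-≤ 5 ab)
      where
      s l : Fin n → ℕ
      s v = a * δ x v + b * δ y v
      l v = (δ v₁ v + δ v₁′ v) + (δ v₂ v + δ v₂′ v)
      Σs : Σ[ s ] ≡ a + b
      Σs = trans (sum-map-+ (λ v → a * δ x v) (λ v → b * δ y v) (allFin n)) (cong₂ _+_ (scale a x) (scale b y))
        where
        scale : ∀ a x → Σ[ (λ v → a * δ x v) ] ≡ a
        scale a x = trans (sum-map-* a (δ x) (allFin n)) (trans (cong (a *_) (Σ-δ x)) (*-identityʳ a))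
      Σl : Σ[ l ] ≡ 4
      Σl = trans (sum-map-+ (λ v → δ v₁ v + δ v₁′ v) (λ v → δ v₂ v + δ v₂′ v) (allFin n))
        (cong₂ _+_ (trans (sum-map-+ (δ v₁) (δ v₁′) (allFin n)) (cong₂ _+_ (Σ-δ v₁) (Σ-δ v₁′)))
                   (trans (sum-map-+ (δ v₂) (δ v₂′) (allFin n)) (cong₂ _+_ (Σ-δ v₂) (Σ-δ v₂′))))
      s≡0 : ∀ {v} → v ≢ x → v ≢ y → s v ≡ 0
      s≡0 {v} v≢x v≢y = cong₂ _+_ (trans (cong (a *_) (δ-≢ v≢x)) (*-zeroʳ a)) (trans (cong (b *_) (δ-≢ v≢y)) (*-zeroʳ b))
      low-case : ∀ {v k k′} → v ≢ x → v ≢ y → 6 ≤ f v + 2 * k → k ≤ k′ → 6 + s v ≤ f v + 2 * k′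
      low-case {v} v≢x v≢y le k≤ = ≤-trans (≤-reflexive (cong (6 +_) (s≡0 v≢x v≢y))) (≤-trans le (+-monoʳ-≤ (f v) (*-monoʳ-≤ 2 k≤)))
      normal-case : ∀ {v} → Normal v → 6 + s v ≤ f v
      normal-case {v} nv = by (v ≟ x) (v ≟ y)
        where
        by : Dec (v ≡ x) → Dec (v ≡ y) → 6 + s v ≤ f v
        by (yes refl) _ = ≤-trans (≤-reflexive (cong (6 +_) (trans
          (cong₂ _+_ (trans (cong (a *_) (δ-refl v)) (*-identityʳ a)) (trans (cong (b *_) (δ-≢ x≢y)) (*-zeroʳ b))) (+-identityʳ a)))) fx
        by (no v≢x) (yes refl) = ≤-trans (≤-reflexive (cong (6 +_)
          (cong₂ _+_ (trans (cong (a *_) (δ-≢ v≢x)) (*-zeroʳ a)) (trans (cong (b *_) (δ-refl v)) (*-identityʳ b))))) fy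
        by (no v≢x) (no v≢y) = ≤-trans (≤-reflexive (cong (6 +_) (s≡0 v≢x v≢y))) (f≥6 nv)
      pointwise : ∀ v → 6 + s v ≤ f v + 2 * l v
      pointwise v with v ∈? v₁ ∷ v₁′ ∷ [] | v ∈? v₂ ∷ v₂′ ∷ []
      ... | yes v∈ | _ = low-case {k = δ v₁ v + δ v₁′ v} (λ { refl → x∉₁ v∈ }) (λ { refl → y∉₁ v∈ }) (f-pendant∈ p₁ v∈) (m≤m+n _ _)
      ... | no _ | yes v∈ = low-case {k = δ v₂ v + δ v₂′ v} (λ { refl → x∉₂ v∈ }) (λ { refl → y∉₂ v∈ }) (f-pendant∈ p₂ v∈) (m≤n+m _ (δ v₁ v + δ v₁′ v))
      ... | no v∉₁ | no v∉₂ = ≤-trans (normal-case (normal v∉₁ v∉₂)) (m≤m+n _ _)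

  -- G − y has three components, one of which together with y is a clique.
  common-hub : ∀ {v₁ v₁′ v₂ v₂′ y} → Setting v₁ v₁′ y v₂ v₂′ y → Goal
  common-hub {v₁} {v₁′} {v₂} {v₂′} {y} S = finish (outside L (m≤m+n 6 2))
    where
    open Setting S
    L = v₁ ∷ v₁′ ∷ v₂ ∷ v₂′ ∷ y ∷ []
    A : Fin 2 → List (Fin n)
    A zero = v₁ ∷ v₁′ ∷ []
    A (suc zero) = v₂ ∷ v₂′ ∷ []
    cl-A : ∀ i → WE.Closed (_∈ A i) [ y ]
    cl-A zero = pendant-closed p₁
    cl-A (suc zero) = pendant-closed p₂
    y∉ : ∀ i → y ∉ A i
    y∉ zero = hub∉ p₁ (Pendant.hub p₁)
    y∉ (suc zero) = hub∉ p₂ (Pendant.hub p₂)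
    A⊆L : ∀ i {x} → x ∈ A i → x ∈ L
    A⊆L zero (here eq) = here eq
    A⊆L zero (there (here eq)) = there (here eq)
    A⊆L (suc zero) (here eq) = there (there (here eq))
    A⊆L (suc zero) (there (here eq)) = there (there (there (here eq)))
    disj : ∀ {i j x} → x ∈ A i → x ∈ A j → i ≡ j
    disj {zero} {zero} _ _ = refl
    disj {zero} {suc zero} a b = contradiction a (apart b)
    disj {suc zero} {zero} a b = contradiction b (apart a)
    disj {suc zero} {suc zero} _ _ = refl
    ex : ∀ i → ∃ (_∈ A i)
    ex zero = v₁ , here refl
    ex (suc zero) = v₂ , here refl
    -- The new edge meets neither pendant, so both stay separated from `u` by `y`. The vertex `v`
    -- may be `y`, which yields the edges to the hub as well.
    join : ∀ {u v} → (∀ i → u ∉ A i) → (∀ i → v ∉ A i) → u ≢ y → u ≢ v → E u v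
    join {u} {v} u∉ v∉ u≢y u≢v = forced u≢v (tough-rest (E⁺ u v) E⁺-sym {2} [ y ] (λ i → _∈ A i) (λ i → _∈? A i)
      (λ i → closed∉ {P = _∈ A i} (cl-A i) (u∉ i) (v∉ i)) (λ { i (here refl) → y∉ i }) ex disj ≤-refl
      (λ { (here u≡y) → u≢y u≡y }) u∉)
    L∌ : ∀ {u} → u ∉ L → ∀ i → u ∉ A i
    L∌ u∉ i = u∉ ∘ A⊆L i
    ≢y : ∀ {u} → u ∉ L → u ≢ y
    ≢y u∉ u≡y = u∉ (there (there (there (there (here u≡y)))))
    out : ∀ {r u} → r ∉ L → E r u → u ∉ L ⊎ u ≡ y
    out {r} {u} r∉ e with u ∈? L | u ≟ y
    ... | no u∉ | _ = inj₁ u∉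
    ... | yes _ | yes u≡y = inj₂ u≡y
    ... | yes u∈ | no u≢y = contradiction u∈ λ
      { (here eq) → no-A zero (here eq) ; (there (here eq)) → no-A zero (there (here eq))
      ; (there (there (here eq))) → no-A (suc zero) (here eq) ; (there (there (there (here eq)))) → no-A (suc zero) (there (here eq))
      ; (there (there (there (there (here eq))))) → u≢y eq }
      where
      no-A : ∀ i → u ∉ A i
      no-A i u∈A with cl-A i u∈A (E-sym e)
      ... | inj₁ r∈ = L∌ r∉ i r∈
      ... | inj₂ (here r≡y) = ≢y r∉ r≡y
    finish : ∃ (_∉ L) → Goal
    -- The hub has three neighbours in the clique and one in each pendant, all of weight 2: together
    -- 10, a surplus of 4 at a single vertex. The second vertex only has to be normal.
    finish (r , r∉) = surplus-goal S 4 0 (≢y r∉ ∘ sym) (y∉ zero , y∉ (suc zero)) (L∌ r∉ zero , L∌ r∉ (suc zero)) ten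
        (f≥6 (normal (L∌ r∉ zero) (L∌ r∉ (suc zero)))) (n≤1+n 3)
      where
      ten : 10 ≤ f y
      ten = ≤-trans (≤-trans (+-monoʳ-≤ 6 (+-mono-≤ (pendant-w p₁) (+-mono-≤ (pendant-w p₂) z≤n)))
        (clique-hub L (m≤m+n 6 2) (there (there (there (there (here refl)))))
          (λ u∉ v∉ u≢v → join (L∌ u∉) (L∌ v∉) (≢y u∉) u≢v)
          (λ r∉ → E-sym (join (L∌ r∉) y∉ (≢y r∉) (≢y r∉))) out
          (λ r∉ → normal (L∌ r∉ zero) (L∌ r∉ (suc zero)))
          (v₁ ∷ v₂ ∷ []) (λ { (here eq) → here eq ; (there (here eq)) → there (there (here eq)) })
          (((λ { refl → apart (here refl) (here refl) }) ∷ []) ∷ [] ∷ [])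
          (E-sym (Pendant.vy p₁) ∷ E-sym (Pendant.vy p₂) ∷ []))) (charge≤f y)

  from-new : ∀ {u v q} → u ≢ v → E⁺ u v u q → E u q ⊎ q ≡ v
  from-new u≢v (old e) = inj₁ e
  from-new u≢v new = inj₂ refl
  from-new u≢v wen = contradiction refl u≢v

  -- Two pendants with distinct hubs

  module TwoHubs {v₁ v₁′ y₁ v₂ v₂′ y₂} (S : Setting v₁ v₁′ y₁ v₂ v₂′ y₂) (y₁≢y₂ : y₁ ≢ y₂) where
    open Setting S

    A₁ A₂ : List (Fin n)
    A₁ = v₁ ∷ v₁′ ∷ []
    A₂ = v₂ ∷ v₂′ ∷ []
    y₁∉₁ : y₁ ∉ A₁
    y₁∉₁ = hub∉ p₁ (Pendant.hub p₁)
    y₁∉₂ : y₁ ∉ A₂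
    y₁∉₂ = hub∉ p₂ (Pendant.hub p₁)
    y₂∉₁ : y₂ ∉ A₁
    y₂∉₁ = hub∉ p₁ (Pendant.hub p₂)
    y₂∉₂ : y₂ ∉ A₂
    y₂∉₂ = hub∉ p₂ (Pendant.hub p₂)

    record R (u : Fin n) : Set where
      constructor mkR
      field
        ∉₁ : u ∉ A₁
        ∉₂ : u ∉ A₂
        ≢₁ : u ≢ y₁
        ≢₂ : u ≢ y₂
      inner : Inner S u
      inner = ∉₁ , ∉₂

    R? : ∀ u → Dec (R u)
    R? u with u ∈? A₁ | u ∈? A₂ | u ≟ y₁ | u ≟ y₂
    ... | yes p | _ | _ | _ = no λ r → R.∉₁ r p
    ... | no _ | yes p | _ | _ = no λ r → R.∉₂ r p
    ... | no _ | no _ | yes p | _ = no λ r → R.≢₁ r p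
    ... | no _ | no _ | no _ | yes p = no λ r → R.≢₂ r p
    ... | no a | no b | no c | no d = yes (mkR a b c d)

    -- Pendants and hubs take up at most six of at least eight vertices, so `R` always has two
    -- elements.
    another : ∀ r → ∃ λ u → R u × u ≢ r
    another r with outside (r ∷ v₁ ∷ v₁′ ∷ v₂ ∷ v₂′ ∷ y₁ ∷ y₂ ∷ []) ≤-refl
    ... | u , u∉ = u , mkR (λ { (here p) → u∉ (there (here p)) ; (there (here p)) → u∉ (there (there (here p))) })
        (λ { (here p) → u∉ (there (there (there (here p)))) ; (there (here p)) → u∉ (there (there (there (there (here p))))) })
        (λ p → u∉ (there (there (there (there (there (here p))))))) (λ p → u∉ (there (there (there (there (there (there (here p))))))))
      , λ p → u∉ (here p)

    y₁-nbr : ∀ {q} → E y₁ q → q ∈ A₁ ⊎ q ≡ y₂ ⊎ R q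
    y₁-nbr {q} e with q ∈? A₁ | q ≟ y₂
    ... | yes p | _ = inj₁ p
    ... | no _ | yes p = inj₂ (inj₁ p)
    ... | no q∉ | no q≢ = inj₂ (inj₂ (mkR q∉ (λ q∈ → [ y₁∉₂ , (λ { (here p) → y₁≢y₂ p }) ]′ (pendant-closed p₂ q∈ (E-sym e))) (E⇒≢ e ∘ sym) q≢))

    R-nbr : ∀ {r q} → R r → E r q → q ≡ y₁ ⊎ q ≡ y₂ ⊎ R q
    R-nbr {r} {q} Rr e with q ≟ y₁ | q ≟ y₂
    ... | yes p | _ = inj₁ p
    ... | no _ | yes p = inj₂ (inj₁ p)
    ... | no q≢₁ | no q≢₂ = inj₂ (inj₂ (mkR
      (λ q∈ → [ R.∉₁ Rr , (λ { (here p) → R.≢₁ Rr p }) ]′ (pendant-closed p₁ q∈ (E-sym e)))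
      (λ q∈ → [ R.∉₂ Rr , (λ { (here p) → R.≢₂ Rr p }) ]′ (pendant-closed p₂ q∈ (E-sym e))) q≢₁ q≢₂))

    -- The part of a Hamiltonian path between the two hubs; what lies beyond them is confined to the
    -- pendants.
    record Span (T : Fin n → Fin n → Set) : Set where
      constructor mkSpan
      field
        middle   : List (Fin n)
        unique   : Unique (y₁ ∷ middle ++ [ y₂ ])
        sound    : ∀ {r} → r ∈ middle → R r
        complete : ∀ {r} → R r → r ∈ middle
        linked   : Linked T (y₁ ∷ middle ++ [ y₂ ])

    -- The pendants can be walked through at both ends, which would complete a span to a Hamiltonian
    -- path of `G`.
    ¬span : ¬ Span E
    ¬span (mkSpan M uq so co k) = ¬hamiltonian (WE.hamList (as ++ y₁ ∷ M ++ y₂ ∷ reverse bs)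
        (Uniqueₚ.++⁺ (Extent.unique e₁) (subst Unique (++-assoc (y₁ ∷ M) [ y₂ ] (reverse bs))
            (Uniqueₚ.++⁺ uq (Unique-resp-↭ (↭-sym (↭-reverse bs)) (Extent.unique e₂))
              λ (x∈ , x∈′) → proj₂ (mid∉ x∈) (Extent.sound e₂ (Anyₚ.reverse⁻ x∈′))))
          λ { {x} (x∈ , x∈′) → [ (λ x∈M → proj₁ (mid∉ x∈M) (Extent.sound e₁ x∈))
                          , (λ x∈r → apart (Extent.sound e₂ (Anyₚ.reverse⁻ x∈r)) (Extent.sound e₁ x∈)) ]′
                          (∈-++⁻ (y₁ ∷ M ++ [ y₂ ]) (subst (x ∈_) (sym (++-assoc (y₁ ∷ M) [ y₂ ] (reverse bs))) x∈′)) })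
        all
        (Linked-++ as (Extent.walk e₁ p₁) (Linked-++ (y₁ ∷ M) k
          (subst (Linked E) (reverse-++ bs [ y₂ ]) (Linked-reverse E-sym (Extent.walk e₂ p₂))))))
      where
      e₁ = extent v₁ v₁′ p₁
      e₂ = extent v₂ v₂′ p₂
      as = Extent.vertices e₁
      bs = Extent.vertices e₂
      mid∉ : ∀ {x} → x ∈ y₁ ∷ M ++ [ y₂ ] → Inner S x
      mid∉ (here refl) = y₁∉₁ , y₁∉₂
      mid∉ (there x∈) with ∈-++⁻ M x∈
      ... | inj₁ x∈M = R.inner (so x∈M)
      ... | inj₂ (here refl) = y₂∉₁ , y₂∉₂
      all : ∀ x → x ∈ as ++ y₁ ∷ M ++ y₂ ∷ reverse bs
      all x with x ∈? A₁ | x ∈? A₂ | x ≟ y₁ | x ≟ y₂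
      ... | yes p | _ | _ | _ = ∈-++⁺ˡ (Extent.complete e₁ p)
      ... | no _ | yes p | _ | _ = ∈-++⁺ʳ as (there (∈-++⁺ʳ M (there (Anyₚ.reverse⁺ (Extent.complete e₂ p)))))
      ... | no _ | no _ | yes p | _ = ∈-++⁺ʳ as (here p)
      ... | no _ | no _ | no _ | yes p = ∈-++⁺ʳ as (there (∈-++⁺ʳ M (here p)))
      ... | no a | no b | no c | no d = ∈-++⁺ʳ as (there (∈-++⁺ˡ (co (mkR a b c d))))

    -- A Hamiltonian path starts in one pendant and ends in the other.
    spanning : ∀ {u v} → Inner S u → Inner S v → Hamiltonian⁺ u v → Span (E⁺ u v)
    spanning {u} {v} (u∉₁ , u∉₂) (v∉₁ , v∉₂) = from
      where
      module W = W⁺ u v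
      c₁ : W.Closed (_∈ A₁) [ y₁ ]
      c₁ = closed∉ {P = _∈ A₁} (pendant-closed p₁) u∉₁ v∉₁
      c₂ : W.Closed (_∈ A₂) [ y₂ ]
      c₂ = closed∉ {P = _∈ A₂} (pendant-closed p₂) u∉₂ v∉₂
      core : ∀ x l → Unique (x ∷ l) → (∀ w → w ∈ x ∷ l) → Linked (E⁺ u v) (x ∷ l) → last′ x l ∈ A₂ → Span (E⁺ u v)
      core x l uq c k e with W.end-in c₁ y₁∉₁ k uq (_∈? A₁) (c v₁) (here refl)
      ... | inj₂ e₁ = contradiction e₁ (apart e)
      -- The path now runs from the first pendant to the second. Everything before `y₁` lies in `A₁`
      -- and everything after `y₂` in `A₂`; the stretch between is the span.
      ... | inj₁ x∈ with W.prefix c₁ y₁∉₁ k x∈ (c y₁)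
      ... | [] , bs , eq , _ = contradiction (subst (_∈ A₁) (proj₁ (∷-injective eq)) x∈) y₁∉₁
      ... | a ∷ as , bs , refl , as∈ with W.suffix c₂ y₂∉₂ (Linked-++ʳ (a ∷ as) k) (Unique-++ʳ (a ∷ as) uq) e′ y₂∈
        where
        e′ : last′ y₁ bs ∈ A₂
        e′ = subst (_∈ A₂) (last′-++ a as y₁ bs) e
        y₂∈ : y₂ ∈ y₁ ∷ bs
        y₂∈ = [ (λ y∈ → contradiction (All.lookup as∈ y∈) y₂∉₁) , id ]′ (∈-++⁻ (a ∷ as) (c y₂))
      ... | [] , ds , eq , _ = contradiction (proj₁ (∷-injective eq)) y₁≢y₂
      ... | b ∷ M , ds , eq , ds∈ with ∷-injective eq
      ... | refl , refl = mkSpan M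
          (Unique-++ˡ (y₁ ∷ M ++ [ y₂ ]) (subst Unique (sym (++-assoc (y₁ ∷ M) [ y₂ ] ds)) U)) so co (Linked-++ˡ (y₁ ∷ M) K)
        where
        K : Linked (E⁺ u v) (y₁ ∷ M ++ y₂ ∷ ds)
        K = Linked-++ʳ (a ∷ as) k
        U : Unique (y₁ ∷ M ++ y₂ ∷ ds)
        U = Unique-++ʳ (a ∷ as) uq
        so : ∀ {r} → r ∈ M → R r
        so r∈ = mkR
          (All.lookup (W.avoid← c₁ K (λ { (here refl) → proj₂ (Unique-split [] U) })
            (apart (subst (_∈ A₂) (last′-++ a as y₁ _) e))) (there (∈-++⁺ˡ r∈)))
          (All.lookup (W.avoid→ c₂ (Linked-prefix (y₁ ∷ M) K) (λ { (here refl) → proj₁ (Unique-split (y₁ ∷ M) U) }) y₁∉₂) (there r∈))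
          (λ { refl → proj₂ (Unique-split [] U) (∈-++⁺ˡ r∈) })
          (λ { refl → proj₁ (Unique-split (y₁ ∷ M) U) (there r∈) })
        co : ∀ {r} → R r → r ∈ M
        co {r} Rr with ∈-++⁻ (a ∷ as) (c r)
        ... | inj₁ r∈ = contradiction (All.lookup as∈ r∈) (R.∉₁ Rr)
        ... | inj₂ (here p) = contradiction p (R.≢₁ Rr)
        ... | inj₂ (there r∈) with ∈-++⁻ M r∈
        ... | inj₁ r∈M = r∈M
        ... | inj₂ (here p) = contradiction p (R.≢₂ Rr)
        ... | inj₂ (there r∈ds) = contradiction (All.lookup ds∈ r∈ds) (R.∉₂ Rr)
      backwards : ∀ x m → Unique (m ++ [ x ]) → (∀ w → w ∈ m ++ [ x ]) → Linked (E⁺ u v) (m ++ [ x ]) → x ∈ A₂ → Span (E⁺ u v)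
      backwards x [] uq c k x∈ = core x [] uq c k x∈
      backwards x (h ∷ t) uq c k x∈ = core h (t ++ [ x ]) uq c k (subst (_∈ A₂) (sym (last′-++ h t x [])) x∈)
      from : Hamiltonian⁺ u v → Span (E⁺ u v)
      from (Walks.hamList [] uq c k) with c u
      ... | ()
      from (Walks.hamList (x ∷ l) uq c k) with W.end-in c₂ y₂∉₂ k uq (_∈? A₂) (c v₂) (here refl)
      ... | inj₂ e = core x l uq c k e
      ... | inj₁ x∈ = backwards x (reverse l) (subst Unique eq (Unique-resp-↭ (↭-sym (↭-reverse (x ∷ l))) uq))
              (λ w → subst (w ∈_) eq (Anyₚ.reverse⁺ (c w))) (subst (Linked (E⁺ u v)) eq (Linked-reverse E⁺-sym k)) x∈
        where
        eq = unfold-reverse x l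

    span⁺ : ∀ {u v} → Inner S u → Inner S v → u ≢ v → ¬ E u v → Span (E⁺ u v)
    span⁺ iu iv u≢v ¬e = spanning iu iv (hamiltonian⁺ u≢v ¬e)

    in₁ : Inner S y₁
    in₁ = y₁∉₁ , y₁∉₂
    in₂ : Inner S y₂
    in₂ = y₂∉₁ , y₂∉₂

    -- By `¬span` the new edge `y₁u` is used, and `y₁` occurs only at the beginning, so the first
    -- step is the one that uses it.
    first-edge : ∀ {u} → y₁ ≢ u → (s : Span (E⁺ y₁ u)) → ∃ λ M → Span.middle s ≡ u ∷ M
    first-edge y₁≢u (mkSpan [] uq so co k) with co (proj₁ (proj₂ (another y₁)))
    ... | ()
    first-edge y₁≢u (mkSpan (m ∷ M) uq so co (e ∷ k)) with from-new y₁≢u e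
    ... | inj₁ e′ = contradiction (mkSpan (m ∷ M) uq so co (e′ ∷ Linked-old (proj₂ (Unique-split [] uq)) k)) ¬span
    ... | inj₂ refl = M , refl

    -- By `first-edge` a span in `G` + `y₁y₂` would pass from `y₁` to `y₂` at once, while `R` still
    -- has to be visited in between.
    hubs-adjacent : E y₁ y₂
    hubs-adjacent with E? y₁ y₂
    ... | yes e = e
    ... | no ¬e with span⁺ in₁ in₂ y₁≢y₂ ¬e
    ... | s with first-edge y₁≢y₂ s
    ... | M , eq = contradiction refl (R.≢₂ (Span.sound s (subst (y₂ ∈_) (sym eq) (here refl))))

    ¬v₁y₂ : ¬ E v₁ y₂
    ¬v₁y₂ e with pendant-closed p₁ (here refl) e
    ... | inj₁ y∈ = y₂∉₁ y∈
    ... | inj₂ (here p) = y₁≢y₂ (sym p)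

    v₁≢y₂ : v₁ ≢ y₂
    v₁≢y₂ p = y₂∉₁ (here (sym p))

    -- The removal of `y₂` would separate the first pendant with `y₁` and `W`, the second pendant,
    -- and the part containing `u`. The nonedge `v₁y₂` has an end at the cut vertex, so its addition
    -- would not create a Hamiltonian path.
    no-cut : ∀ W → All R W → (∀ {p q} → p ∈ y₁ ∷ W → E p q → q ∈ A₁ ⊎ q ∈ y₁ ∷ W ⊎ q ≡ y₂) → ∀ {u} → R u → u ∉ W → ⊥
    no-cut W RW cl {u} Ru u∉W = ¬v₁y₂ (forced v₁≢y₂ (tough-rest (E⁺ v₁ y₂) E⁺-sym {2} [ y₂ ] (λ i → _∈ C i) (λ i → _∈? C i) cl-C ¬S ex disj ≤-refl
        (λ { (here p) → R.≢₂ Ru p }) ¬Cu))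
      where
      C : Fin 2 → List (Fin n)
      C zero = v₁ ∷ v₁′ ∷ y₁ ∷ W
      C (suc zero) = A₂
      A₁⊆C : ∀ {x} → x ∈ A₁ → x ∈ C zero
      A₁⊆C (here p) = here p
      A₁⊆C (there (here p)) = there (here p)
      C-cases : ∀ {x} → x ∈ C zero → x ∈ A₁ ⊎ x ∈ y₁ ∷ W
      C-cases (here p) = inj₁ (here p)
      C-cases (there (here p)) = inj₁ (there (here p))
      C-cases (there (there x∈)) = inj₂ x∈
      closed : ∀ i → WE.Closed (_∈ C i) [ y₂ ]
      closed zero p∈ e with C-cases p∈
      ... | inj₁ p∈A = [ inj₁ ∘ A₁⊆C , (λ { (here p) → inj₁ (there (there (here p))) }) ]′ (pendant-closed p₁ p∈A e)
      ... | inj₂ p∈W = [ inj₁ ∘ A₁⊆C , [ inj₁ ∘ there ∘ there , inj₂ ∘ here ]′ ]′ (cl p∈W e)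
      closed (suc zero) = pendant-closed p₂
      ¬S : ∀ i {s} → s ∈ [ y₂ ] → s ∉ C i
      ¬S zero (here refl) y∈ with C-cases y∈
      ... | inj₁ y∈A = y₂∉₁ y∈A
      ... | inj₂ (here p) = y₁≢y₂ (sym p)
      ... | inj₂ (there y∈W) = R.≢₂ (All.lookup RW y∈W) refl
      ¬S (suc zero) (here refl) = y₂∉₂
      cl-C : ∀ i → W⁺.Closed v₁ y₂ (_∈ C i) [ y₂ ]
      cl-C i = closed⁺ {P = _∈ C i} (closed i) (λ _ → inj₂ (here refl)) (λ y∈ → contradiction y∈ (¬S i (here refl)))
      ex : ∀ i → ∃ (_∈ C i)
      ex zero = v₁ , here refl
      ex (suc zero) = v₂ , here refl
      C∩A₂ : ∀ {x} → x ∈ C zero → x ∉ A₂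
      C∩A₂ x∈ x∈₂ with C-cases x∈
      ... | inj₁ x∈₁ = apart x∈₂ x∈₁
      ... | inj₂ (here refl) = y₁∉₂ x∈₂
      ... | inj₂ (there x∈W) = R.∉₂ (All.lookup RW x∈W) x∈₂
      disj : ∀ {i j x} → x ∈ C i → x ∈ C j → i ≡ j
      disj {zero} {zero} _ _ = refl
      disj {zero} {suc zero} a b = contradiction b (C∩A₂ a)
      disj {suc zero} {zero} a b = contradiction a (C∩A₂ b)
      disj {suc zero} {suc zero} _ _ = refl
      ¬Cu : ∀ i → u ∉ C i
      ¬Cu zero u∈ with C-cases u∈
      ... | inj₁ p = R.∉₁ Ru p
      ... | inj₂ (here p) = R.≢₁ Ru p
      ... | inj₂ (there p) = u∉W p
      ¬Cu (suc zero) = R.∉₂ Ru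

    -- The removal of `a` and `y₂` would separate `C`, the second pendant, `r`, and the part
    -- containing `u`: four parts for two cut vertices. As in `no-cut`, adding `v₁y₂` would not
    -- help.
    no-ear : ∀ C {a r u} → v₁ ∈ C → (∀ {p q} → p ∈ C → E p q → q ∈ C ⊎ q ∈ a ∷ y₂ ∷ []) → a ∉ C → y₂ ∉ C → (∀ {x} → x ∈ C → x ∉ A₂) →
      a ∉ A₂ → R r → r ∉ C → R u → u ∉ C → u ≢ a → u ≢ r → ¬ Ear r a y₂
    no-ear C {a} {r} {u} v₁∈ cl a∉ y₂∉ C∩A₂ a∉₂ Rr r∉ Ru u∉ u≢a u≢r ea = ¬v₁y₂ (forced v₁≢y₂
        (tough-rest (E⁺ v₁ y₂) E⁺-sym {3} (a ∷ y₂ ∷ []) (λ i → _∈ P i) (λ i → _∈? P i) cl-P ¬S ex disj ≤-refl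
        (λ { (here p) → u≢a p ; (there (here p)) → R.≢₂ Ru p }) ¬Pu))
      where
      P : Fin 3 → List (Fin n)
      P zero = C
      P (suc zero) = A₂
      P (suc (suc zero)) = [ r ]
      closed : ∀ i → WE.Closed (_∈ P i) (a ∷ y₂ ∷ [])
      closed zero = cl
      closed (suc zero) p∈ e = [ inj₁ , inj₂ ∘ there ]′ (pendant-closed p₂ p∈ e)
      closed (suc (suc zero)) (here refl) e = [ inj₂ ∘ here , inj₂ ∘ there ∘ here ]′ (Ear.only ea e)
      ¬S : ∀ i {s} → s ∈ a ∷ y₂ ∷ [] → s ∉ P i
      ¬S zero (here refl) = a∉
      ¬S zero (there (here refl)) = y₂∉
      ¬S (suc zero) (here refl) = a∉₂
      ¬S (suc zero) (there (here refl)) = y₂∉₂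
      ¬S (suc (suc zero)) (here refl) (here p) = E⇒≢ (Ear.vx ea) (sym p)
      ¬S (suc (suc zero)) (there (here refl)) (here p) = E⇒≢ (Ear.vy ea) (sym p)
      cl-P : ∀ i → W⁺.Closed v₁ y₂ (_∈ P i) (a ∷ y₂ ∷ [])
      cl-P i = closed⁺ {P = _∈ P i} (closed i) (λ _ → inj₂ (there (here refl))) (λ y∈ → contradiction y∈ (¬S i (there (here refl))))
      ex : ∀ i → ∃ (_∈ P i)
      ex zero = v₁ , v₁∈
      ex (suc zero) = v₂ , here refl
      ex (suc (suc zero)) = r , here refl
      disj : ∀ {i j x} → x ∈ P i → x ∈ P j → i ≡ j
      disj {zero} {zero} _ _ = refl
      disj {zero} {suc zero} a b = contradiction b (C∩A₂ a)
      disj {zero} {suc (suc zero)} a (here refl) = contradiction a r∉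
      disj {suc zero} {zero} a b = contradiction a (C∩A₂ b)
      disj {suc zero} {suc zero} _ _ = refl
      disj {suc zero} {suc (suc zero)} a (here refl) = contradiction a (R.∉₂ Rr)
      disj {suc (suc zero)} {zero} (here refl) b = contradiction b r∉
      disj {suc (suc zero)} {suc zero} (here refl) b = contradiction b (R.∉₂ Rr)
      disj {suc (suc zero)} {suc (suc zero)} _ _ = refl
      ¬Pu : ∀ i → u ∉ P i
      ¬Pu zero = u∉
      ¬Pu (suc zero) = R.∉₂ Ru
      ¬Pu (suc (suc zero)) (here p) = u≢r p

    hub-neighbour : ∃ λ z → R z × E y₁ z
    hub-neighbour with any? (λ z → R? z ×-dec E? y₁ z)
    ... | yes p = p
    ... | no ¬p = let u , Ru , _ = another y₁ in
      ⊥-elim (no-cut [] [] (λ { (here refl) e → [ inj₁ , [ inj₂ ∘ inj₂ , (λ Rq → contradiction (_ , Rq , e) ¬p) ]′ ]′ (y₁-nbr e) }) Ru (λ ()))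

    no-hub-ear : ∀ {r} → R r → ¬ Ear r y₁ y₂
    no-hub-ear {r} Rr = let u , Ru , u≢r = another r in
      no-ear A₁ (here refl) (λ p∈ e → [ inj₁ , (λ { (here p) → inj₂ (here p) }) ]′ (pendant-closed p₁ p∈ e)) y₁∉₁ y₂∉₁ (λ x∈ x∈₂ → apart x∈₂ x∈)
        y₁∉₂ Rr (R.∉₁ Rr) Ru (R.∉₁ Ru) (R.≢₁ Ru) u≢r

    -- A path through the new edge y₁u starts y₁ u …, leaving an ear at y₁ with one usable neighbour.
    ear-full : ∀ {r s} → R r → Ear r y₁ s → ∀ {u} → R u → E y₁ u
    ear-full {r} {s} Rr e {u} Ru with E? y₁ u
    ... | yes p = p
    ... | no ¬p with span⁺ in₁ (R.inner Ru) (R.≢₁ Ru ∘ sym) ¬p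
    ... | sp with first-edge (R.≢₁ Ru ∘ sym) sp
    ear-full {r} {s} Rr e {u} Ru | no ¬p | mkSpan _ uq so co (_ ∷ k) | M , refl
      with co Rr
    ... | here refl = contradiction (E-sym (Ear.vx e)) ¬p
    ... | there r∈ with inner-neighbours M (AllPairs.tail uq) k r∈
    ... | p , q , pr , rq , p∈ , q∈ , p≢q = contradiction (trans (is-s (E⁺-sym pr) p∈) (sym (is-s rq q∈))) p≢q
      where
      r≢u : r ≢ u
      r≢u refl = ¬p (E-sym (Ear.vx e))
      is-s : ∀ {x} → E⁺ y₁ u r x → x ∈ u ∷ M ++ [ y₂ ] → x ≡ s
      is-s rx x∈ with Ear.only e (old∉ (R.≢₁ Rr) r≢u rx)
      ... | inj₁ refl = contradiction x∈ (proj₂ (Unique-split [] uq))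
      ... | inj₂ x≡s = x≡s

    -- The 4 is the weight of the neighbours `v₁` and `y₂` of the hub.
    charge-hub : ∀ {r s} k → R r → R s → r ≢ s → E y₁ r → E y₁ s → k ≤ w r + w s → 4 + k ≤ charge y₁
    charge-hub {r} {s} k Rr Rs r≢s yr ys le = charge≥ (4 + k)
      ((v₁≢y₂ ∷ (λ p → R.∉₁ Rr (here (sym p))) ∷ (λ p → R.∉₁ Rs (here (sym p))) ∷ []) ∷ ((R.≢₂ Rr ∘ sym) ∷ (R.≢₂ Rs ∘ sym) ∷ []) ∷ (r≢s ∷ []) ∷ [] ∷ [])
      (E-sym (Pendant.vy p₁) ∷ hubs-adjacent ∷ yr ∷ ys ∷ [])
      (+-mono-≤ (pendant-w p₁) (+-mono-≤ (3≤D⇒w (Pendant.hub p₂)) (≤-trans le (≤-reflexive (cong (w r +_) (sym (+-identityʳ (w s))))))))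

    -- A hub has surplus 2, or surplus 1 because of an ear at it. The second case keeps the ear and
    -- the adjacency of the hub to all of `R`, since these exclude the same case at the other hub.
    Side : Set
    Side = 8 ≤ charge y₁ ⊎ (7 ≤ charge y₁ × ∃₂ λ r s → R r × R s × Ear r y₁ s × (∀ {u} → R u → E y₁ u))

    side : ∀ {z z′} → R z → R z′ → z ≢ z′ → E y₁ z → E y₁ z′ → Side
    side {z} {z′} Rz Rz′ z≢z′ yz yz′ = by (B? z) (B? z′)
      where
      full : ∀ {r} → R r → E y₁ r → B r → Side
      full {r} Rr yr b with ear-at (B.degree b) (E-sym yr)
      ... | s , e with R-nbr Rr (Ear.vy e)
      ... | inj₁ s≡y = contradiction (sym s≡y) (Ear.x≢y e)
      ... | inj₂ (inj₁ refl) = contradiction e (no-hub-ear Rr)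
      ... | inj₂ (inj₂ Rs) = inj₂ (charge-hub 3 Rr Rs (E⇒≢ (Ear.vy e)) yr (Ear.xy e) (+-mono-≤ (1≤w r) (3≤D⇒w (B-nbr b (Ear.vy e))))
                                 , r , s , Rr , Rs , e , ear-full Rr e)
      by : Dec (B z) → Dec (B z′) → Side
      by (yes b) _ = full Rz yz b
      by (no _) (yes b) = full Rz′ yz′ b
      by (no ¬b) (no ¬b′) = inj₁ (charge-hub 4 Rz Rz′ z≢z′ yz yz′ (+-mono-≤ (¬B⇒w ¬b) (¬B⇒w ¬b′)))

    -- A hub with a single neighbour in `R`

    module Single {z} (Rz : R z) (yz : E y₁ z) (only : ∀ {u} → R u → E y₁ u → u ≡ z) where

      zy₂ : E z y₂
      zy₂ with E? z y₂
      ... | yes e = e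
      ... | no ¬e = ⊥-elim (bad (span⁺ (R.inner Rz) in₂ (R.≢₂ Rz) ¬e))
        where
        bad : ¬ Span (E⁺ z y₂)
        bad (mkSpan [] uq so co k) with co Rz
        ... | ()
        bad (mkSpan (m ∷ M) uq so co (e ∷ k)) with only (so (here refl)) (old∉ (R.≢₁ Rz ∘ sym) y₁≢y₂ e)
        bad (mkSpan (_ ∷ []) uq so co (e ∷ k)) | refl with another z
        ... | u , Ru , u≢z with co Ru
        ... | here u≡z = u≢z u≡z
        bad s@(mkSpan (_ ∷ m′ ∷ M) uq@(_ ∷ z∉ ∷ _) so co (e ∷ e′ ∷ k)) | refl with from-new (R.≢₂ Rz) e′
        ... | inj₂ m′≡y = R.≢₂ (so (there (here refl))) m′≡y
        ... | inj₁ zm = ¬span (mkSpan _ uq so co (yz ∷ zm ∷ Linked-old (λ z∈ → All.lookup z∉ z∈ refl) k))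

      -- Otherwise y₂ separates three components.
      z-neighbour : ∃ λ r → R r × r ≢ z × E z r
      z-neighbour with any? (λ r → R? r ×-dec (¬? (r ≟ z) ×-dec E? z r))
      ... | yes p = p
      ... | no ¬p = let u , Ru , u≢z = another z in ⊥-elim (no-cut [ z ] (Rz ∷ []) cl Ru (λ { (here p) → u≢z p }))
        where
        cl : ∀ {p q} → p ∈ y₁ ∷ z ∷ [] → E p q → q ∈ A₁ ⊎ q ∈ y₁ ∷ z ∷ [] ⊎ q ≡ y₂
        cl (here refl) e = [ inj₁ , [ inj₂ ∘ inj₂ , (λ Rq → inj₂ (inj₁ (there (here (only Rq e))))) ]′ ]′ (y₁-nbr e)
        cl (there (here refl)) e with R-nbr Rz e
        ... | inj₁ p = inj₂ (inj₁ (here p))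
        ... | inj₂ (inj₁ p) = inj₂ (inj₂ p)
        ... | inj₂ (inj₂ Rq) = contradiction (_ , Rq , E⇒≢ e ∘ sym , e) ¬p

      D-z : 3 ≤ D z
      D-z = let r , Rr , _ , zr = z-neighbour in
        length≤D ((y₁≢y₂ ∷ (R.≢₁ Rr ∘ sym) ∷ []) ∷ ((R.≢₂ Rr ∘ sym) ∷ []) ∷ [] ∷ []) (E-sym yz ∷ zy₂ ∷ zr ∷ [])

      two-vertices : ∀ {r} → R r → r ≢ z → (∀ {u} → R u → u ≡ z ⊎ u ≡ r) → E z r → ¬ E r y₂
      two-vertices {r} Rr r≢z all zr ry = ¬span (mkSpan (z ∷ r ∷ [])
        (((R.≢₁ Rz ∘ sym) ∷ (R.≢₁ Rr ∘ sym) ∷ y₁≢y₂ ∷ []) ∷ ((r≢z ∘ sym) ∷ R.≢₂ Rz ∷ []) ∷ (R.≢₂ Rr ∷ []) ∷ [] ∷ [])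
        (λ { (here refl) → Rz ; (there (here refl)) → Rr }) ([ here , there ∘ here ]′ ∘ all) (yz ∷ zr ∷ ry ∷ [-]))

      -- If `R` has a third vertex, this is `no-ear` with `y₁` moved into the first part and `z`
      -- taking its place in the cutset. If not, `y₁ z r y₂` is a span.
      no-z-ear : ∀ {r} → R r → ¬ Ear r z y₂
      no-z-ear {r} Rr e with any? (λ u → R? u ×-dec (¬? (u ≟ z) ×-dec ¬? (u ≟ r)))
      ... | yes (u , Ru , u≢z , u≢r) = no-ear C (here refl) cl (∉C Rz) y₂∉C C∩A₂ (R.∉₂ Rz) Rr (∉C Rr) Ru (∉C Ru) u≢z u≢r e
        where
        C = v₁ ∷ v₁′ ∷ y₁ ∷ []
        ∉C : ∀ {x} → R x → x ∉ C
        ∉C Rx (here p) = R.∉₁ Rx (here p)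
        ∉C Rx (there (here p)) = R.∉₁ Rx (there (here p))
        ∉C Rx (there (there (here p))) = R.≢₁ Rx p
        y₂∉C : y₂ ∉ C
        y₂∉C (here p) = y₂∉₁ (here p)
        y₂∉C (there (here p)) = y₂∉₁ (there (here p))
        y₂∉C (there (there (here p))) = y₁≢y₂ (sym p)
        C∩A₂ : ∀ {x} → x ∈ C → x ∉ A₂
        C∩A₂ (here refl) x∈ = apart x∈ (here refl)
        C∩A₂ (there (here refl)) x∈ = apart x∈ (there (here refl))
        C∩A₂ (there (there (here refl))) = y₁∉₂
        lift : ∀ {x} → x ∈ A₁ → x ∈ C
        lift (here p) = here p
        lift (there (here p)) = there (here p)
        into : ∀ {q} → q ∈ A₁ ⊎ q ∈ [ y₁ ] → q ∈ C ⊎ q ∈ z ∷ y₂ ∷ []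
        into (inj₁ q∈) = inj₁ (lift q∈)
        into (inj₂ (here p)) = inj₁ (there (there (here p)))
        cl : ∀ {p q} → p ∈ C → E p q → q ∈ C ⊎ q ∈ z ∷ y₂ ∷ []
        cl (here refl) e = into (pendant-closed p₁ (here refl) e)
        cl (there (here refl)) e = into (pendant-closed p₁ (there (here refl)) e)
        cl (there (there (here refl))) e with y₁-nbr e
        ... | inj₁ q∈ = inj₁ (lift q∈)
        ... | inj₂ (inj₁ p) = inj₂ (there (here p))
        ... | inj₂ (inj₂ Rq) = inj₂ (here (only Rq e))
      ... | no ¬p = two-vertices Rr (E⇒≢ (Ear.vx e)) all (E-sym (Ear.vx e)) (Ear.vy e)
        where
        all : ∀ {u} → R u → u ≡ z ⊎ u ≡ r
        all {u} Ru with u ≟ z | u ≟ r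
        ... | yes p | _ = inj₁ p
        ... | no _ | yes p = inj₂ p
        ... | no a | no b = contradiction (u , Ru , a , b) ¬p

      -- The ear at `k` is not on `z` and `y₂` by `no-z-ear`, and `k` is not adjacent to `y₁`. Its
      -- other vertex `t` therefore lies in `R` and gives `x` a neighbour of weight 2 besides the
      -- light `k`.
      B-partner : ∀ {k x} → R k → k ≢ z → B k → (x ≡ y₂ ⊎ x ≡ z) → E x k →
        ∃ λ t → R t × t ≢ z × t ≢ k × E x t × 3 ≤ D t
      B-partner {k} {x} Rk k≢z b x≡ xk with ear-at (B.degree b) (E-sym xk)
      ... | t , e = t , Rt , t≢z , E⇒≢ (Ear.vy e) ∘ sym , Ear.xy e , B-nbr b (Ear.vy e)
        where
        flip-ear : ∀ {v x y} → Ear v x y → Ear v y x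
        flip-ear (ear a b c d f) = ear b a (c ∘ sym) (E-sym d) ([ inj₂ , inj₁ ]′ ∘ f)
        t≢z : t ≢ z
        t≢z t≡z = [ (λ x≡y₂ → no-z-ear Rk (subst₂ (Ear k) t≡z x≡y₂ (flip-ear e))) , (λ x≡z → Ear.x≢y e (trans x≡z (sym t≡z))) ]′ x≡
        Rt : R t
        Rt with R-nbr Rk (Ear.vy e)
        ... | inj₁ refl = contradiction (only Rk (E-sym (Ear.vy e))) k≢z
        ... | inj₂ (inj₂ r) = r
        ... | inj₂ (inj₁ t≡y₂) = [ (λ x≡y₂ → contradiction (trans x≡y₂ (sym t≡y₂)) (Ear.x≢y e))
                                 , (λ x≡z → contradiction (subst₂ (Ear k) x≡z t≡y₂ e) (no-z-ear Rk)) ]′ x≡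

      -- Four neighbours of weight 2: `v₂`, `y₁`, `z`, and `s` or, if `s` lies in `B`, its partner.
      y₂-surplus : ∀ {s} → R s → s ≢ z → E y₂ s → 8 ≤ charge y₂
      y₂-surplus {s} Rs s≢z ys = by (B? s)
        where
        v₂≢ : ∀ {x} → R x → v₂ ≢ x
        v₂≢ Rx p = R.∉₂ Rx (here (sym p))
        v₂≢y₁ : v₂ ≢ y₁
        v₂≢y₁ p = y₁∉₂ (here (sym p))
        by : Dec (B s) → 8 ≤ charge y₂
        by (no ¬b) = charge≥ 8
          ((v₂≢y₁ ∷ v₂≢ Rz ∷ v₂≢ Rs ∷ []) ∷ ((R.≢₁ Rz ∘ sym) ∷ (R.≢₁ Rs ∘ sym) ∷ []) ∷ ((s≢z ∘ sym) ∷ []) ∷ [] ∷ [])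
          (E-sym (Pendant.vy p₂) ∷ E-sym hubs-adjacent ∷ E-sym zy₂ ∷ ys ∷ [])
          (+-mono-≤ (pendant-w p₂) (+-mono-≤ (3≤D⇒w (Pendant.hub p₁)) (+-mono-≤ (3≤D⇒w D-z) (+-mono-≤ (¬B⇒w ¬b) z≤n))))
        by (yes b) with B-partner Rs s≢z b (inj₁ refl) ys
        ... | t , Rt , t≢z , t≢s , yt , 3t = charge≥ 8
          ((v₂≢y₁ ∷ v₂≢ Rz ∷ v₂≢ Rt ∷ []) ∷ ((R.≢₁ Rz ∘ sym) ∷ (R.≢₁ Rt ∘ sym) ∷ []) ∷ ((t≢z ∘ sym) ∷ []) ∷ [] ∷ [])
          (E-sym (Pendant.vy p₂) ∷ E-sym hubs-adjacent ∷ E-sym zy₂ ∷ yt ∷ [])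
          (+-mono-≤ (pendant-w p₂) (+-mono-≤ (3≤D⇒w (Pendant.hub p₁)) (+-mono-≤ (3≤D⇒w D-z) (+-mono-≤ (3≤D⇒w 3t) z≤n))))

      -- Otherwise `z` has only the neighbours `y₁`, `y₂` and `r`. A span in `G` + `y₁r` begins
      -- `y₁ r`, so `z` must be visited between `r` and `y₂`, which leaves `R` with the two elements
      -- `r` and `z`. Then `s` is `r`, and `two-vertices` applies.
      z-degree : ∀ {r s} → R r → r ≢ z → E z r → R s → s ≢ z → E y₂ s → 4 ≤ D z
      z-degree {r} {s} Rr r≢z zr Rs s≢z ys with 4 ≤? D z
      ... | yes p = p
      ... | no ¬p = ⊥-elim (bad (span⁺ in₁ (R.inner Rr) (R.≢₁ Rr ∘ sym) (λ e → r≢z (only Rr e))))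
        where
        Nz : ∀ {u} → R u → E z u → u ≡ r
        Nz Ru e with saturated (≤-pred (≰⇒> ¬p)) ((y₁≢y₂ ∷ (R.≢₁ Rr ∘ sym) ∷ []) ∷ ((R.≢₂ Rr ∘ sym) ∷ []) ∷ [] ∷ []) (E-sym yz ∷ zy₂ ∷ zr ∷ []) e
        ... | here q = contradiction q (R.≢₁ Ru)
        ... | there (here q) = contradiction q (R.≢₂ Ru)
        ... | there (there (here q)) = q
        old-z : ∀ {u} → E⁺ y₁ r z u → E z u
        old-z = old∉ (R.≢₁ Rz) (r≢z ∘ sym)
        bad : ¬ Span (E⁺ y₁ r)
        bad sp with first-edge (R.≢₁ Rr ∘ sym) sp
        bad (mkSpan _ uq so co k) | M , refl with co Rz
        ... | here z≡r = r≢z (sym z≡r)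
        bad (mkSpan _ (_ ∷ r∉ ∷ uq) so co (_ ∷ _ ∷ k)) | m ∷ M , refl | there (there z∈) with predecessor M k z∈
        ... | p , pz , p∈ = All.lookup r∉ (∈-++⁺ˡ p∈) (sym (Nz (so (there p∈)) (old-z (E⁺-sym pz))))
        bad (mkSpan _ (_ ∷ r∉ ∷ uq) so co (_ ∷ _ ∷ e ∷ k)) | m ∷ m′ ∷ M , refl | there (here refl) =
          All.lookup r∉ (there (here refl)) (sym (Nz (so (there (there (here refl)))) (old-z e)))
        bad (mkSpan _ uq so co _) | _ ∷ [] , refl | there (here refl) with co Rs
        ... | there (here s≡z) = s≢z s≡z
        ... | here refl = two-vertices Rr r≢z (λ Ru → case (co Ru)) zr (E-sym ys)
          where
          case : ∀ {u} → u ∈ r ∷ z ∷ [] → u ≡ z ⊎ u ≡ r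
          case (here p) = inj₂ p
          case (there (here p)) = inj₁ p

      -- The two hubs give 4. The remaining 3 come from `r` and its partner if `r` lies in `B`, and
      -- otherwise from `r` and the fourth neighbour provided by `z-degree`.
      z-surplus : ∀ {s} → R s → s ≢ z → E y₂ s → 7 ≤ charge z
      z-surplus {s} Rs s≢z ys with z-neighbour
      ... | r , Rr , r≢z , zr = by (B? r)
        where
        weigh : ∀ {t} → E z t → t ≢ y₁ → t ≢ y₂ → t ≢ r → 3 ≤ w r + w t → 7 ≤ charge z
        weigh {t} zt t≢₁ t≢₂ t≢r le = charge≥ 7
          ((y₁≢y₂ ∷ (R.≢₁ Rr ∘ sym) ∷ (t≢₁ ∘ sym) ∷ []) ∷ ((R.≢₂ Rr ∘ sym) ∷ (t≢₂ ∘ sym) ∷ []) ∷ ((t≢r ∘ sym) ∷ []) ∷ [] ∷ [])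
          (E-sym yz ∷ zy₂ ∷ zr ∷ zt ∷ [])
          (+-mono-≤ (3≤D⇒w (Pendant.hub p₁)) (+-mono-≤ (3≤D⇒w (Pendant.hub p₂)) (≤-trans le (≤-reflexive (cong (w r +_) (sym (+-identityʳ (w t))))))))
        by : Dec (B r) → 7 ≤ charge z
        by (yes b) with B-partner Rr r≢z b (inj₂ refl) zr
        ... | t , Rt , t≢z , t≢r , zt , 3t = weigh zt (R.≢₁ Rt) (R.≢₂ Rt) t≢r (+-mono-≤ (1≤w r) (3≤D⇒w 3t))
        by (no ¬b) with fresh (y₁ ∷ y₂ ∷ r ∷ []) (z-degree Rr r≢z zr Rs s≢z ys)
        ... | t , zt , t∉ = weigh zt (t∉ ∘ here) (t∉ ∘ there ∘ here) (t∉ ∘ there ∘ there ∘ here) (+-mono-≤ (¬B⇒w ¬b) (1≤w t))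

      -- z separates R from the rest, so R is a clique.
      both-single : (∀ {s} → R s → E y₂ s → s ≡ z) → Goal
      both-single only₂ = surplus-goal S 4 0 (R.≢₁ Rz) (R.inner Rz) in₁
          (≤-trans (≤-trans (+-monoʳ-≤ 6 (+-mono-≤ (3≤D⇒w (Pendant.hub p₁)) (+-mono-≤ (3≤D⇒w (Pendant.hub p₂)) z≤n)))
            (clique-hub L (≤-refl) (here refl) (λ u∉ v∉ → join (L∌ u∉) (L∌ v∉)) (λ r∉ → E-sym (join (L∌ r∉) Rz (≢z r∉))) out
              (λ r∉ → normal (R.∉₁ (L∌ r∉)) (R.∉₂ (L∌ r∉))) (y₁ ∷ y₂ ∷ [])
              (λ { (here p) → there (there (there (there (there (here p))))) ; (there (here p)) → there (there (there (there (there (there (here p)))))) })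
              ((y₁≢y₂ ∷ []) ∷ [] ∷ []) (E-sym yz ∷ zy₂ ∷ []))) (charge≤f z))
          (f≥6 (inj₂ (Pendant.hub p₁))) (n≤1+n 3)
        where
        L = z ∷ v₁ ∷ v₁′ ∷ v₂ ∷ v₂′ ∷ y₁ ∷ y₂ ∷ []
        L∌ : ∀ {u} → u ∉ L → R u
        L∌ u∉ = mkR (λ { (here p) → u∉ (there (here p)) ; (there (here p)) → u∉ (there (there (here p))) })
          (λ { (here p) → u∉ (there (there (there (here p)))) ; (there (here p)) → u∉ (there (there (there (there (here p))))) })
          (λ p → u∉ (there (there (there (there (there (here p))))))) (λ p → u∉ (there (there (there (there (there (there (here p))))))))
        ≢z : ∀ {u} → u ∉ L → u ≢ z
        ≢z u∉ p = u∉ (here p)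
        ∉L : ∀ {u} → R u → u ≢ z → u ∉ L
        ∉L Ru u≢z (here p) = u≢z p
        ∉L Ru u≢z (there (here p)) = R.∉₁ Ru (here p)
        ∉L Ru u≢z (there (there (here p))) = R.∉₁ Ru (there (here p))
        ∉L Ru u≢z (there (there (there (here p)))) = R.∉₂ Ru (here p)
        ∉L Ru u≢z (there (there (there (there (here p))))) = R.∉₂ Ru (there (here p))
        ∉L Ru u≢z (there (there (there (there (there (here p)))))) = R.≢₁ Ru p
        ∉L Ru u≢z (there (there (there (there (there (there (here p))))))) = R.≢₂ Ru p
        enter : ∀ {u} → R u → u ∉ L ⊎ u ≡ z
        enter {u} Ru with u ≟ z
        ... | yes p = inj₂ p
        ... | no u≢z = inj₁ (∉L Ru u≢z)
        out : ∀ {r u} → r ∉ L → E r u → u ∉ L ⊎ u ≡ z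
        out r∉ e with R-nbr (L∌ r∉) e
        ... | inj₁ refl = contradiction (only (L∌ r∉) (E-sym e)) (≢z r∉)
        ... | inj₂ (inj₁ refl) = contradiction (only₂ (L∌ r∉) (E-sym e)) (≢z r∉)
        ... | inj₂ (inj₂ Ru) = enter Ru
        join : ∀ {u v} → R u → R v → u ≢ v → E u v
        join {u} {v} Ru Rv u≢v = forced u≢v (W⁺.three-ends u v (_∈? A₁) (_∈? A₂) (λ x → ¬? (x ∈? L))
          (closed∉ {P = _∈ A₁} (pendant-closed p₁) (R.∉₁ Ru) (R.∉₁ Rv)) (closed∉ {P = _∈ A₂} (pendant-closed p₂) (R.∉₂ Ru) (R.∉₂ Rv))
          (closed⁺ {P = _∉ L} (λ r∉ e → [ inj₁ , inj₂ ∘ here ]′ (out r∉ e))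
            (λ _ → [ inj₁ , inj₂ ∘ here ]′ (enter Rv)) (λ _ → [ inj₁ , inj₂ ∘ here ]′ (enter Ru)))
          y₁∉₁ y₂∉₂ (λ z∉ → z∉ (here refl)) (v₁ , here refl) (v₂ , here refl) (outside L ≤-refl)
          (λ a b → apart b a) (λ a x∉ → R.∉₁ (L∌ x∉) a) (λ a x∉ → R.∉₂ (L∌ x∉) a))

      goal : Goal
      goal with any? (λ s → R? s ×-dec (¬? (s ≟ z) ×-dec E? y₂ s))
      -- A surplus of 2 at `y₂` and of 1 at `z` is exactly what is required; `y₁` itself contributes
      -- none.
      ... | yes (s , Rs , s≢z , ys) = surplus-goal S 2 1 (R.≢₂ Rz ∘ sym) in₂ (R.inner Rz)
              (≤-trans (y₂-surplus Rs s≢z ys) (charge≤f y₂)) (≤-trans (z-surplus Rs s≢z ys) (charge≤f z)) ≤-refl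
      ... | no ¬p = both-single only₂
        where
        only₂ : ∀ {s} → R s → E y₂ s → s ≡ z
        only₂ {s} Rs ys with s ≟ z
        ... | yes p = p
        ... | no s≢z = contradiction (s , Rs , s≢z , ys) ¬p

    goal-or-side : Goal ⊎ Side
    goal-or-side with hub-neighbour
    ... | z , Rz , yz with any? (λ u → R? u ×-dec (¬? (u ≟ z) ×-dec E? y₁ u))
    ... | yes (u , Ru , u≢z , yu) = inj₂ (side Ru Rz u≢z yu yz)
    ... | no ¬p = inj₁ (Single.goal Rz yz only)
      where
      only : ∀ {u} → R u → E y₁ u → u ≡ z
      only {u} Ru e with u ≟ z
      ... | yes p = p
      ... | no u≢z = contradiction (u , Ru , u≢z , e) ¬p

  distinct-hubs : ∀ {v₁ v₁′ y₁ v₂ v₂′ y₂} → Setting v₁ v₁′ y₁ v₂ v₂′ y₂ → y₁ ≢ y₂ → Goal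
  distinct-hubs {v₁} {v₁′} {y₁} {v₂} {v₂′} {y₂} S y₁≢y₂ = by T₁.goal-or-side T₂.goal-or-side
    where
    module T₁ = TwoHubs S y₁≢y₂
    module T₂ = TwoHubs (swap-setting S) (y₁≢y₂ ∘ sym)
    finish : ∀ a b → 6 + a ≤ charge y₁ → 6 + b ≤ charge y₂ → 3 ≤ a + b → Goal
    finish a b h₁ h₂ = surplus-goal S a b y₁≢y₂ T₁.in₁ T₁.in₂ (≤-trans h₁ (charge≤f y₁)) (≤-trans h₂ (charge≤f y₂))
    by : Goal ⊎ T₁.Side → Goal ⊎ T₂.Side → Goal
    by (inj₁ g) _ = g
    by (inj₂ _) (inj₁ g) = g
    by (inj₂ (inj₁ h₁)) (inj₂ (inj₁ h₂)) = finish 2 2 h₁ h₂ (n≤1+n 3)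
    by (inj₂ (inj₁ h₁)) (inj₂ (inj₂ (h₂ , _))) = finish 2 1 h₁ h₂ ≤-refl
    by (inj₂ (inj₂ (h₁ , _))) (inj₂ (inj₁ h₂)) = finish 1 2 h₁ h₂ ≤-refl
    -- Surplus 1 at both hubs would not suffice, but it cannot occur: `y₂` would be adjacent to all
    -- of `R`, hence to `r`, whose only neighbours are `y₁` and `s`.
    by (inj₂ (inj₂ (_ , r , s , Rr , Rs , e , _))) (inj₂ (inj₂ (_ , _ , _ , _ , _ , _ , full))) =
      ⊥-elim ([ (λ p → y₁≢y₂ (sym p)) , (λ p → T₁.R.≢₂ Rs (sym p)) ]′ (Ear.only e (E-sym (full
        (T₂.mkR (T₁.R.∉₂ Rr) (T₁.R.∉₁ Rr) (T₁.R.≢₂ Rr) (T₁.R.≢₁ Rr))))))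

  zero-sum : Σ[ (λ (_ : Fin n) → 0) ] ≡ 0
  zero-sum = trans (Σ-const {n} 0) (*-zeroʳ n)

  edge-bound : Goal
  edge-bound with search []
  ... | inj₁ g = g
  ... | inj₂ (inj₂ nrm) = halved-claim {s = 0} {l = 0} (subst₂ (λ s l → n * 6 + s ≤ 4 * edgeCount G + 2 * l) zero-sum zero-sum
          (account (λ _ → 0) (λ _ → 0) (λ v → ≤-trans (f≥6 (nrm v (λ ()))) (m≤m+n _ _)))) z≤n
  ... | inj₂ (inj₁ (v₁ , _ , v₁′ , y₁ , p₁)) with search (v₁ ∷ v₁′ ∷ [])
  ... | inj₁ g = g
  -- A single pendant has deficit 4, which is tolerated without any surplus.
  ... | inj₂ (inj₂ nrm) = halved-claim {s = 0} {l = 2} (subst₂ (λ s l → n * 6 + s ≤ 4 * edgeCount G + 2 * l) zero-sum two-sum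
          (account (λ _ → 0) (λ v → δ v₁ v + δ v₁′ v) pointwise)) (n≤1+n 4)
    where
    two-sum : Σ[ (λ v → δ v₁ v + δ v₁′ v) ] ≡ 2
    two-sum = trans (sum-map-+ (δ v₁) (δ v₁′) (allFin n)) (cong₂ _+_ (Σ-δ v₁) (Σ-δ v₁′))
    pointwise : ∀ v → 6 ≤ f v + 2 * (δ v₁ v + δ v₁′ v)
    pointwise v with v ∈? v₁ ∷ v₁′ ∷ []
    ... | yes v∈ = f-pendant∈ p₁ v∈
    ... | no v∉ = ≤-trans (f≥6 (nrm v v∉)) (m≤m+n _ _)
  ... | inj₂ (inj₁ (v₂ , v₂∉ , v₂′ , y₂ , p₂)) with search (v₁ ∷ v₁′ ∷ v₂ ∷ v₂′ ∷ [])
  ... | inj₁ g = g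
  ... | inj₂ (inj₁ (v₃ , v₃∉ , v₃′ , y₃ , p₃)) = ThreePendants.goal p₁ p₂ p₃ v₂∉
          (λ { (here p) → v₃∉ (here p) ; (there (here p)) → v₃∉ (there (here p)) })
          (λ { (here p) → v₃∉ (there (there (here p))) ; (there (here p)) → v₃∉ (there (there (there (here p)))) })
  ... | inj₂ (inj₂ nrm) = by (y₁ ≟ y₂)
    where
    S : Setting v₁ v₁′ y₁ v₂ v₂′ y₂
    S = record { p₁ = p₁ ; p₂ = p₂ ; apart = pendants-disjoint p₁ p₂ v₂∉ ; normal = λ {v} a b → nrm v
      λ { (here p) → a (here p) ; (there (here p)) → a (there (here p)) ; (there (there (here p))) → b (here p) ; (there (there (there (here p)))) → b (there (here p)) } }
    by : Dec (y₁ ≡ y₂) → Goal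
    by (yes refl) = common-hub S
    by (no y₁≢y₂) = distinct-hubs S y₁≢y₂

theorem9 : ∀ (n : ℕ) (G : Graph n) → MaximalNontraceable G →
    (n ≡ 8 → 10 ≤ edgeCount G) ×
    (n ≡ 9 → 12 ≤ edgeCount G) ×
    (10 ≤ n → 3 * n ≤ 2 * edgeCount G + 2)
theorem9 n G mnt with 8 ≤? n
... | yes 8≤n = TwoPendants.edge-bound G mnt 8≤n
... | no 8≰n = (λ { refl → contradiction ≤-refl 8≰n }) , (λ { refl → contradiction (n≤1+n 8) 8≰n })
             , λ 10≤n → contradiction (≤-trans (m≤m+n 8 2) 10≤n) 8≰n
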